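{- Let $q$ be a positive integer and let $\mathscr{B}\colon X\to^? q$ be a Borel CSP on a standard Borel space $X$. Suppose that $\mathrm{asi}(G_{\mathscr{B}})\leq 1$. If \[ \mathsf{p}(\mathscr{B})\,(\mathsf{d}(\mathscr{B})+1)^{2}\,\leq\, e^{ -2}, \] then $\mathscr{B}$ has a Borel solution $f\colon X\to q$.
   Context: $\mathbb{N}=\{0,1,2,\dots\}$, and $q\in\mathbb{N}$ is identified with $\{0,\dots,q-1\}$. CSPs. Let $X$ be a set and $q$ a positive integer. An $(X,q)$-constraint with domain a finite set $D\subseteq X$ is a set $B\subseteq q^D$ of functions $D\to q$; write $\mathrm{dom}(B)=D$. A function $f\colon X\to q$ violates $B$ if $f|_{\mathrm{dom}(B)}\in B$, and satisfies $B$ otherwise. A constraint satisfaction problem (CSP) $\mathscr{B}\colon X\to^? q$ is a set of $(X,q)$-constraints; a solution to it is a function $f\colon X\to q$ satisfying every $B\in\mathscr{B}$. Put $\mathbb{P}[B]=|B|/q^{|\mathrm{dom}(B)|}$, $\mathsf{p}(\mathscr{B})=\sup_{B\in\mathscr{B}}\mathbb{P}[B]$, and $\mathsf{d}(\mathscr{B})=\sup_{B\in\mathscr{B}}|\{B'\in\mathscr{B}: B'\neq B,\ \mathrm{dom}(B')\cap\mathrm{dom}(B)\neq\varnothing\}|$. Inequalities involving $\mathsf{d}(\mathscr{B})$ are understood to include $\mathsf{d}(\mathscr{B})<\infty$. $G_{\mathscr{B}}$ is the graph with vertex set $X$ in which distinct $x,y$ are adjacent iff some $B\in\mathscr{B}$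 has $x,y\in\mathrm{dom}(B)$. Borel CSPs. For a standard Borel space $X$, the set $[X]^k$ of $k$-element subsets carries the quotient standard Borel structure from the $k$-tuples of distinct points, and the set $[X]^{<\infty}=\bigsqcup_k[X]^k$ of finite subsets carries the disjoint union structure. The set of finite partial functions $X\rightharpoonup q$ (identified with their graphs) is a Borel subset of $[X\times q]^{<\infty}$. The set $\mathrm{Const}(X,q)$ of all $(X,q)$-constraints, viewed as finite sets of finite partial functions $X\rightharpoonup q$ with a common domain, is a Borel subset of the space of finite subsets of that space, hence is standard Borel. A CSP $\mathscr{B}\colon X\to^? q$ is Borel if it is a Borel subset of $\mathrm{Const}(X,q)$. (If $\mathscr{B}$ is Borel and $\mathsf{d}(\mathscr{B})<\infty$, then $G_{\mathscr{B}}$ is a locally finite Borel graph, i.e. its adjacency relation is Borel in $X^2$.) Asymptotic separation index. A graph is component-finite if all its connected components are finite. For a Borel graph $G$, $\mathrm{si}(G)$ is the smallest $s\in\mathbb{N}$ for which there is a partition $V(G)=U_0\sqcup\dots\sqcup U_s$ into $s+1$ Borel sets such that every induced subgraph $G[U_i]$ is component-finite ($\infty$ if no such $s$ exists). For $R\in\mathbb{N}$, $G^R$ is the graph on $V(G)$ in which two distinct vertices are adjacent iff they are joined by a path of at most $R$ edges in $G$. Then $\mathrm{asi}(G)=\sup_{R\in\mathbb{N}}\mathrm{si}(G^R)$. -}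

module Defs where

open import Level using (0ℓ; Lift)
open import Data.Unit using (⊤)
open import Data.Fin.Base using (Fin; zero)
open import Data.Integer.Base as ℤ using (ℤ; +_)
open import Data.List.Base using (length)
open import Data.Maybe.Base using (Maybe; just)
open import Data.Nat.Base as ℕ using (ℕ; zero; suc; _!; NonZero)
open import Data.Nat.Properties using (m^n≢0; _!≢0)
open import Data.Product.Base using (Σ; ∃; ∃₂; Σ-syntax; ∃-syntax; _×_; _,_; proj₁; proj₂; map₂)
open import Data.Product using (∃!)
open import Data.Product.Relation.Binary.Pointwise.NonDependent using (_×ₛ_)
open import Data.Rational.Base as ℚ using (ℚ; 0ℚ)
open import Data.Rational.Properties as ℚ using ()
open import Data.Vec.Functional.Relation.Binary.Equality.Setoid using (≋-setoid)
open import Function.Base using (_∘_)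
open import Function.Bundles using (_⇔_; Func; _⟶ₛ_; mk⇔)
open import Function.Metric.Structures using (IsGeneralMetric)
open import Relation.Binary.Bundles using (Setoid)
open import Relation.Binary.Construct.Closure.ReflexiveTransitive using (Star)
open import Relation.Binary.Core using (Rel)
open import Relation.Binary.Definitions using (_Respects_)
open import Relation.Binary.PropositionalEquality.Core as ≡ using (_≡_)
open import Relation.Binary.PropositionalEquality.Properties as ≡ using ()
open import Relation.Binary.Structures using (IsEquivalence)
import Relation.Binary.Construct.On as On
import Data.List.Membership.Setoid as Membership
open import Relation.Nullary.Negation.Core using (¬_)
open import Relation.Unary using (Pred; ∁; ⋃; ∅; _≐_; _∈_; _⊆_)

open Setoid using (Carrier)

-- An element x of [-∞, ∞] is given by its strict upper cut, the set of
-- rationals r with x < r.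

record ℝ∞ : Set₁ where
  field
    _<ℚ_    : Pred ℚ 0ℓ
    rounded : ∀ {r} → _<ℚ_ r ⇔ (∃[ s ] s ℚ.< r × _<ℚ_ s)

open ℝ∞ public using (_<ℚ_)

inf : Pred ℚ 0ℓ → ℝ∞
inf P = record
  { _<ℚ_    = λ r → ∃[ s ] s ℚ.< r × P s
  ; rounded = mk⇔
      (λ (s , s<r , p) → let (t , s<t , t<r) = ℚ.<-dense s<r in t , t<r , s , s<t , p)
      (λ (t , t<r , s , s<t , p) → s , ℚ.<-trans s<t t<r , p)
  }

infix 4 _≤_ _≃_

_≤_ _≃_ : Rel ℝ∞ 0ℓ
x ≤ y = ∀ {r} → y <ℚ r → x <ℚ r
x ≃ y = x ≤ y × y ≤ x

Finite : Pred ℝ∞ 0ℓ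
Finite x = (∃[ r ] x <ℚ r) × (∃[ r ] ¬ x <ℚ r)

infixl 6 _+_
infixl 7 _·_

0ℝ : ℝ∞
0ℝ = inf (_≡ 0ℚ)

_+_ : ℝ∞ → ℝ∞ → ℝ∞
x + y = inf λ r → ∃₂ λ s t → x <ℚ s × y <ℚ t × r ≡ s ℚ.+ t

_·_ : ℕ → ℝ∞ → ℝ∞
m · x = inf λ r → ∃[ s ] x <ℚ s × r ≡ (+ m ℚ./ 1) ℚ.* s

expSum : ℤ → ℕ → ℚ
expSum z zero    = ℚ.1ℚ
expSum z (suc n) = expSum z n ℚ.+ ((z ℤ.^ suc n) ℚ./ (suc n !)) {{suc n !≢0}}

-- The limit of the partial sums, written as their limit superior.

exp : ℤ → ℝ∞
exp z = inf λ s → ∃[ N ] (∀ n → N ℕ.≤ n → expSum z n ℚ.≤ s)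

-- "Borel A" says that A belongs to the chosen σ-algebra.  Points are
-- compared by the setoid equality, and so measurable sets must respect it.

record BorelSpace : Set₂ where
  field
    setoid   : Setoid 0ℓ 0ℓ
    Borel    : Pred (Pred (Carrier setoid) 0ℓ) (Level.suc 0ℓ)
    respects : ∀ {A} → Borel A → A Respects (Setoid._≈_ setoid)
    resp-≐   : ∀ {A B} → A ≐ B → Borel A → Borel B
    ∅-Borel  : Borel ∅
    ∁-Borel  : ∀ {A} → Borel A → Borel (∁ A)
    ⋃-Borel  : ∀ {A : ℕ → Pred (Carrier setoid) 0ℓ} → (∀ n → Borel (A n)) → Borel (⋃ ℕ A)

  open Setoid setoid public using (_≈_) renaming (Carrier to Point)
  open Membership setoid public using () renaming (_∈_ to _∈ˡ_)

  HasAtMost : ℕ → Pred (Pred Point 0ℓ) 0ℓ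
  HasAtMost n A = ∃[ xs ] length xs ℕ.≤ n × (∀ {x} → x ∈ A → x ∈ˡ xs)

  IsFinite : Pred (Pred Point 0ℓ) 0ℓ
  IsFinite A = ∃[ xs ] (∀ {x} → x ∈ A → x ∈ˡ xs)

open BorelSpace public using (Point; Borel; setoid)

IsBorelMap : (X Y : BorelSpace) → Func (setoid X) (setoid Y) → Set₁
IsBorelMap X Y f = ∀ {A} → Borel Y A → Borel X (A ∘ Func.to f)

data σ {X : Set} (G : Pred (Pred X 0ℓ) (Level.suc 0ℓ)) : Pred (Pred X 0ℓ) (Level.suc 0ℓ) where
  gen  : ∀ {A} → G A → σ G A
  resp : ∀ {A B} → A ≐ B → σ G A → σ G B
  ∅-σ  : σ G ∅
  ∁-σ  : ∀ {A} → σ G A → σ G (∁ A)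
  ⋃-σ  : ∀ {A : ℕ → Pred X 0ℓ} → (∀ n → σ G (A n)) → σ G (⋃ ℕ A)

generated : (S : Setoid 0ℓ 0ℓ) (G : Pred (Pred (Carrier S) 0ℓ) (Level.suc 0ℓ)) →
            (∀ {A} → G A → A Respects (Setoid._≈_ S)) → BorelSpace
generated S G G-respects = record
  { setoid   = S
  ; Borel    = σ G
  ; respects = σ-respects
  ; resp-≐   = resp
  ; ∅-Borel  = ∅-σ
  ; ∁-Borel  = ∁-σ
  ; ⋃-Borel  = ⋃-σ
  }
  where
  σ-respects : ∀ {A} → σ G A → A Respects (Setoid._≈_ S)
  σ-respects (gen g)           = G-respects g
  σ-respects (resp (f , g) b) e = f ∘ σ-respects b e ∘ g
  σ-respects ∅-σ             e = λ ()
  σ-respects (∁-σ b)         e = λ ¬a → ¬a ∘ σ-respects b (Setoid.sym S e)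
  σ-respects (⋃-σ b)         e = λ (n , a) → n , σ-respects (b n) e a

discrete : Set → BorelSpace
discrete A = record
  { setoid   = ≡.setoid A
  ; Borel    = λ _ → Lift _ ⊤
  ; respects = λ { _ ≡.refl a → a }
  }

-- The product σ-algebras are generated by the preimages of measurable
-- sets under the coordinate projections.

infixr 2 _⊗_
infix  8 _^_

data Cylinder× (X Y : BorelSpace) : Pred (Pred (Point X × Point Y) 0ℓ) (Level.suc 0ℓ) where
  left  : ∀ {A} → Borel X A → Cylinder× X Y (A ∘ proj₁)
  right : ∀ {A} → Borel Y A → Cylinder× X Y (A ∘ proj₂)

_⊗_ : BorelSpace → BorelSpace → BorelSpace
X ⊗ Y = generated (setoid X ×ₛ setoid Y) (Cylinder× X Y)
  λ { (left a) (e , _) → BorelSpace.respects X a e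
    ; (right a) (_ , e) → BorelSpace.respects Y a e }

data Cylinder^ (X : BorelSpace) (k : ℕ) : Pred (Pred (Fin k → Point X) 0ℓ) (Level.suc 0ℓ) where
  at : ∀ i {A} → Borel X A → Cylinder^ X k (λ t → A (t i))

_^_ : BorelSpace → ℕ → BorelSpace
X ^ k = generated (≋-setoid (setoid X) k) (Cylinder^ X k)
  λ { (at i a) e → BorelSpace.respects X a (e i) }

Subspace : (X : BorelSpace) → Pred (Point X) 0ℓ → BorelSpace
Subspace X P = record
  { setoid   = record { Carrier       = ∃ P
                      ; isEquivalence = On.isEquivalence proj₁ (Setoid.isEquivalence (setoid X)) }
  ; Borel    = λ A → ∃[ B ] Borel X B × A ≐ B ∘ proj₁
  ; respects = λ (B , b , f , g) e → g ∘ BorelSpace.respects X b e ∘ f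
  ; resp-≐   = λ (f , g) (B , b , f′ , g′) → B , b , (f′ ∘ g , f ∘ g′)
  ; ∅-Borel  = ∅ , BorelSpace.∅-Borel X , (λ ()) , λ ()
  ; ∁-Borel  = λ (B , b , f , g) → ∁ B , BorelSpace.∁-Borel X b , (_∘ g) , (_∘ f)
  ; ⋃-Borel  = λ h → ⋃ ℕ (proj₁ ∘ h) , BorelSpace.⋃-Borel X (proj₁ ∘ proj₂ ∘ h)
                     , (λ (n , a) → n , proj₁ (proj₂ (proj₂ (h n))) a)
                     , (λ (n , a) → n , proj₂ (proj₂ (proj₂ (h n))) a)
  }

Quotient : (X : BorelSpace) (_∼_ : Rel (Point X) 0ℓ) → IsEquivalence _∼_ → BorelSpace
Quotient X _∼_ isEq = record
  { setoid   = record { isEquivalence = isEq }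
  ; Borel    = λ A → Borel X A × A Respects _∼_
  ; respects = proj₂
  ; resp-≐   = λ (f , g) (b , r) → BorelSpace.resp-≐ X (f , g) b , λ e → f ∘ r e ∘ g
  ; ∅-Borel  = BorelSpace.∅-Borel X , λ _ ()
  ; ∁-Borel  = λ (b , r) → BorelSpace.∁-Borel X b , λ e → _∘ r (IsEquivalence.sym isEq e)
  ; ⋃-Borel  = λ h → BorelSpace.⋃-Borel X (proj₁ ∘ h) , λ e (n , a) → n , proj₂ (h n) e a
  }

data ⨆-≈ (X : ℕ → BorelSpace) : Rel (∃ (Point ∘ X)) 0ℓ where
  same : ∀ {k s t} → BorelSpace._≈_ (X k) s t → ⨆-≈ X (k , s) (k , t)

⨆ : (ℕ → BorelSpace) → BorelSpace
⨆ X = record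
  { setoid   = record
      { _≈_           = ⨆-≈ X
      ; isEquivalence = record
          { refl  = λ {(k , _)} → same (Setoid.refl (setoid (X k)))
          ; sym   = λ { (same {k} e) → same (Setoid.sym (setoid (X k)) e) }
          ; trans = λ { (same {k} e) (same e′) → same (Setoid.trans (setoid (X k)) e e′) }
          }
      }
  ; Borel    = λ A → ∀ k → Borel (X k) (A ∘ (k ,_))
  ; respects = λ { b (same {k} e) → BorelSpace.respects (X k) (b k) e }
  ; resp-≐   = λ (f , g) b k → BorelSpace.resp-≐ (X k) (f , g) (b k)
  ; ∅-Borel  = λ k → BorelSpace.∅-Borel (X k)
  ; ∁-Borel  = λ b k → BorelSpace.∁-Borel (X k) (b k)
  ; ⋃-Borel  = λ b k → BorelSpace.⋃-Borel (X k) (λ n → b n k)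
  }

-- The dense sequence is Maybe-valued so that the empty space is included.

record PolishMetric (S : Setoid 0ℓ 0ℓ) : Set₁ where
  open Setoid S using (_≈_) renaming (Carrier to Pt)
  field
    dist     : Pt → Pt → ℝ∞
    isMetric : IsGeneralMetric _≈_ _≃_ _≤_ 0ℝ _+_ dist
    finite   : ∀ x y → Finite (dist x y)

  Cauchy : Pred (ℕ → Pt) 0ℓ
  Cauchy s = ∀ ε → 0ℚ ℚ.< ε → ∃[ N ] (∀ m n → N ℕ.≤ m → N ℕ.≤ n → dist (s m) (s n) <ℚ ε)

  _⟶_ : (ℕ → Pt) → Pt → Set
  s ⟶ x = ∀ ε → 0ℚ ℚ.< ε → ∃[ N ] (∀ n → N ℕ.≤ n → dist (s n) x <ℚ ε)

  Open : Pred (Pred Pt 0ℓ) 0ℓ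
  Open U = ∀ {x} → x ∈ U → ∃[ ε ] 0ℚ ℚ.< ε × (∀ {y} → dist x y <ℚ ε → y ∈ U)

  field
    complete  : ∀ s → Cauchy s → ∃[ x ] s ⟶ x
    separable : Σ[ e ∈ (ℕ → Maybe Pt) ]
                (∀ x ε → 0ℚ ℚ.< ε → ∃₂ λ n y → e n ≡ just y × dist x y <ℚ ε)

record IsStandardBorel (X : BorelSpace) : Set₁ where
  field
    metric : PolishMetric (setoid X)
    borel  : ∀ {A} → Borel X A ⇔ σ (λ U → Lift _ (PolishMetric.Open metric U)) A

module _ (X : BorelSpace) where
  open BorelSpace X using (_≈_)
  private module S = Setoid (setoid X)

  Distinct : ∀ {k} → Pred (Fin k → Point X) 0ℓ
  Distinct t = ∀ i j → t i ≈ t j → i ≡ j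

  SameImage : ∀ {k} → Rel (∃ (Distinct {k})) 0ℓ
  SameImage (s , _) (t , _) = (∀ i → ∃[ j ] s i ≈ t j) × (∀ j → ∃[ i ] s i ≈ t j)

  SameImage-isEquivalence : ∀ {k} → IsEquivalence (SameImage {k})
  SameImage-isEquivalence = record
    { refl  = (λ i → i , S.refl) , (λ i → i , S.refl)
    ; sym   = λ (f , g) → (λ i → map₂ S.sym (g i)) , (λ j → map₂ S.sym (f j))
    ; trans = λ (f , g) (f′ , g′) →
        (λ i → let (j , e) = f i ; (k , e′) = f′ j in k , S.trans e e′) ,
        (λ k → let (j , e′) = g′ k ; (i , e) = g j in i , S.trans e e′)
    }

infix 8 [_]^_ [_]^<∞

[_]^_ : BorelSpace → ℕ → BorelSpace
[ X ]^ k = Quotient (Subspace (X ^ k) (Distinct X)) (SameImage X) (SameImage-isEquivalence X)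

[_]^<∞ : BorelSpace → BorelSpace
[ X ]^<∞ = ⨆ ([ X ]^_)

module FiniteSubset (X : BorelSpace) where
  open BorelSpace X using (_≈_)

  ∣_∣ : Point [ X ]^<∞ → ℕ
  ∣ k , _ ∣ = k

  infix 4 _∈ᶠ_
  _∈ᶠ_ : Point X → Point [ X ]^<∞ → Set
  x ∈ᶠ (_ , t , _) = ∃[ i ] x ≈ t i

module Graph (X : BorelSpace) where
  open BorelSpace X using (_≈_)

  Induced : Rel (Point X) 0ℓ → Pred (Point X) 0ℓ → Rel (Point X) 0ℓ
  Induced G U x y = x ∈ U × y ∈ U × G x y

  ComponentFinite : Rel (Point X) 0ℓ → Pred (Point X) 0ℓ → Set
  ComponentFinite G U = ∀ {x} → x ∈ U → BorelSpace.IsFinite X (Star (Induced G U) x)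

  data Walk (G : Rel (Point X) 0ℓ) : ℕ → Rel (Point X) 0ℓ where
    stop : ∀ {R x y} → x ≈ y → Walk G R x y
    step : ∀ {R x y z} → G x y → Walk G R y z → Walk G (suc R) x z

  Power : Rel (Point X) 0ℓ → ℕ → Rel (Point X) 0ℓ
  Power G R x y = ¬ x ≈ y × Walk G R x y

  record Separation (G : Rel (Point X) 0ℓ) (s : ℕ) : Set₁ where
    field
      U               : Fin (suc s) → Pred (Point X) 0ℓ
      borel           : ∀ i → Borel X (U i)
      partition       : ∀ x → ∃! _≡_ λ i → x ∈ U i
      componentFinite : ∀ i → ComponentFinite G (U i)

  si_≤_ : Rel (Point X) 0ℓ → ℕ → Set₁
  si G ≤ s = ∃[ s′ ] s′ ℕ.≤ s × Separation G s′

  asi_≤_ : Rel (Point X) 0ℓ → ℕ → Set₁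
  asi G ≤ s = ∀ R → si (Power G R) ≤ s

module CSP (X : BorelSpace) (q : ℕ) where
  open BorelSpace X using (_≈_)

  open FiniteSubset (X ⊗ discrete (Fin q)) using () renaming (∣_∣ to ∣_∣ᵍ; _∈ᶠ_ to _∈ᵍ_)

  IsPartialFunction : Pred (Point [ X ⊗ discrete (Fin q) ]^<∞) 0ℓ
  IsPartialFunction g = ∀ {x y a b} → (x , a) ∈ᵍ g → (y , b) ∈ᵍ g → x ≈ y → a ≡ b

  PartialFunction : BorelSpace
  PartialFunction = Subspace [ X ⊗ discrete (Fin q) ]^<∞ IsPartialFunction

  graph : Point PartialFunction → Point [ X ⊗ discrete (Fin q) ]^<∞
  graph = proj₁

  domᵖ : Point PartialFunction → Pred (Point X) 0ℓ
  domᵖ g x = ∃[ a ] (x , a) ∈ᵍ graph g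

  open FiniteSubset PartialFunction using (∣_∣; _∈ᶠ_)

  HasCommonDomain : Pred (Point [ PartialFunction ]^<∞) 0ℓ
  HasCommonDomain B = ∀ {g h} → g ∈ᶠ B → h ∈ᶠ B → domᵖ g ⊆ domᵖ h

  Const : BorelSpace
  Const = Subspace [ PartialFunction ]^<∞ HasCommonDomain

  elements : Point Const → Point [ PartialFunction ]^<∞
  elements = proj₁

  -- As a set of partial functions, the empty constraint does not determine
  -- a domain; it is given the empty one.

  dom : Point Const → Pred (Point X) 0ℓ
  dom B x = ∃[ g ] g ∈ᶠ elements B × x ∈ domᵖ g

  ∣dom_∣ : Point Const → ℕ
  ∣dom (zero  , _)     , _ ∣ = 0
  ∣dom (suc _ , t , _) , _ ∣ = ∣ graph (t zero) ∣ᵍ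

  Violates : (Point X → Fin q) → Pred (Point Const) 0ℓ
  Violates f B = ∃[ g ] g ∈ᶠ elements B ×
                 (∀ {x a} → (x , a) ∈ᵍ graph g ⇔ (x ∈ dom B × f x ≡ a))

  IsSolution : Pred (Point Const) 0ℓ → Pred (Point X → Fin q) 0ℓ
  IsSolution 𝓑 f = ∀ {B} → B ∈ 𝓑 → ¬ Violates f B

  ℙ : .{{_ : NonZero q}} → Point Const → ℚ
  ℙ B = (+ ∣ elements B ∣ ℚ./ (q ℕ.^ ∣dom B ∣)) {{m^n≢0 q ∣dom B ∣}}

  -- The rationals s ≥ 0 bounding every ℙ B have as infimum the supremum of
  -- the ℙ B in [0, ∞], which is 0 when there are no constraints.

  𝗉 : .{{_ : NonZero q}} → Pred (Point Const) 0ℓ → ℝ∞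
  𝗉 𝓑 = inf λ s → 0ℚ ℚ.≤ s × (∀ {B} → B ∈ 𝓑 → ℙ B ℚ.≤ s)

  Neighbours : Pred (Point Const) 0ℓ → Point Const → Pred (Point Const) 0ℓ
  Neighbours 𝓑 B B′ = B′ ∈ 𝓑 × ¬ (BorelSpace._≈_ Const B′ B) × ∃[ x ] x ∈ dom B′ × x ∈ dom B

  DegreeBound : Pred (Point Const) 0ℓ → Pred ℕ 0ℓ
  DegreeBound 𝓑 n = ∀ {B} → B ∈ 𝓑 → BorelSpace.HasAtMost Const n (Neighbours 𝓑 B)

  𝖽_≡_ : Pred (Point Const) 0ℓ → ℕ → Set
  𝖽 𝓑 ≡ n = DegreeBound 𝓑 n × (∀ m → DegreeBound 𝓑 m → n ℕ.≤ m)

  G[_] : Pred (Point Const) 0ℓ → Rel (Point X) 0ℓ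
  G[ 𝓑 ] x y = ¬ x ≈ y × ∃[ B ] B ∈ 𝓑 × x ∈ dom B × y ∈ dom B

-- A single pair of component-finite Borel sets U and ∁U separating G suffices.
-- Put c = δ^d / (1+δ)^(d+1) for δ = max d 1; this is at least 1 / (e (d+1)), so
-- the hypothesis gives ℙ B ≤ c².  For random values on U, Markov's inequality
-- bounds by c the probability that the conditional probability of violating B
-- exceeds c.  So the Lovász local lemma in the finite components of U yields
-- values on U for which all conditional probabilities are at most c, and a
-- second application, in the components of ∁U, extends them to a solution.
--
-- For the choices to be Borel, the values on a component are described by one of
-- countably many codes.  The points in whose component a given code fails form
-- an analytic set, and these sets have empty intersection; Novikov's theorem
-- encloses them in Borel sets with empty intersection.  By Lusin's theorem, the
-- complements can be saturated to Borel sets that are unions of components,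
-- and every component uses the first code that is available to it.
--
-- Since ∃ is a Σ-type, excluded middle is also a choice principle here.

module Submission where

open import Axiom.DoubleNegationElimination using (em⇒dne)
open import Axiom.ExcludedMiddle using (ExcludedMiddle)
open import Data.Bool.Base using (if_then_else_)
open import Data.Empty using (⊥)
open import Data.Fin.Base as Fin using (Fin; zero; suc; toℕ; fromℕ<; punchOut)
import Data.Fin.Properties as Fin
open import Data.Integer.Base as ℤ using (ℤ; -[1+_])
import Data.Integer.Properties as ℤ
open import Data.List.Base using (List; []; _∷_; _++_; length; map; filter)
open import Data.List.Membership.Propositional using () renaming (_∈_ to _∈ₗ_; find to findₗ; lose to loseₗ)
open import Data.List.Membership.Propositional.Properties using (∈-map⁺; ∈-filter⁺; ∈-filter⁻)
open import Data.List.Properties using (length-map)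
open import Data.List.Relation.Binary.Permutation.Propositional as Perm using (_↭_; ↭-sym; ↭-trans; ↭-refl; prep)
open import Data.List.Relation.Binary.Permutation.Propositional.Properties using (All-resp-↭; ↭-length; shift)
open import Data.List.Relation.Unary.All as All using (All; []; _∷_)
import Data.List.Relation.Unary.All.Properties as All
open import Data.List.Relation.Unary.AllPairs as AllPairs using (AllPairs; []; _∷_)
import Data.List.Relation.Unary.AllPairs.Properties as AllPairs
open import Data.List.Relation.Unary.Any as Any using (Any; here; there)
import Data.List.Relation.Unary.Any.Properties as Any
open import Data.Maybe.Base as Maybe using (Maybe; just; nothing)
open import Data.Maybe.Properties using (just-injective)
open import Data.Nat.Base as ℕ using (ℕ; zero; suc)
open import Data.Nat.Induction using (<-wellFounded)
import Data.Nat.Properties as ℕ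
open import Data.Nat.Solver using (module +-*-Solver)
open import Data.Product.Base using (Σ; ∃; ∃₂; Σ-syntax; ∃-syntax; _×_; _,_; proj₁; proj₂)
open import Data.Rational.Base as ℚ using (ℚ; 0ℚ; 1ℚ; ½; mkℚ; toℚᵘ)
import Data.Rational.Properties as ℚ
open import Data.Rational.Solver using () renaming (module +-*-Solver to ℚ-Solver)
open import Data.Rational.Unnormalised.Base as ℚᵘ using (mkℚᵘ)
import Data.Rational.Unnormalised.Properties as ℚᵘ
open import Data.Sum.Base as Sum using (_⊎_; inj₁; inj₂; [_,_])
open import Data.Unit.Base using (⊤; tt)
open import Data.Vec.Functional using (removeAt)
open import Function.Base using (_∘_; id; case_of_; const)
open import Function.Bundles using (Func; Equivalence)
open import Function.Metric.Structures using (IsGeneralMetric)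
open import Induction.WellFounded using (Acc; acc)
open import Level using (0ℓ; Level; lift)
open import Relation.Binary.Bundles using (Setoid)
open import Relation.Binary.Definitions using (Symmetric; tri<; tri≈; tri>)
open import Relation.Binary.PropositionalEquality as ≡ using (_≡_; refl; sym; trans; cong; cong₂; subst; subst₂; module ≡-Reasoning)
open import Relation.Nullary using (Dec; yes; no; does; ¬_; contradiction)
open import Relation.Unary using (Pred; ∁; ∅; _≐_; _⊆_)
open import Algebra.Properties.Semiring.Sum ℕ.+-*-semiring using (sum; sum-cong-≗; sum-remove; ∑-comm; ∑-distrib-+; *-distribˡ-sum; *-distribʳ-sum)

-- A constraint may have points on both sides of the separation, and values chosen on one side can
-- leave no room on the other; so the first round controls conditional probabilities instead of
-- violations. The bound c² is spent evenly on the two rounds. Constraints that only one round sees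
-- are settled by c² ≤ c < 1: one disjoint from `U` keeps the probability ℙ B ≤ c² ≤ c, and one
-- inside `U` has conditional probability 0 or 1, so that being at most c forces 0.
--
-- Probabilities are kept as numbers of assignments, with powers of `q` multiplied out, and the
-- probabilistic part is arithmetic in ℕ. Reals enter only where exp(-2) ≤ (δ/(1+δ))^(2δ) is
-- extracted from the exponential series.
--
-- To ask whether a component meets a bad constraint is to quantify over uncountably many
-- constraints, which turns Borel sets into projections. Sets are therefore described by closed sets
-- of codes, a description that is stable under projection and passes through the subspaces,
-- quotients and sums from which `Const` is built.

-- Enumerations of countable index sets.

module Countability where

  _then_ : ∀ {a} {A : Set a} → A → A → ℕ → A
  (x then y) zero    = x
  (x then y) (suc _) = y

  -- Runs through the antidiagonals of ℕ × ℕ one after the other.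
  unpair : ℕ → ℕ × ℕ
  unpair zero = 0 , 0
  unpair (suc n) with unpair n
  ... | a , zero  = 0 , suc a
  ... | a , suc b = suc a , b

  opaque
    unpair-surjective : ∀ a b → ∃[ n ] unpair n ≡ (a , b)
    unpair-surjective a b = go (a ℕ.+ b) a b refl
      where
      next : ∀ n a b → unpair n ≡ (a , suc b) → unpair (suc n) ≡ (suc a , b)
      next n a b eq rewrite eq = refl

      turn : ∀ n a → unpair n ≡ (a , 0) → unpair (suc n) ≡ (0 , suc a)
      turn n a eq rewrite eq = refl

      go : ∀ s a b → a ℕ.+ b ≡ s → ∃[ n ] unpair n ≡ (a , b)
      go s       zero    zero    e = 0 , refl
      go (suc s) zero    (suc b) e with go s b zero (trans (ℕ.+-identityʳ b) (ℕ.suc-injective e))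
      ... | n , eq = suc n , turn n b eq
      go s       (suc a) b       e with go s a (suc b) (trans (ℕ.+-suc a b) e)
      ... | n , eq = suc n , next n a b eq

  -- A partial enumeration, so that the empty index set is included.
  Countable : Set → Set
  Countable J = Σ[ e ∈ (ℕ → Maybe J) ] (∀ j → ∃[ n ] e n ≡ just j)

  ⊥-countable : Countable ⊥
  ⊥-countable = (λ _ → nothing) , λ ()

  ⊤-countable : Countable ⊤
  ⊤-countable = (λ _ → just tt) , λ _ → 0 , refl

  ℕ-countable : Countable ℕ
  ℕ-countable = just , λ n → n , refl

  Fin-countable : ∀ k → Countable (Fin k)
  Fin-countable k = e , onto
    where
    e : ℕ → Maybe (Fin k)
    e n with n ℕ.<? k
    ... | yes n<k = just (fromℕ< n<k)
    ... | no  _   = nothing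

    onto : ∀ i → ∃[ n ] e n ≡ just i
    onto i = toℕ i , lem
      where
      lem : e (toℕ i) ≡ just i
      lem with toℕ i ℕ.<? k
      ... | yes i<k = cong just (Fin.fromℕ<-toℕ i i<k)
      ... | no  i≮k = contradiction (Fin.toℕ<n i) i≮k

  ⊎-countable : ∀ {J K} → Countable J → Countable K → Countable (J ⊎ K)
  ⊎-countable {J} {K} (e , e-onto) (f , f-onto) = g ∘ unpair , onto
    where
    g : ℕ × ℕ → Maybe (J ⊎ K)
    g (zero  , b) = Maybe.map inj₁ (e b)
    g (suc _ , b) = Maybe.map inj₂ (f b)

    onto : ∀ x → ∃[ n ] g (unpair n) ≡ just x
    onto (inj₁ j) with b , eq ← e-onto j with n , p ← unpair-surjective 0 b =
      n , trans (cong g p) (cong (Maybe.map inj₁) eq)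
    onto (inj₂ k) with b , eq ← f-onto k with n , p ← unpair-surjective 1 b =
      n , trans (cong g p) (cong (Maybe.map inj₂) eq)

  Σ-countable : ∀ {K : Set} {J : K → Set} → Countable K → (∀ k → Countable (J k)) →
                Countable (Σ K J)
  Σ-countable {K} {J} (e , e-onto) c = g ∘ unpair , onto
    where
    h : ℕ → Maybe K → Maybe (Σ K J)
    h b (just k) = Maybe.map (k ,_) (proj₁ (c k) b)
    h b nothing  = nothing

    g : ℕ × ℕ → Maybe (Σ K J)
    g (a , b) = h b (e a)

    onto : ∀ x → ∃[ n ] g (unpair n) ≡ just x
    onto (k , j) with a , p ← e-onto k | b , r ← proj₂ (c k) j with n , s ← unpair-surjective a b =
      n , trans (cong g s) (trans (cong (h b) p) (cong (Maybe.map (k ,_)) r))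

  listFrom : ∀ {A : Set} → (ℕ → A) → ℕ → ℕ → List A
  listFrom e zero    _ = []
  listFrom e (suc l) m = e (proj₁ (unpair m)) ∷ listFrom e l (proj₂ (unpair m))

  listAt : ∀ {A : Set} → (ℕ → A) → ℕ → List A
  listAt e n = listFrom e (proj₁ (unpair n)) (proj₂ (unpair n))

  opaque
    listAt-surjective : ∀ {A : Set} (e : ℕ → A) → (∀ a → ∃[ n ] e n ≡ a) →
                        ∀ as → ∃[ n ] listAt e n ≡ as
    listAt-surjective e onto as = let (l , m , eq) = lem as ; (n , p) = unpair-surjective l m in
      n , trans (cong (λ z → listFrom e (proj₁ z) (proj₂ z)) p) eq
      where
      lem : ∀ as → ∃[ l ] ∃[ m ] listFrom e l m ≡ as
      lem []       = 0 , 0 , refl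
      lem (a ∷ as) with n , refl ← onto a | l , m , refl ← lem as with k , p ← unpair-surjective n m
        = suc l , k , cong (λ z → e (proj₁ z) ∷ listFrom e l (proj₂ z)) p

-- Classical logic and indicator functions.

module Indicator (em : ∀ {ℓ} → ExcludedMiddle ℓ) where

  private variable
    a b : Level

  dne : {P : Set a} → ¬ ¬ P → P
  dne = em⇒dne em

  ¬∀⇒∃¬ : {A : Set a} {P : A → Set b} → ¬ (∀ x → P x) → ∃[ x ] ¬ P x
  ¬∀⇒∃¬ h = dne λ ¬∃ → h λ x → dne λ ¬p → ¬∃ (x , ¬p)

  ⟦_⟧ : Set a → ℕ
  ⟦ P ⟧ = if does (em {P = P}) then 1 else 0

  ⟦⟧-yes : {P : Set a} → P → ⟦ P ⟧ ≡ 1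
  ⟦⟧-yes {P = P} p with em {P = P}
  ... | yes _ = refl
  ... | no ¬p = contradiction p ¬p

  ⟦⟧-no : {P : Set a} → ¬ P → ⟦ P ⟧ ≡ 0
  ⟦⟧-no {P = P} ¬p with em {P = P}
  ... | yes p = contradiction p ¬p
  ... | no _  = refl

  ⟦⟧-mono : {P : Set a} {Q : Set b} → (P → Q) → ⟦ P ⟧ ℕ.≤ ⟦ Q ⟧
  ⟦⟧-mono {P = P} f with em {P = P}
  ... | yes p = ℕ.≤-reflexive (sym (⟦⟧-yes (f p)))
  ... | no _  = ℕ.z≤n

  ⟦⟧-cong : {P : Set a} {Q : Set b} → (P → Q) → (Q → P) → ⟦ P ⟧ ≡ ⟦ Q ⟧
  ⟦⟧-cong f g = ℕ.≤-antisym (⟦⟧-mono f) (⟦⟧-mono g)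

-- Analytic sets as projections of closed sets of codes.

module Analyticity (em : ∀ {ℓ} → ExcludedMiddle ℓ) where
  open Countability

  private variable
    I I′ : Set

  -- Baire space is ℕ^I for a countable index set I; products and sequences
  -- of points are then formed by reindexing, with no pairing functions.

  Closed : ((I → ℕ) → Set) → Set
  Closed {I} F = ∀ γ → (∀ (L : List I) → ∃[ β ] F β × (∀ {i} → i ∈ₗ L → β i ≡ γ i)) → F γ

  closed-ext : ∀ {F : (I → ℕ) → Set} → Closed F → ∀ {γ γ′} → (∀ i → γ i ≡ γ′ i) → F γ → F γ′
  closed-ext c {γ} e f = c _ λ L → γ , f , λ {i} _ → e i

  closed-const : ∀ (Q : Set) → Closed {I} (λ _ → Q)
  closed-const Q γ h = proj₁ (proj₂ (h []))

  closed-∩ : ∀ {K : Set} {F : K → (I → ℕ) → Set} → (∀ k → Closed (F k)) →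
             Closed (λ γ → ∀ k → F k γ)
  closed-∩ c γ h k = c k γ λ L → let (β , f , e) = h L in β , f k , e

  closed-× : ∀ {F G : (I → ℕ) → Set} → Closed F → Closed G → Closed (λ γ → F γ × G γ)
  closed-× c d γ h = c γ (λ L → let (β , f , e) = h L in β , proj₁ f , e)
                   , d γ (λ L → let (β , f , e) = h L in β , proj₂ f , e)

  -- Adding `i` to the inspected coordinates makes the approximations agree with `γ` there, so a
  -- coordinate may select which closed condition is imposed.
  closed-at : ∀ (i : I) {F : ℕ → (I → ℕ) → Set} → (∀ n → Closed (F n)) →
              Closed (λ γ → F (γ i) γ)
  closed-at i {F} c γ h = c (γ i) γ λ L → let (β , f , e) = h (i ∷ L) in
    β , subst (λ n → F n β) (e (here refl)) f , e ∘ there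

  closed-∘ : ∀ (ρ : I → I′) {F : (I → ℕ) → Set} → Closed F → Closed (λ γ → F (γ ∘ ρ))
  closed-∘ ρ c γ h = c (γ ∘ ρ) λ L → let (β , f , e) = h (map ρ L) in
    β ∘ ρ , f , λ i∈L → e (∈-map⁺ ρ i∈L)

  closed-resp : ∀ {F G : (I → ℕ) → Set} → (∀ {γ} → F γ → G γ) → (∀ {γ} → G γ → F γ) →
                Closed F → Closed G
  closed-resp to from c γ h = to (c γ λ L → let (β , g , e) = h L in β , from g , e)

  module _ {K : Set} (J : K → Set) (k : K) (f : J k → ℕ) where

    private
      transport : ∀ k′ → Dec (k ≡ k′) → J k′ → ℕ
      transport k′ (yes refl) = f
      transport k′ (no _)     = λ _ → 0

      transport-elim : ∀ (P : (J k → ℕ) → Set) → P f → ∀ d → P (transport k d)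
      transport-elim P p (yes refl) = p
      transport-elim P p (no k≢k)   = contradiction refl k≢k

    extendByZero : ∀ k′ → J k′ → ℕ
    extendByZero k′ = transport k′ em

    extendByZero-elim : ∀ (P : (J k → ℕ) → Set) → P f → P (extendByZero k)
    extendByZero-elim P p = transport-elim P p em

  -- A closed set of codes in Baire space, related onto `Y`. Points equal in a setoid may share a
  -- code, so `Codes` is a relation and not a function.
  record Coded (Y : Set) : Set₁ where
    no-eta-equality
    field
      Index     : Set
      countable : Countable Index
      Codes     : (Index → ℕ) → Y → Set
      codes-closed   : Closed (λ α → ∃[ y ] Codes α y)
      total     : ∀ y → ∃[ α ] Codes α y

  open Coded

  -- Soundness and completeness hold for every code of a point, so that membership can be tested on
  -- any one of them.
  record Analytic {Y : Set} (𝒴 : Coded Y) (A : Pred Y 0ℓ) : Set₁ where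
    no-eta-equality
    field
      Witness    : Set
      witnesses  : Countable Witness
      Graph      : (Index 𝒴 → ℕ) → (Witness → ℕ) → Set
      closed     : Closed (λ γ → Graph (γ ∘ inj₁) (γ ∘ inj₂))
      sound      : ∀ {α β y} → Codes 𝒴 α y → Graph α β → A y
      complete   : ∀ {α y} → Codes 𝒴 α y → A y → ∃[ β ] Graph α β

    graph-ext : ∀ {α α′ β β′} → (∀ i → α i ≡ α′ i) → (∀ j → β j ≡ β′ j) →
                Graph α β → Graph α′ β′
    graph-ext {α} {α′} {β} {β′} e e′ = closed-ext closed {[ α , β ]} {[ α′ , β′ ]} [ e , e′ ]

  private variable
    Y Z : Set
    𝒴 : Coded Y
    𝒵 : Coded Z

  module _ {𝒴 : Coded Y} where

    an-resp : ∀ {A B : Pred Y 0ℓ} → A ≐ B → Analytic 𝒴 A → Analytic 𝒴 B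
    an-resp (to , from) a = record
      { Analytic a
      ; sound    = λ c g → to (Analytic.sound a c g)
      ; complete = λ c b → Analytic.complete a c (from b)
      }

    an-const : ∀ (Q : Set) → Analytic 𝒴 (λ _ → Q)
    an-const Q = record
      { Witness   = ⊥
      ; witnesses = ⊥-countable
      ; Graph     = λ _ _ → Q
      ; closed    = closed-const Q
      ; sound     = λ _ g → g
      ; complete  = λ _ g → (λ ()) , g
      }

    an-⋂ : ∀ {K} → Countable K → {A : K → Pred Y 0ℓ} → (∀ k → Analytic 𝒴 (A k)) →
           Analytic 𝒴 (λ y → ∀ k → A k y)
    an-⋂ {K} K-ctbl a = record
      { Witness   = Σ K (Analytic.Witness ∘ a)
      ; witnesses = Σ-countable K-ctbl (Analytic.witnesses ∘ a)
      ; Graph     = λ α β → ∀ k → Analytic.Graph (a k) α (λ j → β (k , j))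
      ; closed    = closed-∩ λ k → closed-∘ (Sum.map id (k ,_)) (Analytic.closed (a k))
      ; sound     = λ c g k → Analytic.sound (a k) c (g k)
      ; complete  = λ c x → (λ (k , j) → proj₁ (Analytic.complete (a k) c (x k)) j)
                          , λ k → proj₂ (Analytic.complete (a k) c (x k))
      }

    -- One further coordinate of the witness, read through the enumeration of `K`, names a set
    -- containing the point; the coordinates meant for the other sets are filled with zeros.
    an-⋃ : ∀ {K} → Countable K → {A : K → Pred Y 0ℓ} → (∀ k → Analytic 𝒴 (A k)) →
           Analytic 𝒴 (λ y → ∃[ k ] A k y)
    an-⋃ {K} K-ctbl {A} a = record
      { Witness   = ⊤ ⊎ Σ K (Analytic.Witness ∘ a)
      ; witnesses = ⊎-countable ⊤-countable (Σ-countable K-ctbl (Analytic.witnesses ∘ a))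
      ; Graph     = λ α β → G (proj₁ K-ctbl (β (inj₁ tt))) α (β ∘ inj₂)
      ; closed    = closed-at (inj₂ (inj₁ tt)) λ n → G-closed (proj₁ K-ctbl n)
      ; sound     = λ {_} {β} → G-sound (proj₁ K-ctbl (β (inj₁ tt)))
      ; complete  = comp
      }
      where
      G : Maybe K → (Index 𝒴 → ℕ) → (Σ K (Analytic.Witness ∘ a) → ℕ) → Set
      G nothing  _ _ = ⊥
      G (just k) α β = Analytic.Graph (a k) α (λ j → β (k , j))

      G-closed : ∀ m → Closed {Index 𝒴 ⊎ (⊤ ⊎ Σ K (Analytic.Witness ∘ a))}
                              (λ γ → G m (γ ∘ inj₁) (λ x → γ (inj₂ (inj₂ x))))
      G-closed nothing  = closed-const ⊥
      G-closed (just k) = closed-∘ (Sum.map id (inj₂ ∘ (k ,_))) (Analytic.closed (a k))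

      G-sound : ∀ m {α β y} → Codes 𝒴 α y → G m α β → ∃[ k ] A k y
      G-sound (just k) c g = k , Analytic.sound (a k) c g

      comp : ∀ {α y} → Codes 𝒴 α y → ∃[ k ] A k y →
             ∃[ β ] G (proj₁ K-ctbl (β (inj₁ tt))) α (β ∘ inj₂)
      comp {α} c (k , x) = let (w , g) = Analytic.complete (a k) c x in
        (λ { (inj₁ _) → proj₁ (proj₂ K-ctbl k) ; (inj₂ (k′ , j)) → extendByZero (Analytic.Witness ∘ a) k w k′ j }) ,
        subst (λ m → G m α (λ (k′ , j) → extendByZero (Analytic.Witness ∘ a) k w k′ j)) (sym (proj₂ (proj₂ K-ctbl k)))
          (extendByZero-elim (Analytic.Witness ∘ a) k w (Analytic.Graph (a k) α) g)

  -- Maps that act on codes by a mere choice of coordinates, such as projections and pairings;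
  -- preimages of closed relations are then closed by `closed-∘`.
  record Tracked (𝒴 : Coded Y) (𝒵 : Coded Z) (r : Y → Z) : Set where
    field
      ρ     : Index 𝒵 → Index 𝒴
      track : ∀ {α y} → Codes 𝒴 α y → Codes 𝒵 (α ∘ ρ) (r y)

  open Tracked

  an-∘ : ∀ {r : Y → Z} → Tracked 𝒴 𝒵 r → ∀ {A} → Analytic 𝒵 A → Analytic 𝒴 (A ∘ r)
  an-∘ t a = record
    { Witness   = Analytic.Witness a
    ; witnesses = Analytic.witnesses a
    ; Graph     = λ α → Analytic.Graph a (α ∘ ρ t)
    ; closed    = closed-∘ (Sum.map (ρ t) id) (Analytic.closed a)
    ; sound     = λ c → Analytic.sound a (track t c)
    ; complete  = λ c → Analytic.complete a (track t c)
    }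

  infixr 2 _×ᶜ_
  _×ᶜ_ : Coded Y → Coded Z → Coded (Y × Z)
  Index (𝒴 ×ᶜ 𝒵) = Index 𝒴 ⊎ Index 𝒵
  countable (𝒴 ×ᶜ 𝒵) = ⊎-countable (countable 𝒴) (countable 𝒵)
  Codes (𝒴 ×ᶜ 𝒵) = λ γ (y , z) → Codes 𝒴 (γ ∘ inj₁) y × Codes 𝒵 (γ ∘ inj₂) z
  codes-closed (𝒴 ×ᶜ 𝒵) = closed-resp (λ ((y , c) , (z , d)) → (y , z) , c , d)
                              (λ ((y , z) , c , d) → (y , c) , (z , d))
                    (closed-× (closed-∘ inj₁ (codes-closed 𝒴)) (closed-∘ inj₂ (codes-closed 𝒵)))
  total (𝒴 ×ᶜ 𝒵) = λ (y , z) → [ proj₁ (total 𝒴 y) , proj₁ (total 𝒵 z) ]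
                            , proj₂ (total 𝒴 y) , proj₂ (total 𝒵 z)

  Σᶜ : {Y : ℕ → Set} → (∀ k → Coded (Y k)) → Coded (∃ Y)
  Index (Σᶜ 𝒴) = ⊤ ⊎ Σ ℕ (Index ∘ 𝒴)
  countable (Σᶜ 𝒴) = ⊎-countable ⊤-countable (Σ-countable ℕ-countable (countable ∘ 𝒴))
  Codes (Σᶜ 𝒴) = λ γ (k , s) → γ (inj₁ tt) ≡ k × Codes (𝒴 k) (λ i → γ (inj₂ (k , i))) s
  codes-closed (Σᶜ 𝒴) = closed-resp (λ (s , c) → (_ , s) , refl , c)
                              (λ { ((k , s) , refl , c) → s , c })
                    (closed-at (inj₁ tt) λ k → closed-∘ (inj₂ ∘ (k ,_)) (codes-closed (𝒴 k)))
  total (Σᶜ 𝒴) = λ (k , s) → code k s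
    where
    code : ∀ k s → ∃[ γ ] γ (inj₁ tt) ≡ k × Codes (𝒴 k) (λ i → γ (inj₂ (k , i))) s
    code k s = let (α , c) = total (𝒴 k) s in
      (λ { (inj₁ _) → k ; (inj₂ (k′ , i)) → extendByZero (Index ∘ 𝒴) k α k′ i }) ,
      refl , extendByZero-elim (Index ∘ 𝒴) k α (λ α → Codes (𝒴 k) α s) c

  infix 8 _^ᶜ_
  _^ᶜ_ : Coded Y → (k : ℕ) → Coded (Fin k → Y)
  Index (𝒴 ^ᶜ k) = Fin k × Index 𝒴
  countable (𝒴 ^ᶜ k) = Σ-countable (Fin-countable k) λ _ → countable 𝒴
  Codes (𝒴 ^ᶜ k) = λ γ t → ∀ i → Codes 𝒴 (λ j → γ (i , j)) (t i)
  codes-closed (𝒴 ^ᶜ k) = closed-resp (λ c → proj₁ ∘ c , proj₂ ∘ c) (λ (t , c) i → t i , c i)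
                    (closed-∩ λ i → closed-∘ (i ,_) (codes-closed 𝒴))
  total (𝒴 ^ᶜ k) = λ t → (λ (i , j) → proj₁ (total 𝒴 (t i)) j) , λ i → proj₂ (total 𝒴 (t i))

  Subᶜ : (𝒴 : Coded Y) {A : Pred Y 0ℓ} → Analytic 𝒴 A → Coded (∃ A)
  Index (Subᶜ 𝒴 a) = Index 𝒴 ⊎ Analytic.Witness a
  countable (Subᶜ 𝒴 a) = ⊎-countable (countable 𝒴) (Analytic.witnesses a)
  Codes (Subᶜ 𝒴 a) = λ γ (y , _) → Codes 𝒴 (γ ∘ inj₁) y × Analytic.Graph a (γ ∘ inj₁) (γ ∘ inj₂)
  codes-closed (Subᶜ 𝒴 a) = closed-resp (λ ((y , c) , g) → (y , Analytic.sound a c g) , c , g)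
                              (λ ((y , _) , c , g) → (y , c) , g)
                    (closed-× (closed-∘ inj₁ (codes-closed 𝒴)) (Analytic.closed a))
  total (Subᶜ 𝒴 a) = λ (y , x) → let (α , c) = total 𝒴 y ; (β , g) = Analytic.complete a c x in
                              [ α , β ] , c , g

  Finᶜ : ∀ q → Coded (Fin q)
  Index (Finᶜ q) = ⊤
  countable (Finᶜ q) = ⊤-countable
  Codes (Finᶜ q) = λ γ a → γ tt ≡ toℕ a
  codes-closed (Finᶜ q) = closed-at tt {λ n _ → ∃[ a ] n ≡ toℕ a} λ n → closed-const _
  total (Finᶜ q) = λ a → (λ _ → toℕ a) , refl

  -- A code of `z` becomes part of the witness. That these coordinates do code some point is a
  -- closed condition by `codes-closed`; without it the soundness of `A` would say nothing.
  an-∃ : ∀ {A : Pred (Y × Z) 0ℓ} → Analytic (𝒴 ×ᶜ 𝒵) A → Analytic 𝒴 (λ y → ∃[ z ] A (y , z))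
  an-∃ {𝒴 = 𝒴} {𝒵 = 𝒵} {A} a = record
    { Witness   = Index 𝒵 ⊎ A.Witness
    ; witnesses = ⊎-countable (countable 𝒵) A.witnesses
    ; Graph     = λ α β → (∃[ z ] Codes 𝒵 (β ∘ inj₁) z) × A.Graph [ α , β ∘ inj₁ ] (β ∘ inj₂)
    ; closed    = closed-× (closed-∘ (inj₂ ∘ inj₁) (codes-closed 𝒵))
                    (closed-resp (A.graph-ext Sum.[ (λ _ → refl) , (λ _ → refl) ] λ _ → refl)
                                 (A.graph-ext Sum.[ (λ _ → refl) , (λ _ → refl) ] λ _ → refl)
                      (closed-∘ assoc A.closed))
    ; sound     = λ c ((z , d) , g) → z , A.sound (c , d) g
    ; complete  = λ c (z , x) → let (ζ , d) = total 𝒵 z ; (β , g) = A.complete (c , d) x in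
                                [ ζ , β ] , (z , d) , g
    }
    where
    module A = Analytic a
    assoc : (Index 𝒴 ⊎ Index 𝒵) ⊎ A.Witness → Index 𝒴 ⊎ (Index 𝒵 ⊎ A.Witness)
    assoc (inj₁ (inj₁ i)) = inj₁ i
    assoc (inj₁ (inj₂ i)) = inj₂ (inj₁ i)
    assoc (inj₂ j)        = inj₂ (inj₂ j)

  -- In general no total map leads from the sum to one slice along which preimages could be taken.
  -- Instead, the slice number is a coordinate of the code and selects the closed relation by
  -- `closed-at`.
  an-slice : {Y : ℕ → Set} {𝒴 : ∀ k → Coded (Y k)} {A : Pred (Z × ∃ Y) 0ℓ} →
             (∀ k → Analytic (𝒵 ×ᶜ 𝒴 k) (λ (z , s) → A (z , k , s))) → Analytic (𝒵 ×ᶜ Σᶜ 𝒴) A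
  an-slice {𝒵 = 𝒵} {𝒴 = 𝒴} {A} a = record
    { Witness   = Σ ℕ (Analytic.Witness ∘ a)
    ; witnesses = Σ-countable ℕ-countable (Analytic.witnesses ∘ a)
    ; Graph     = λ α β → let k = α (inj₂ (inj₁ tt)) in
                          Analytic.Graph (a k) (α ∘ r k) (λ j → β (k , j))
    ; closed    = closed-at (inj₁ (inj₂ (inj₁ tt)))
                    λ k → closed-∘ (Sum.map (r k) (k ,_)) (Analytic.closed (a k))
    ; sound     = λ { (c , refl , d) g → Analytic.sound (a _) (c , d) g }
    ; complete  = λ { {α} (c , refl , d) x → comp _ {α} c d x }
    }
    where
    r : ∀ k → Index 𝒵 ⊎ Index (𝒴 k) → Index 𝒵 ⊎ (⊤ ⊎ Σ ℕ (Index ∘ 𝒴))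
    r k = Sum.map id (inj₂ ∘ (k ,_))

    comp : ∀ k {α z s} → Codes 𝒵 (α ∘ inj₁) z → Codes (𝒴 k) (α ∘ inj₂ ∘ inj₂ ∘ (k ,_)) s →
           A (z , k , s) → ∃[ β ] Analytic.Graph (a k) (α ∘ r k) (λ j → β (k , j))
    comp k {α} c d x = let (w , g) = Analytic.complete (a k) {α ∘ r k} (c , d) x in
      (λ (k′ , j) → extendByZero (Analytic.Witness ∘ a) k w k′ j) ,
      extendByZero-elim (Analytic.Witness ∘ a) k w (Analytic.Graph (a k) (α ∘ r k)) g

-- Rational arithmetic and the powers of 1/2.

module Rationals where
  open import Data.Rational.Base using (_+_; _*_; _≤_; _<_)

  opaque
    ι : ℕ → ℚ
    ι n = ℤ.+ n ℚ./ 1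

    ι-def : ∀ n → ι n ≡ ℤ.+ n ℚ./ 1
    ι-def n = refl

    toℚᵘ-ι : ∀ n → toℚᵘ (ι n) ℚᵘ.≃ mkℚᵘ (ℤ.+ n) 0
    toℚᵘ-ι n = ℚ.toℚᵘ-fromℚᵘ (mkℚᵘ (ℤ.+ n) 0)

  ι-0 : ι 0 ≡ 0ℚ
  ι-0 = ι-def 0

  ι-1 : ι 1 ≡ 1ℚ
  ι-1 = ι-def 1

  ι-+ : ∀ m n → ι (m ℕ.+ n) ≡ ι m + ι n
  ι-+ m n = ℚ.toℚᵘ-injective (begin
    toℚᵘ (ι (m ℕ.+ n)) ≈⟨ toℚᵘ-ι (m ℕ.+ n) ⟩
    mkℚᵘ (ℤ.+ (m ℕ.+ n)) 0 ≈⟨ ℚᵘ.*≡* (cong (ℤ._* ℤ.+ 1) (sym (cong₂ ℤ._+_ (ℤ.*-identityʳ (ℤ.+ m)) (ℤ.*-identityʳ (ℤ.+ n))))) ⟩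
    mkℚᵘ (ℤ.+ m) 0 ℚᵘ.+ mkℚᵘ (ℤ.+ n) 0 ≈⟨ ℚᵘ.+-cong (toℚᵘ-ι m) (toℚᵘ-ι n) ⟨
    toℚᵘ (ι m) ℚᵘ.+ toℚᵘ (ι n) ≈⟨ ℚ.toℚᵘ-homo-+ (ι m) (ι n) ⟨
    toℚᵘ (ι m + ι n) ∎)
    where open ℚᵘ.≃-Reasoning

  ι-* : ∀ m n → ι (m ℕ.* n) ≡ ι m * ι n
  ι-* m n = ℚ.toℚᵘ-injective (begin
    toℚᵘ (ι (m ℕ.* n)) ≈⟨ toℚᵘ-ι (m ℕ.* n) ⟩
    mkℚᵘ (ℤ.+ (m ℕ.* n)) 0 ≈⟨ ℚᵘ.*≡* (cong (ℤ._* ℤ.+ 1) (ℤ.pos-* m n)) ⟩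
    mkℚᵘ (ℤ.+ m) 0 ℚᵘ.* mkℚᵘ (ℤ.+ n) 0 ≈⟨ ℚᵘ.*-cong (toℚᵘ-ι m) (toℚᵘ-ι n) ⟨
    toℚᵘ (ι m) ℚᵘ.* toℚᵘ (ι n) ≈⟨ ℚ.toℚᵘ-homo-* (ι m) (ι n) ⟨
    toℚᵘ (ι m * ι n) ∎)
    where open ℚᵘ.≃-Reasoning

  ι-mono : ∀ {m n} → m ℕ.≤ n → ι m ≤ ι n
  ι-mono {m} {n} m≤n = ℚ.toℚᵘ-cancel-≤ (begin
    toℚᵘ (ι m) ≃⟨ toℚᵘ-ι m ⟩
    mkℚᵘ (ℤ.+ m) 0 ≤⟨ ℚᵘ.*≤* (ℤ.*-monoʳ-≤-nonNeg (ℤ.+ 1) (ℤ.+≤+ m≤n)) ⟩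
    mkℚᵘ (ℤ.+ n) 0 ≃⟨ toℚᵘ-ι n ⟨
    toℚᵘ (ι n) ∎)
    where open ℚᵘ.≤-Reasoning

  ι-cancel : ∀ {m n} → ι m ≤ ι n → m ℕ.≤ n
  ι-cancel {m} {n} h = ℕ.≮⇒≥ λ n<m → ℚ.<-irrefl refl (ℚ.<-≤-trans (strict n<m) h)
    where
    strict : n ℕ.< m → ι n < ι m
    strict n<m = ℚ.<-≤-trans
      (subst₂ _<_ (ℚ.+-identityʳ (ι n)) (sym (trans (cong ι (ℕ.+-comm 1 n)) (trans (ι-+ n 1) (cong (ι n +_) ι-1))))
        (ℚ.+-monoʳ-< (ι n) {0ℚ} {1ℚ} (ℚ.*<* (ℤ.+<+ (ℕ.s≤s ℕ.z≤n)))))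
      (ι-mono n<m)

  ι≥0 : ∀ n → 0ℚ ≤ ι n
  ι≥0 n = subst (_≤ ι n) ι-0 (ι-mono ℕ.z≤n)

  ι-pos : ∀ n .{{_ : ℕ.NonZero n}} → ℚ.Positive (ι n)
  ι-pos (suc n) = ℚ.positive (ℚ.<-≤-trans (ℚ.*<* (ℤ.+<+ (ℕ.s≤s ℕ.z≤n)))
    (subst (_≤ ι (suc n)) ι-1 (ι-mono (ℕ.s≤s ℕ.z≤n))))

  archimedean : ∀ {ε} → 0ℚ < ε → ∃[ n ] 1ℚ ≤ ι n * ε
  archimedean {mkℚ (ℤ.+ zero) d c} h = contradiction h (ℚ.<-irrefl (ℚ.≃⇒≡ (ℚ.*≡* refl)))
  archimedean {mkℚ -[1+ p ] d c} (ℚ.*<* ())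
  archimedean {ε@(mkℚ (ℤ.+ suc p) d c)} h = suc d , ℚ.toℚᵘ-cancel-≤ (begin
    toℚᵘ 1ℚ ≤⟨ ℚᵘ.*≤* (ℤ.+≤+ le) ⟩
    mkℚᵘ (ℤ.+ suc d) 0 ℚᵘ.* toℚᵘ ε ≃⟨ ℚᵘ.*-cong (toℚᵘ-ι (suc d)) (ℚᵘ.≃-refl {toℚᵘ ε}) ⟨
    toℚᵘ (ι (suc d)) ℚᵘ.* toℚᵘ ε ≃⟨ ℚ.toℚᵘ-homo-* (ι (suc d)) ε ⟨
    toℚᵘ (ι (suc d) * ε) ∎)
    where
    open ℚᵘ.≤-Reasoning
    le : 1 ℕ.* (1 ℕ.* suc d) ℕ.≤ suc d ℕ.* suc p ℕ.* 1
    le = subst₂ ℕ._≤_ (sym (trans (ℕ.*-identityˡ _) (ℕ.*-identityˡ _))) (sym (ℕ.*-identityʳ _)) (ℕ.m≤m*n (suc d) (suc p))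

  opaque
    ½^ : ℕ → ℚ
    ½^ zero    = 1ℚ
    ½^ (suc n) = ½ * ½^ n

    ½^-zero : ½^ 0 ≡ 1ℚ
    ½^-zero = refl

    ½^-suc : ∀ n → ½^ (suc n) ≡ ½ * ½^ n
    ½^-suc n = refl

  ½^-halves : ∀ n → ½^ (suc n) + ½^ (suc n) ≡ ½^ n
  ½^-halves n = trans (cong₂ _+_ (½^-suc n) (½^-suc n)) (trans (sym (ℚ.*-distribʳ-+ (½^ n) ½ ½)) (ℚ.*-identityˡ (½^ n)))

  opaque
    ½^>0 : ∀ n → 0ℚ < ½^ n
    ½^>0 zero    = subst (0ℚ <_) (sym ½^-zero) (ℚ.*<* (ℤ.+<+ (ℕ.s≤s ℕ.z≤n)))
    ½^>0 (suc n) = subst₂ _<_ (ℚ.*-zeroʳ ½) (sym (½^-suc n)) (ℚ.*-monoʳ-<-pos ½ (½^>0 n))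

  ½^-dec : ∀ n → ½^ (suc n) < ½^ n
  ½^-dec n = subst₂ _<_ (ℚ.+-identityʳ _) (½^-halves n) (ℚ.+-monoʳ-< (½^ (suc n)) (½^>0 (suc n)))

  n*½^n≤1 : ∀ n → ι n * ½^ n ≤ 1ℚ
  n*½^n≤1 zero    = subst (_≤ 1ℚ) (sym (trans (cong (_* ½^ 0) ι-0) (ℚ.*-zeroˡ (½^ 0)))) (ℚ.*≤* (ℤ.+≤+ ℕ.z≤n))
  n*½^n≤1 (suc n) = begin
    ι (suc n) * ½^ (suc n) ≡⟨ cong (ι (suc n) *_) (½^-suc n) ⟩
    ι (suc n) * (½ * ½^ n) ≡⟨ cong (_* (½ * ½^ n)) (trans (ι-+ 1 n) (cong (_+ ι n) ι-1)) ⟩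
    (1ℚ + ι n) * (½ * ½^ n)
      ≡⟨ solve 3 (λ i h x → (con 1ℚ :+ i) :* (h :* x) := h :* x :+ h :* (i :* x)) refl (ι n) ½ (½^ n) ⟩
    ½ * ½^ n + ½ * (ι n * ½^ n)
      ≤⟨ ℚ.+-mono-≤ (ℚ.*-monoˡ-≤-nonNeg ½ (½^≤1 n)) (ℚ.*-monoˡ-≤-nonNeg ½ (n*½^n≤1 n)) ⟩
    1ℚ ∎
    where
    open ℚ.≤-Reasoning
    open ℚ-Solver
    ½^≤1 : ∀ n → ½^ n ≤ 1ℚ
    ½^≤1 zero    = ℚ.≤-reflexive ½^-zero
    ½^≤1 (suc n) = ℚ.≤-trans (ℚ.<⇒≤ (½^-dec n)) (½^≤1 n)

  opaque
    ½^-small : ∀ {ε} → 0ℚ < ε → ∃[ n ] ½^ n < ε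
    ½^-small {ε} ε>0 with archimedean ε>0
    ... | zero  , h = contradiction (ℚ.≤-trans h (ℚ.≤-reflexive (trans (cong (_* ε) ι-0) (ℚ.*-zeroˡ ε)))) λ { (ℚ.*≤* (ℤ.+≤+ ())) }
    -- `n*½^n≤1` gives `½^ (suc n) ≤ ε`; one more halving makes it strict.
    ... | suc n , h = suc (suc n) , ℚ.<-≤-trans (½^-dec (suc n))
      (ℚ.*-cancelˡ-≤-pos (ι (suc n)) {{ι-pos (suc n)}} (ℚ.≤-trans (n*½^n≤1 (suc n)) h))

-- Finite sums and integration over finitely many points.

module FiniteSums where
  open import Data.Nat.Base using (_+_; _*_; _≤_; _<_)
  open import Data.Nat.Properties

  sum-mono : ∀ {n} {φ ψ : Fin n → ℕ} → (∀ i → φ i ≤ ψ i) → sum φ ≤ sum ψ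
  sum-mono {zero}  h = ≤-refl
  sum-mono {suc n} h = +-mono-≤ (h zero) (sum-mono (h ∘ suc))

  sum-const : ∀ n c → sum {n} (λ _ → c) ≡ n * c
  sum-const zero    c = refl
  sum-const (suc n) c = cong (c +_) (sum-const n c)

  sum-positive : ∀ {n} (φ : Fin n → ℕ) → 0 < sum φ → ∃[ i ] 0 < φ i
  sum-positive {suc n} φ h with φ zero in eq
  ... | zero  = let (i , p) = sum-positive (φ ∘ suc) h in suc i , p
  ... | suc k = zero , subst (0 <_) (sym eq) (ℕ.s≤s ℕ.z≤n)

-- I xs φ f / q ^ length xs is the expectation of φ when the values of f on
-- the points of xs are chosen anew.
module Integration (em : ∀ {ℓ} → ExcludedMiddle ℓ) (S : Setoid 0ℓ 0ℓ) (q : ℕ) where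
  open import Data.Nat.Base using (_+_; _*_; _^_; _≤_; _<_)
  open import Data.Nat.Properties
  open FiniteSums
  open Setoid S using (_≈_) renaming (Carrier to Pt)
  private module S = Setoid S

  Assignment : Set
  Assignment = Pt → Fin q

  infixl 9 _[_≔_]
  opaque
    _[_≔_] : Assignment → Pt → Fin q → Assignment
    (f [ x ≔ a ]) y with em {P = x ≈ y}
    ... | yes _ = a
    ... | no _  = f y

    ≔-hit : ∀ {f x a y} → x ≈ y → (f [ x ≔ a ]) y ≡ a
    ≔-hit {x = x} {y = y} e with em {P = x ≈ y}
    ... | yes _ = refl
    ... | no ¬e = contradiction e ¬e

    ≔-miss : ∀ {f x a y} → ¬ x ≈ y → (f [ x ≔ a ]) y ≡ f y
    ≔-miss {x = x} {y = y} ¬e with em {P = x ≈ y}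
    ... | yes e = contradiction e ¬e
    ... | no _  = refl

  ≔-cong : ∀ {f g} x a → (∀ y → f y ≡ g y) → ∀ y → (f [ x ≔ a ]) y ≡ (g [ x ≔ a ]) y
  ≔-cong x a e y = case em {P = x ≈ y} of λ
    { (yes h) → trans (≔-hit h) (sym (≔-hit h))
    ; (no h)  → trans (≔-miss h) (trans (e y) (sym (≔-miss h))) }

  ≔-overwrite : ∀ f x a y b → x ≈ y → ∀ z → (f [ x ≔ a ] [ y ≔ b ]) z ≡ (f [ y ≔ b ]) z
  ≔-overwrite f x a y b e z = case em {P = y ≈ z} of λ
    { (yes h) → trans (≔-hit h) (sym (≔-hit h))
    ; (no h)  → trans (≔-miss h) (trans (≔-miss (h ∘ S.trans (S.sym e))) (sym (≔-miss h))) }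

  ≔-swap : ∀ f x a y b → ¬ x ≈ y → ∀ z → (f [ x ≔ a ] [ y ≔ b ]) z ≡ (f [ y ≔ b ] [ x ≔ a ]) z
  ≔-swap f x a y b x≉y z = case em {P = y ≈ z} of λ
    { (yes h) → trans (≔-hit h) (sym (trans (≔-miss λ h′ → x≉y (S.trans h′ (S.sym h))) (≔-hit h)))
    ; (no h)  → trans (≔-miss h) (case em {P = x ≈ z} of λ
        { (yes h′) → trans (≔-hit h′) (sym (≔-hit h′))
        ; (no h′)  → trans (≔-miss h′) (sym (trans (≔-miss h′) (≔-miss h))) }) }

  ≔-resp : ∀ {f x a} → (∀ {y z} → y ≈ z → f y ≡ f z) → ∀ {y z} → y ≈ z → (f [ x ≔ a ]) y ≡ (f [ x ≔ a ]) z
  ≔-resp {x = x} f-resp {y} {z} e = case em {P = x ≈ y} of λ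
    { (yes h) → trans (≔-hit h) (sym (≔-hit (S.trans h e)))
    ; (no h)  → trans (≔-miss h) (trans (f-resp e) (sym (≔-miss λ h′ → h (S.trans h′ (S.sym e))))) }

  Functional : Set
  Functional = Assignment → ℕ

  Extensional : Functional → Set
  Extensional φ = ∀ {f g} → (∀ y → f y ≡ g y) → φ f ≡ φ g

  Independent : Pt → Functional → Set
  Independent x φ = ∀ f a → φ (f [ x ≔ a ]) ≡ φ f

  J : Pt → Functional → Functional
  J x φ f = sum (λ a → φ (f [ x ≔ a ]))

  -- Repeated entries are harmless: resampling a point once more only multiplies the result by `q`,
  -- in step with `q ^ length xs`.
  I : List Pt → Functional → Functional
  I []       φ = φ
  I (x ∷ xs) φ = J x (I xs φ)

  J-cong : ∀ x {φ ψ} → (∀ f → φ f ≡ ψ f) → ∀ f → J x φ f ≡ J x ψ f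
  J-cong x e f = sum-cong-≗ (λ a → e (f [ x ≔ a ]))

  I-cong : ∀ xs {φ ψ} → (∀ f → φ f ≡ ψ f) → ∀ f → I xs φ f ≡ I xs ψ f
  I-cong []       e = e
  I-cong (x ∷ xs) e = J-cong x (I-cong xs e)

  I-mono : ∀ xs {φ ψ} → (∀ f → φ f ≤ ψ f) → ∀ f → I xs φ f ≤ I xs ψ f
  I-mono []       h   = h
  I-mono (x ∷ xs) h f = sum-mono (λ a → I-mono xs h (f [ x ≔ a ]))

  I-+ : ∀ xs φ ψ f → I xs (λ g → φ g + ψ g) f ≡ I xs φ f + I xs ψ f
  I-+ []       φ ψ f = refl
  I-+ (x ∷ xs) φ ψ f = trans (J-cong x (I-+ xs φ ψ) f)
    (∑-distrib-+ (λ a → I xs φ (f [ x ≔ a ])) (λ a → I xs ψ (f [ x ≔ a ])))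

  I-zero : ∀ xs f → I xs (λ _ → 0) f ≡ 0
  I-zero []       f = refl
  I-zero (x ∷ xs) f = trans (J-cong x (I-zero xs) f) (trans (sum-const q 0) (*-zeroʳ q))

  I-sum : ∀ xs {n} (φ : Fin n → Functional) f → I xs (λ g → sum (λ i → φ i g)) f ≡ sum (λ i → I xs (φ i) f)
  I-sum xs {zero}  φ f = I-zero xs f
  I-sum xs {suc n} φ f = trans (I-+ xs (φ zero) _ f) (cong (I xs (φ zero) f +_) (I-sum xs (φ ∘ suc) f))

  I-* : ∀ xs c φ f → I xs (λ g → c * φ g) f ≡ c * I xs φ f
  I-* []       c φ f = refl
  I-* (x ∷ xs) c φ f = trans (J-cong x (I-* xs c φ) f) (sym (*-distribˡ-sum c (λ a → I xs φ (f [ x ≔ a ]))))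

  J-ext : ∀ x {φ} → Extensional φ → Extensional (J x φ)
  J-ext x φ-ext e = sum-cong-≗ (λ a → φ-ext (≔-cong x a e))

  I-ext : ∀ xs {φ} → Extensional φ → Extensional (I xs φ)
  I-ext []       φ-ext = φ-ext
  I-ext (x ∷ xs) φ-ext = J-ext x (I-ext xs φ-ext)

  J-independent-self : ∀ {x y φ} → Extensional φ → x ≈ y → Independent x (J y φ)
  J-independent-self φ-ext e f a = sum-cong-≗ (λ b → φ-ext (≔-overwrite f _ a _ b e))

  -- An exchange of sums unless `x ≈ y`; in that case the value chosen last overwrites the other,
  -- and both sides are `q` copies of `J x φ f`.
  J-comm : ∀ x y {φ} → Extensional φ → ∀ f → J x (J y φ) f ≡ J y (J x φ) f
  J-comm x y {φ} φ-ext f = case em {P = x ≈ y} of λ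
    { (yes e) → begin
        sum (λ a → J y φ (f [ x ≔ a ])) ≡⟨ sum-cong-≗ (J-independent-self φ-ext e f) ⟩
        sum {q} (λ a → J y φ f) ≡⟨ sum-cong-≗ {q} (λ a → sum-cong-≗ (λ b → φ-ext (same e b))) ⟩
        sum {q} (λ a → J x φ f) ≡⟨ sum-cong-≗ (J-independent-self φ-ext (S.sym e) f) ⟨
        sum (λ a → J x φ (f [ y ≔ a ])) ∎
    ; (no ¬e) → trans (sum-cong-≗ (λ a → sum-cong-≗ (λ b → φ-ext (≔-swap f x a y b ¬e))))
                      (∑-comm (λ a b → φ (f [ y ≔ b ] [ x ≔ a ]))) }
    where
    open ≡-Reasoning
    same : x ≈ y → ∀ b z → (f [ y ≔ b ]) z ≡ (f [ x ≔ b ]) z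
    same e b z = case em {P = y ≈ z} of λ
      { (yes h) → trans (≔-hit h) (sym (≔-hit (S.trans e h)))
      ; (no h)  → trans (≔-miss h) (sym (≔-miss (h ∘ S.trans (S.sym e)))) }

  I-J-comm : ∀ xs y {φ} → Extensional φ → ∀ f → I xs (J y φ) f ≡ J y (I xs φ) f
  I-J-comm []       y φ-ext f = refl
  I-J-comm (x ∷ xs) y φ-ext f = trans (J-cong x (I-J-comm xs y φ-ext) f) (J-comm x y (I-ext xs φ-ext) f)

  I-comm : ∀ xs ys {φ} → Extensional φ → ∀ f → I xs (I ys φ) f ≡ I ys (I xs φ) f
  I-comm xs []       φ-ext f = refl
  I-comm xs (y ∷ ys) φ-ext f = trans (I-J-comm xs y (I-ext ys φ-ext) f) (J-cong y (I-comm xs ys φ-ext) f)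

  J-independent : ∀ {x} y {φ} → Extensional φ → Independent x φ → Independent x (J y φ)
  J-independent {x} y φ-ext ind f a = case em {P = x ≈ y} of λ
    { (yes e) → J-independent-self φ-ext e f a
    ; (no ¬e) → sum-cong-≗ (λ b → trans (φ-ext (≔-swap f x a y b ¬e)) (ind (f [ y ≔ b ]) a)) }

  I-independent : ∀ {x} ys {φ} → Extensional φ → Independent x φ → Independent x (I ys φ)
  I-independent []       φ-ext ind = ind
  I-independent (y ∷ ys) φ-ext ind = J-independent y (I-ext ys φ-ext) (I-independent ys φ-ext ind)

  I-independent-∈ : ∀ {x ys φ} → Extensional φ → Any (x ≈_) ys → Independent x (I ys φ)
  I-independent-∈ {ys = y ∷ ys} φ-ext (here e)   = J-independent-self (I-ext ys φ-ext) e
  I-independent-∈ {ys = y ∷ ys} φ-ext (there x∈) = J-independent y (I-ext ys φ-ext) (I-independent-∈ φ-ext x∈)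

  I-constant : ∀ xs {φ} → All (λ x → Independent x φ) xs → ∀ f → I xs φ f ≡ q ^ length xs * φ f
  I-constant []       []             f = sym (*-identityˡ _)
  I-constant (x ∷ xs) {φ} (ind ∷ inds) f = begin
    sum (λ a → I xs φ (f [ x ≔ a ]))
      ≡⟨ sum-cong-≗ (λ a → trans (I-constant xs inds (f [ x ≔ a ])) (cong (q ^ length xs *_) (ind f a))) ⟩
    sum {q} (λ a → q ^ length xs * φ f) ≡⟨ sum-const q _ ⟩
    q * (q ^ length xs * φ f) ≡⟨ *-assoc q (q ^ length xs) (φ f) ⟨
    q ^ suc (length xs) * φ f ∎
    where open ≡-Reasoning

  -- Both sides are equal to I xs (I ys φ) f, as the two integrals commute.
  I-transfer : ∀ xs ys {φ} → Extensional φ →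
               All (λ x → Any (x ≈_) ys ⊎ Independent x φ) xs →
               All (λ y → Any (y ≈_) xs ⊎ Independent y φ) ys →
               ∀ f → q ^ length ys * I xs φ f ≡ q ^ length xs * I ys φ f
  I-transfer xs ys φ-ext hx hy f = begin
    q ^ length ys * I xs _ f ≡⟨ I-constant ys (All.map [ I-independent-∈ φ-ext , I-independent xs φ-ext ] hy) f ⟨
    I ys (I xs _) f ≡⟨ I-comm ys xs φ-ext f ⟩
    I xs (I ys _) f ≡⟨ I-constant xs (All.map [ I-independent-∈ φ-ext , I-independent ys φ-ext ] hx) f ⟩
    q ^ length xs * I ys _ f ∎
    where open ≡-Reasoning

  -- At each resampled point one of the factors is constant and leaves the sum; its `q` equal copies
  -- account for the factor `q`.
  I-product : ∀ xs {φ ψ} → Extensional φ → Extensional ψ →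
              All (λ x → Independent x φ ⊎ Independent x ψ) xs →
              ∀ f → q ^ length xs * I xs (λ g → φ g * ψ g) f ≡ I xs φ f * I xs ψ f
  I-product []       φ-ext ψ-ext []       f = *-identityˡ _
  I-product (x ∷ xs) {φ} {ψ} φ-ext ψ-ext (h ∷ hs) f = begin
    q * q ^ length xs * sum (λ a → I xs (λ g → φ g * ψ g) (f [ x ≔ a ])) ≡⟨ *-assoc q (q ^ length xs) _ ⟩
    q * (q ^ length xs * sum (λ a → I xs (λ g → φ g * ψ g) (f [ x ≔ a ])))
      ≡⟨ cong (q *_) (*-distribˡ-sum (q ^ length xs) (λ a → I xs (λ g → φ g * ψ g) (f [ x ≔ a ]))) ⟩
    q * sum (λ a → q ^ length xs * I xs (λ g → φ g * ψ g) (f [ x ≔ a ]))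
      ≡⟨ cong (q *_) (sum-cong-≗ (λ a → I-product xs φ-ext ψ-ext hs (f [ x ≔ a ]))) ⟩
    q * sum (λ a → Φ a * Ψ a) ≡⟨ factor h ⟩
    sum Φ * sum Ψ ∎
    where
    open ≡-Reasoning
    Φ Ψ : Fin q → ℕ
    Φ a = I xs φ (f [ x ≔ a ])
    Ψ a = I xs ψ (f [ x ≔ a ])

    factor : Independent x φ ⊎ Independent x ψ → q * sum (λ a → Φ a * Ψ a) ≡ sum Φ * sum Ψ
    factor (inj₁ ind) = begin
      q * sum (λ a → Φ a * Ψ a) ≡⟨ cong (q *_) (sum-cong-≗ (λ a → cong (_* Ψ a) (I-independent xs φ-ext ind f a))) ⟩
      q * sum (λ a → I xs φ f * Ψ a) ≡⟨ cong (q *_) (*-distribˡ-sum (I xs φ f) Ψ) ⟨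
      q * (I xs φ f * sum Ψ) ≡⟨ *-assoc q (I xs φ f) (sum Ψ) ⟨
      q * I xs φ f * sum Ψ
        ≡⟨ cong (_* sum Ψ) (trans (sum-cong-≗ (I-independent xs φ-ext ind f)) (sum-const q (I xs φ f))) ⟨
      sum Φ * sum Ψ ∎
    factor (inj₂ ind) = begin
      q * sum (λ a → Φ a * Ψ a) ≡⟨ cong (q *_) (sum-cong-≗ (λ a → cong (Φ a *_) (I-independent xs ψ-ext ind f a))) ⟩
      q * sum (λ a → Φ a * I xs ψ f) ≡⟨ cong (q *_) (*-distribʳ-sum (I xs ψ f) Φ) ⟨
      q * (sum Φ * I xs ψ f) ≡⟨ solve 3 (λ a b c → a :* (b :* c) := b :* (a :* c)) refl q (sum Φ) (I xs ψ f) ⟩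
      sum Φ * (q * I xs ψ f)
        ≡⟨ cong (sum Φ *_) (trans (sum-cong-≗ (I-independent xs ψ-ext ind f)) (sum-const q (I xs ψ f))) ⟨
      sum Φ * sum Ψ ∎
      where open +-*-Solver

  -- One point after another receives a value that keeps the remaining sum positive.
  I-positive : ∀ xs φ {f} → (∀ {y z} → y ≈ z → f y ≡ f z) → 0 < I xs φ f →
               ∃[ h ] 0 < φ h × (∀ {y z} → y ≈ z → h y ≡ h z) × (∀ {y} → ¬ Any (_≈ y) xs → h y ≡ f y)
  I-positive []       φ {f} f-resp p = f , p , f-resp , λ _ → refl
  I-positive (x ∷ xs) φ {f} f-resp p =
    let (a , p′) = sum-positive (λ a → I xs φ (f [ x ≔ a ])) p
        (h , φh , h-resp , h-off) = I-positive xs φ (≔-resp f-resp) p′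
    in h , φh , h-resp , λ y∉ → trans (h-off (y∉ ∘ there)) (≔-miss (y∉ ∘ here))

-- The Lovász local lemma, in counting form.

module LocalLemma (em : ∀ {ℓ} → ExcludedMiddle ℓ) (S : Setoid 0ℓ 0ℓ) (q : ℕ) where
  open import Data.Nat.Base using (_+_; _*_; _^_; _≤_; _<_)
  open import Data.Nat.Properties
  open Indicator em
  open Integration em S q
  open Setoid S using (_≈_) renaming (Carrier to Pt)

  allPairs-resp-↭ : ∀ {A : Set} {R : A → A → Set} → Symmetric R → ∀ {xs ys} → xs ↭ ys → AllPairs R xs → AllPairs R ys
  allPairs-resp-↭ s Perm.refl          rs                  = rs
  allPairs-resp-↭ s (Perm.prep x p)    (r ∷ rs)            = All-resp-↭ p r ∷ allPairs-resp-↭ s p rs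
  allPairs-resp-↭ s (Perm.swap x y p)  ((r ∷ rx) ∷ ry ∷ rs) = (s r ∷ All-resp-↭ p ry) ∷ All-resp-↭ p rx ∷ allPairs-resp-↭ s p rs
  allPairs-resp-↭ s (Perm.trans p p′)  rs                  = allPairs-resp-↭ s p′ (allPairs-resp-↭ s p rs)

  split : ∀ {A : Set} (P : A → Set) xs → ∃₂ λ ys zs → xs ↭ ys ++ zs × All P ys × All (¬_ ∘ P) zs
  split P []       = [] , [] , ↭-refl , [] , []
  split P (x ∷ xs) with split P xs | em {P = P x}
  ... | ys , zs , p , y , z | yes px = x ∷ ys , zs , prep x p , px ∷ y , z
  ... | ys , zs , p , y , z | no ¬px = ys , x ∷ zs , ↭-trans (prep x p) (↭-sym (shift x ys zs)) , y , ¬px ∷ z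

  -- Every event gets the weight x = 1/(1+δ), and `rare` bounds its probability by x(1-x)^d =
  -- δ^d/(1+δ)^(d+1). Neighbours are counted in lists of pairwise `_≉_` events, because constraints
  -- are compared by a setoid equality.
  module _ .{{_ : ℕ.NonZero q}} {Event : Set} (_≉_ : Event → Event → Set) (≉-sym : Symmetric _≉_)
    (Occurs : Event → Assignment → Set) (Dom : Event → Pt → Set)
    (dom-resp : ∀ i {x y} → x ≈ y → Dom i x → Dom i y)
    (local : ∀ i {g h} → (∀ {y} → Dom i y → g y ≡ h y) → Occurs i g → Occurs i h)
    (d δ : ℕ) .{{_ : ℕ.NonZero δ}}
    (degree : ∀ i Γ → AllPairs _≉_ (i ∷ Γ) → All (λ j → ∃[ x ] Dom i x × Dom j x) Γ → length Γ ≤ d)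
    (xs : List Pt) (f : Assignment)
    (rare : ∀ i → suc δ ^ suc d * I xs (λ g → ⟦ Occurs i g ⟧) f ≤ δ ^ d * q ^ length xs)
    where

    private
      Near : Event → Event → Set
      Near i j = ∃[ x ] Dom i x × Dom j x

      Avoids : List Event → Assignment → Set
      Avoids T g = All (λ j → ¬ Occurs j g) T

      occurs : Event → Functional
      occurs i g = ⟦ Occurs i g ⟧

      avoid : List Event → Functional
      avoid T g = ⟦ Avoids T g ⟧

      N : List Event → ℕ
      N T = I xs (avoid T) f

      E : Event → List Event → ℕ
      E i T = I xs (λ g → occurs i g * avoid T g) f

      occurs-ext : ∀ i → Extensional (occurs i)
      occurs-ext i e = ⟦⟧-cong (local i (λ {y} _ → e y)) (local i (λ {y} _ → sym (e y)))

      avoid-ext : ∀ T → Extensional (avoid T)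
      avoid-ext T {g} {h} e = ⟦⟧-cong (All.map λ {j} ¬o o → ¬o (local j (λ {y} _ → sym (e y)) o))
                              (All.map λ {j} ¬o o → ¬o (local j (λ {y} _ → e y) o))

      unaffected : ∀ i {x} → ¬ Dom i x → ∀ {g a y} → Dom i y → (g [ x ≔ a ]) y ≡ g y
      unaffected i ¬d d = ≔-miss λ e → ¬d (dom-resp i (Setoid.sym S e) d)

      occurs-independent : ∀ i {x} → ¬ Dom i x → Independent x (occurs i)
      occurs-independent i ¬d g a = ⟦⟧-cong (local i (unaffected i ¬d)) (local i (sym ∘ unaffected i ¬d))

      avoid-independent : ∀ {x} T → All (λ j → ¬ Dom j x) T → Independent x (avoid T)
      avoid-independent T ¬ds g a = ⟦⟧-cong
        (λ av → All.zipWith (λ { {j} (¬d , ¬o) o → ¬o (local j (sym ∘ unaffected j ¬d) o) }) (¬ds , av))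
        (λ av → All.zipWith (λ { {j} (¬d , ¬o) o → ¬o (local j (unaffected j ¬d) o) }) (¬ds , av))

      N-split : ∀ i T → N T ≡ N (i ∷ T) + E i T
      N-split i T = trans (I-cong xs pointwise f) (I-+ xs (avoid (i ∷ T)) _ f)
        where
        pointwise : ∀ g → avoid T g ≡ avoid (i ∷ T) g + occurs i g * avoid T g
        pointwise g = case em {P = Occurs i g} of λ
          { (yes o) → sym (cong₂ _+_ (⟦⟧-no λ { (¬o ∷ _) → ¬o o }) (trans (cong (_* avoid T g) (⟦⟧-yes o)) (*-identityˡ _)))
          ; (no ¬o) → sym (trans
              (cong₂ _+_ (⟦⟧-cong (λ { (_ ∷ av) → av }) (¬o ∷_)) (cong (_* avoid T g) (⟦⟧-no ¬o)))
              (+-identityʳ _)) }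

      -- No point influences both `i` and `T`, so conditioning on the avoidance of `T` leaves the
      -- probability of `i` unchanged.
      far : ∀ i T → All (¬_ ∘ Near i) T → suc δ ^ suc d * E i T ≤ δ ^ d * N T
      far i T apart = *-cancelˡ-≤ (q ^ length xs) {{m^n≢0 q (length xs)}} (begin
        Q * (M * E i T) ≡⟨ solve 3 (λ a b c → a :* (b :* c) := b :* (a :* c)) refl Q M (E i T) ⟩
        M * (Q * E i T)
          ≡⟨ cong (M *_) (I-product xs (occurs-ext i) (avoid-ext T) (All.tabulate λ {x} _ → choose x) f) ⟩
        M * (I xs (occurs i) f * N T) ≡⟨ *-assoc M _ (N T) ⟨
        M * I xs (occurs i) f * N T ≤⟨ *-monoˡ-≤ (N T) (rare i) ⟩
        K * Q * N T ≡⟨ solve 3 (λ a b c → a :* b :* c := b :* (a :* c)) refl K Q (N T) ⟩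
        Q * (K * N T) ∎)
        where
        open ≤-Reasoning
        open +-*-Solver
        M = suc δ ^ suc d
        K = δ ^ d
        Q = q ^ length xs
        choose : ∀ x → Independent x (occurs i) ⊎ Independent x (avoid T)
        choose x = case em {P = Dom i x} of λ
          { (yes p) → inj₂ (avoid-independent T (All.map (λ ¬near p′ → ¬near (x , p , p′)) apart))
          ; (no ¬p) → inj₁ (occurs-independent i ¬p) }

      -- The conditional probability of `i`, given that `T` is avoided, is at most 1/(1+δ). It is
      -- multiplied out because `N T` is shown to be positive only afterwards, from this very bound.
      Unlikely : List Event → Set
      Unlikely T = ∀ i → AllPairs _≉_ (i ∷ T) → suc δ * E i T ≤ N T

      N-decay : ∀ i T → suc δ * E i T ≤ N T → δ * N T ≤ suc δ * N (i ∷ T)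
      N-decay i T h = +-cancelˡ-≤ (N T) _ _ (begin
        N T + δ * N T ≡⟨ cong (suc δ *_) (N-split i T) ⟩
        suc δ * (N (i ∷ T) + E i T) ≡⟨ *-distribˡ-+ (suc δ) (N (i ∷ T)) (E i T) ⟩
        suc δ * N (i ∷ T) + suc δ * E i T ≤⟨ +-monoʳ-≤ (suc δ * N (i ∷ T)) h ⟩
        suc δ * N (i ∷ T) + N T ≡⟨ +-comm (suc δ * N (i ∷ T)) (N T) ⟩
        N T + suc δ * N (i ∷ T) ∎)
        where open ≤-Reasoning

      -- Each event of `Γ` costs at most a factor δ/(1+δ). The lists conditioned upon on the way all
      -- have length below `n`, where the induction hypothesis is available.
      chain : ∀ {n} Γ T → (∀ T′ → length T′ < n → Unlikely T′) → length (Γ ++ T) ≤ n → AllPairs _≉_ (Γ ++ T) →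
              δ ^ length Γ * N T ≤ suc δ ^ length Γ * N (Γ ++ T)
      chain []      T ih len pairs = ≤-refl
      chain (j ∷ Γ) T ih len pairs@(_ ∷ pairs′) = begin
        δ * δ ^ length Γ * N T ≡⟨ *-assoc δ _ (N T) ⟩
        δ * (δ ^ length Γ * N T) ≤⟨ *-monoʳ-≤ δ (chain Γ T ih (<⇒≤ len) pairs′) ⟩
        δ * (suc δ ^ length Γ * N (Γ ++ T))
          ≡⟨ solve 3 (λ a b c → a :* (b :* c) := b :* (a :* c)) refl δ (suc δ ^ length Γ) (N (Γ ++ T)) ⟩
        suc δ ^ length Γ * (δ * N (Γ ++ T))
          ≤⟨ *-monoʳ-≤ (suc δ ^ length Γ) (N-decay j (Γ ++ T) (ih (Γ ++ T) len j pairs)) ⟩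
        suc δ ^ length Γ * (suc δ * N (j ∷ Γ ++ T))
          ≡⟨ solve 3 (λ a b c → b :* (a :* c) := a :* b :* c) refl (suc δ) (suc δ ^ length Γ) (N (j ∷ Γ ++ T)) ⟩
        suc δ ^ length (j ∷ Γ) * N (j ∷ Γ ++ T) ∎
        where
        open ≤-Reasoning
        open +-*-Solver

      N-↭ : ∀ {T T′} → T ↭ T′ → N T ≡ N T′
      N-↭ p = I-cong xs (λ g → ⟦⟧-cong (All-resp-↭ p) (All-resp-↭ (↭-sym p))) f

      -- Split `T` into the neighbours `Γ` of `i` and the rest `T′`. Forgetting `Γ` and using
      -- independence from `T′` gives E i T ≤ c N T′ with c = δ^d/(1+δ)^(d+1). Returning from `T′`
      -- to `T` costs ((1+δ)/δ)^k for the k neighbours, and k ≤ d leaves at most 1/(1+δ).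
      unlikely : ∀ T → Acc _<_ (length T) → Unlikely T
      unlikely T (acc rs) i pairs@(_ ∷ _) with split (Near i) T
      ... | Γ , T′ , p , near , apart = *-cancelˡ-≤ (δ ^ k * suc δ ^ d)
          {{m*n≢0 (δ ^ k) (suc δ ^ d) {{m^n≢0 δ k}} {{m^n≢0 (suc δ) d}}}} (begin
          δ ^ k * suc δ ^ d * (suc δ * E i T)
            ≡⟨ solve 4 (λ a b c e → a :* b :* (c :* e) := a :* (c :* b :* e)) refl (δ ^ k) (suc δ ^ d) (suc δ) (E i T) ⟩
          δ ^ k * (suc δ ^ suc d * E i T) ≤⟨ *-monoʳ-≤ (δ ^ k) (*-monoʳ-≤ (suc δ ^ suc d) E-mono) ⟩
          δ ^ k * (suc δ ^ suc d * E i T′) ≤⟨ *-monoʳ-≤ (δ ^ k) (far i T′ apart) ⟩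
          δ ^ k * (δ ^ d * N T′) ≡⟨ solve 3 (λ a b c → a :* (b :* c) := b :* (a :* c)) refl (δ ^ k) (δ ^ d) (N T′) ⟩
          δ ^ d * (δ ^ k * N T′)
            ≤⟨ *-monoʳ-≤ (δ ^ d) (chain Γ T′ (λ T″ lt → unlikely T″ (rs lt))
                 (≤-reflexive (sym (↭-length p))) (AllPairs.tail pairs′)) ⟩
          δ ^ d * (suc δ ^ k * N (Γ ++ T′)) ≡⟨ cong₂ (λ a b → a * (suc δ ^ k * b)) δ^d (sym (N-↭ p)) ⟩
          δ ^ k * δ ^ (d ℕ.∸ k) * (suc δ ^ k * N T)
            ≡⟨ solve 4 (λ a b c e → a :* b :* (c :* e) := a :* (b :* c) :* e) refl (δ ^ k) (δ ^ (d ℕ.∸ k)) (suc δ ^ k) (N T) ⟩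
          δ ^ k * (δ ^ (d ℕ.∸ k) * suc δ ^ k) * N T
            -- With fewer than `d` neighbours some powers of δ are left over; they are enlarged to
            -- powers of 1+δ.
            ≤⟨ *-monoˡ-≤ (N T) (*-monoʳ-≤ (δ ^ k) (*-monoˡ-≤ (suc δ ^ k) (^-monoˡ-≤ (d ℕ.∸ k) (n≤1+n δ)))) ⟩
          δ ^ k * (suc δ ^ (d ℕ.∸ k) * suc δ ^ k) * N T
            ≡⟨ cong (λ a → δ ^ k * a * N T)
                 (trans (sym (^-distribˡ-+-* (suc δ) (d ℕ.∸ k) k)) (cong (suc δ ^_) (m∸n+n≡m k≤d))) ⟩
          δ ^ k * suc δ ^ d * N T ∎)
        where
        open ≤-Reasoning
        open +-*-Solver
        k = length Γ

        pairs′ : AllPairs _≉_ (i ∷ Γ ++ T′)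
        pairs′ = allPairs-resp-↭ ≉-sym (prep i p) pairs

        k≤d : k ≤ d
        k≤d = degree i Γ (initial Γ pairs′) near
          where
          drop : ∀ Γ → AllPairs _≉_ (Γ ++ T′) → AllPairs _≉_ Γ
          drop []      _        = []
          drop (j ∷ Γ) (r ∷ rs) = All.++⁻ˡ Γ r ∷ drop Γ rs
          initial : ∀ Γ → AllPairs _≉_ (i ∷ Γ ++ T′) → AllPairs _≉_ (i ∷ Γ)
          initial Γ (r ∷ rs) = All.++⁻ˡ Γ r ∷ drop Γ rs

        δ^d : δ ^ d ≡ δ ^ k * δ ^ (d ℕ.∸ k)
        δ^d = trans (cong (δ ^_) (sym (m+[n∸m]≡n k≤d))) (^-distribˡ-+-* δ k (d ℕ.∸ k))

        E-mono : E i T ≤ E i T′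
        E-mono = I-mono xs (λ g → *-monoʳ-≤ (occurs i g) (⟦⟧-mono (λ av → All.++⁻ʳ Γ (All-resp-↭ p av)))) f

      -- All `q ^ length xs` choices are present at the start, and every further event keeps at
      -- least the share δ/(1+δ) > 0 of them.
      N-positive : ∀ T → AllPairs _≉_ T → 0 < N T
      N-positive []      _ = subst (0 <_) (sym (I-constant xs {avoid []} (All.tabulate λ _ → avoid-independent [] []) f))
        (subst (λ k → 0 < q ^ length xs * k) (sym (⟦⟧-yes [])) (subst (0 <_) (sym (*-identityʳ _)) (m^n>0 q (length xs))))
      N-positive (i ∷ T) pairs@(_ ∷ pairs′) = *-cancelˡ-< (suc δ) 0 (N (i ∷ T)) (begin-strict
        suc δ * 0 ≡⟨ *-zeroʳ (suc δ) ⟩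
        0 <⟨ *-mono-< (ℕ.>-nonZero⁻¹ δ) (N-positive T pairs′) ⟩
        δ * N T ≤⟨ N-decay i T (unlikely T (<-wellFounded (length T)) i pairs) ⟩
        suc δ * N (i ∷ T) ∎)
        where open ≤-Reasoning

    lovász-local-lemma : (∀ {y z} → y ≈ z → f y ≡ f z) → ∀ T → AllPairs _≉_ T →
      ∃[ h ] All (λ i → ¬ Occurs i h) T × (∀ {y z} → y ≈ z → h y ≡ h z) × (∀ {y} → ¬ Any (_≈ y) xs → h y ≡ f y)
    lovász-local-lemma f-resp T pairs =
      let (h , pos , h-resp , h-off) = I-positive xs (avoid T) f-resp (N-positive T pairs) in
      h , dne (λ ¬av → <-irrefl refl (subst (0 <_) (⟦⟧-no ¬av) pos)) , h-resp , h-off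

open import Defs hiding (_+_; _≤_; _^_)

Subset : BorelSpace → Set₁
Subset X = Pred (Point X) 0ℓ

-- Sets that are analytic together with their complements.

module BiAnalyticity (em : ∀ {ℓ} → ExcludedMiddle ℓ) where
  open import Defs using (_^_)
  open Countability
  open Analyticity em
  open Indicator em
  open Coded
  open Tracked

  private variable
    Y Z W : Set
    𝒴 : Coded Y
    𝒵 : Coded Z
    𝒲 : Coded W

  -- By Suslin's theorem these are the Borel sets of a standard Borel space; as pairs of analytic
  -- sets they pull back along tracked maps and may occur in either polarity.
  Bi : Coded Y → Pred Y 0ℓ → Set₁
  Bi 𝒴 A = Analytic 𝒴 A × Analytic 𝒴 (∁ A)

  module _ {𝒴 : Coded Y} where

    an-× : ∀ {A B : Pred Y 0ℓ} → Analytic 𝒴 A → Analytic 𝒴 B → Analytic 𝒴 (λ y → A y × B y)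
    an-× {A} {B} a b = an-resp ((λ f → f 0 , f 1) , λ { (x , y) zero → x ; (x , y) (suc _) → y })
      (an-⋂ ℕ-countable {A then B} λ { zero → a ; (suc _) → b })

    bi-resp : ∀ {A B : Pred Y 0ℓ} → A ≐ B → Bi 𝒴 A → Bi 𝒴 B
    bi-resp (to , from) (a , a′) = an-resp (to , from) a , an-resp ((λ ¬a → ¬a ∘ from) , (λ ¬b → ¬b ∘ to)) a′

    bi-const : ∀ (Q : Set) → Bi 𝒴 (λ _ → Q)
    bi-const Q = an-const Q , an-const (¬ Q)

    bi-¬ : ∀ {A} → Bi 𝒴 A → Bi 𝒴 (∁ A)
    bi-¬ (a , a′) = a′ , an-resp ((λ x ¬x → ¬x x) , dne) a

    bi-∀ : ∀ {K} → Countable K → {A : K → Pred Y 0ℓ} → (∀ k → Bi 𝒴 (A k)) → Bi 𝒴 (λ y → ∀ k → A k y)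
    bi-∀ c b = an-⋂ c (proj₁ ∘ b) , an-resp ((λ (k , ¬x) x → ¬x (x k)) , ¬∀⇒∃¬) (an-⋃ c (proj₂ ∘ b))

    bi-∃ : ∀ {K} → Countable K → {A : K → Pred Y 0ℓ} → (∀ k → Bi 𝒴 (A k)) → Bi 𝒴 (λ y → ∃[ k ] A k y)
    bi-∃ c b = an-⋃ c (proj₁ ∘ b) , an-resp ((λ h (k , x) → h k x) , λ h k x → h (k , x)) (an-⋂ c (proj₂ ∘ b))

    bi-× : ∀ {A B} → Bi 𝒴 A → Bi 𝒴 B → Bi 𝒴 (λ y → A y × B y)
    bi-× {A} {B} a b = bi-resp ((λ f → f 0 , f 1) , λ { (x , y) zero → x ; (x , y) (suc _) → y })
      (bi-∀ ℕ-countable {A then B} λ { zero → a ; (suc _) → b })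

    bi-→ : ∀ {A B} → Bi 𝒴 A → Bi 𝒴 B → Bi 𝒴 (λ y → A y → B y)
    bi-→ a b = bi-resp ((λ h x → dne λ ¬b → h (x , ¬b)) , λ h (x , ¬b) → ¬b (h x)) (bi-¬ (bi-× a (bi-¬ b)))

    bi-⊎ : ∀ {A B} → Bi 𝒴 A → Bi 𝒴 B → Bi 𝒴 (λ y → A y ⊎ B y)
    bi-⊎ a b = bi-resp ((λ h → case em of λ { (yes x) → inj₁ x ; (no ¬x) → inj₂ (h ¬x) })
                       , [ (λ x ¬x → contradiction x ¬x) , const ]) (bi-→ (bi-¬ a) b)

    σ-bi : ∀ {G} → (∀ {A} → G A → Bi 𝒴 A) → ∀ {A} → σ G A → Bi 𝒴 A
    σ-bi g (gen x)    = g x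
    σ-bi g (resp e b) = bi-resp e (σ-bi g b)
    σ-bi g ∅-σ        = bi-resp ((λ ()) , λ ()) (bi-const ⊥)
    σ-bi g (∁-σ b)    = bi-¬ (σ-bi g b)
    σ-bi g (⋃-σ b)    = bi-∃ ℕ-countable (λ n → σ-bi g (b n))

    Simple : (Y → ℕ) → Set₁
    Simple φ = ∀ r → Bi 𝒴 (λ y → φ y ≡ r)

    simple-const : ∀ n → Simple (λ _ → n)
    simple-const n r = bi-const (n ≡ r)

    -- Decomposing by the countably many pairs of values leaves only constant propositions, so `F`
    -- can be arbitrary.
    simple-rel : ∀ {φ ψ} → Simple φ → Simple ψ → (F : ℕ → ℕ → Set) → Bi 𝒴 (λ y → F (φ y) (ψ y))
    simple-rel p q F = bi-resp ((λ { (r , s , refl , refl , f) → f }) , λ f → _ , _ , refl , refl , f)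
      (bi-∃ ℕ-countable λ r → bi-∃ ℕ-countable λ s → bi-× (p r) (bi-× (q s) (bi-const (F r s))))

    simple-⟦⟧ : ∀ {A} → Bi 𝒴 A → Simple (λ y → ⟦ A y ⟧)
    simple-⟦⟧ {A} b r = bi-resp (to , from)
      (bi-⊎ (bi-× b (bi-const (1 ≡ r))) (bi-× (bi-¬ b) (bi-const (0 ≡ r))))
      where
      to : ∀ {y} → (A y × 1 ≡ r) ⊎ ((¬ A y) × 0 ≡ r) → ⟦ A y ⟧ ≡ r
      to (inj₁ (x , e)) = trans (⟦⟧-yes x) e
      to (inj₂ (x , e)) = trans (⟦⟧-no x) e

      from : ∀ {y} → ⟦ A y ⟧ ≡ r → (A y × 1 ≡ r) ⊎ ((¬ A y) × 0 ≡ r)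
      from {y} e with em {P = A y}
      ... | yes x = inj₁ (x , e)
      ... | no ¬x = inj₂ (¬x , e)

    simple-sum : ∀ {n} {φ : Fin n → Y → ℕ} → (∀ i → Simple (φ i)) → Simple (λ y → sum (λ i → φ i y))
    simple-sum {zero}  p r = simple-const 0 r
    simple-sum {suc n} p r = simple-rel (p zero) (simple-sum (p ∘ suc)) (λ s t → s ℕ.+ t ≡ r)

  bi-∘ : ∀ {r : Y → Z} → Tracked 𝒴 𝒵 r → ∀ {A} → Bi 𝒵 A → Bi 𝒴 (A ∘ r)
  bi-∘ t (a , a′) = an-∘ t a , an-∘ t a′

  bi-slice : {Y : ℕ → Set} {𝒴 : ∀ k → Coded (Y k)} {A : Pred (Z × ∃ Y) 0ℓ} →
             (∀ k → Bi (𝒵 ×ᶜ 𝒴 k) (λ (z , s) → A (z , k , s))) → Bi (𝒵 ×ᶜ Σᶜ 𝒴) A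
  bi-slice b = an-slice (proj₁ ∘ b) , an-slice (proj₂ ∘ b)

  tr-id : Tracked 𝒴 𝒴 id
  tr-id = record { ρ = id ; track = id }

  tr-∘ : ∀ {r : Y → Z} {s : Z → W} → Tracked 𝒵 𝒲 s → Tracked 𝒴 𝒵 r → Tracked 𝒴 𝒲 (s ∘ r)
  tr-∘ t u = record { ρ = ρ u ∘ ρ t ; track = track t ∘ track u }

  tr-proj₁ : Tracked (𝒴 ×ᶜ 𝒵) 𝒴 proj₁
  tr-proj₁ = record { ρ = inj₁ ; track = proj₁ }

  tr-proj₂ : Tracked (𝒴 ×ᶜ 𝒵) 𝒵 proj₂
  tr-proj₂ = record { ρ = inj₂ ; track = proj₂ }

  tr-sub : ∀ {A} {a : Analytic 𝒴 A} → Tracked (Subᶜ 𝒴 a) 𝒴 proj₁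
  tr-sub = record { ρ = inj₁ ; track = proj₁ }

  tr-at : ∀ {k} (i : Fin k) → Tracked (𝒴 ^ᶜ k) 𝒴 (λ t → t i)
  tr-at i = record { ρ = i ,_ ; track = λ c → c i }

  tr-pair : ∀ {r : Y → Z} {s : Y → W} → Tracked 𝒴 𝒵 r → Tracked 𝒴 𝒲 s →
            Tracked 𝒴 (𝒵 ×ᶜ 𝒲) (λ y → r y , s y)
  tr-pair t u = record { ρ = [ ρ t , ρ u ] ; track = λ c → track t c , track u c }

  unitᶜ : Coded ⊤
  Index unitᶜ = ⊥
  countable unitᶜ = ⊥-countable
  Codes unitᶜ _ _ = ⊤
  codes-closed unitᶜ _ _ = tt , tt
  total unitᶜ _ = (λ ()) , tt

  tr-unit : Tracked 𝒴 unitᶜ (λ _ → tt)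
  tr-unit = record { ρ = λ () ; track = λ _ → tt }

  bi-Σ : {Y : ℕ → Set} {𝒴 : ∀ k → Coded (Y k)} {A : Pred (∃ Y) 0ℓ} →
         (∀ k → Bi (𝒴 k) (λ s → A (k , s))) → Bi (Σᶜ 𝒴) A
  bi-Σ {𝒴 = 𝒴} {A = A} b = bi-∘ {𝒵 = unitᶜ ×ᶜ Σᶜ 𝒴} (tr-pair tr-unit tr-id) {A ∘ proj₂}
    (bi-slice λ k → bi-∘ tr-proj₂ (b k))

  -- `bi-slice` opens the right factor; exchanging the factors in between opens the left one as
  -- well.
  bi-slice₂ : {Y : ℕ → Set} {𝒴 : ∀ k → Coded (Y k)} {R : Pred (∃ Y × ∃ Y) 0ℓ} →
              (∀ k l → Bi (𝒴 k ×ᶜ 𝒴 l) (λ (s , t) → R ((k , s) , (l , t)))) → Bi (Σᶜ 𝒴 ×ᶜ Σᶜ 𝒴) R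
  bi-slice₂ {𝒴 = 𝒴} {R} b = bi-slice λ l → bi-∘ {𝒵 = 𝒴 l ×ᶜ Σᶜ 𝒴} (tr-pair tr-proj₂ tr-proj₁)
    {λ (t , s) → R (s , (l , t))} (bi-slice λ k → bi-∘ (tr-pair tr-proj₂ tr-proj₁) {λ (s , t) → R ((k , s) , (l , t))} (b k l))

  bi-Fin : ∀ {q} (A : Pred (Fin q) 0ℓ) → Bi (Finᶜ q) A
  bi-Fin {q} A = half A , half (∁ A)
    where
    half : ∀ (A : Pred (Fin q) 0ℓ) → Analytic (Finᶜ q) A
    half A = record
      { Witness   = ⊥
      ; witnesses = ⊥-countable
      ; Graph     = λ α _ → ∃[ a ] α tt ≡ toℕ a × A a
      ; closed    = closed-at (inj₁ tt) {λ n _ → ∃[ a ] n ≡ toℕ a × A a} λ n → closed-const _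
      ; sound     = λ { c (a , e , x) → subst A (Fin.toℕ-injective (trans (sym e) c)) x }
      ; complete  = λ c x → (λ ()) , _ , c , x
      }

  record Suslin (Y : BorelSpace) : Set₁ where
    no-eta-equality
    field
      coded    : Coded (Point Y)
      borel-bi : ∀ {A} → Borel Y A → Bi coded A

  open Suslin

  suslin-Fin : ∀ q → Suslin (discrete (Fin q))
  suslin-Fin q = record { coded = Finᶜ q ; borel-bi = λ {A} _ → bi-Fin A }

  suslin-⊗ : ∀ {Y Z} → Suslin Y → Suslin Z → Suslin (Y ⊗ Z)
  suslin-⊗ {Y} {Z} sY sZ = record
    { coded    = coded sY ×ᶜ coded sZ
    ; borel-bi = σ-bi cylinder
    }
    where
    cylinder : ∀ {A} → Cylinder× Y Z A → Bi (coded sY ×ᶜ coded sZ) A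
    cylinder (left a)  = bi-∘ tr-proj₁ (borel-bi sY a)
    cylinder (right a) = bi-∘ tr-proj₂ (borel-bi sZ a)

  suslin-^ : ∀ {Y} → Suslin Y → ∀ k → Suslin (Y ^ k)
  suslin-^ {Y} sY k = record { coded = coded sY ^ᶜ k ; borel-bi = σ-bi cylinder }
    where
    cylinder : ∀ {A} → Cylinder^ Y k A → Bi (coded sY ^ᶜ k) A
    cylinder (at i a) = bi-∘ (tr-at i) (borel-bi sY a)

  suslin-Subspace : ∀ {Y} (sY : Suslin Y) {P} → Analytic (coded sY) P → Suslin (Subspace Y P)
  suslin-Subspace sY p = record
    { coded    = Subᶜ (coded sY) p
    ; borel-bi = λ (B , b , to , from) → bi-resp (from , to) (bi-∘ tr-sub (borel-bi sY b))
    }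

  -- The carrier is unchanged and a Borel set of the quotient is Borel upstairs, so the same codes
  -- serve.
  suslin-Quotient : ∀ {Y} (sY : Suslin Y) {_∼_} e → Suslin (Quotient Y _∼_ e)
  suslin-Quotient sY e = record { coded = coded sY ; borel-bi = borel-bi sY ∘ proj₁ }

  suslin-⨆ : ∀ {Y : ℕ → BorelSpace} → (∀ k → Suslin (Y k)) → Suslin (⨆ Y)
  suslin-⨆ sY = record { coded = Σᶜ (coded ∘ sY) ; borel-bi = λ b → bi-Σ λ k → borel-bi (sY k) (b k) }

-- Balls of radius 2^-n and limits in a Polish metric.

module PolishSpaces {S : Setoid 0ℓ 0ℓ} (𝓜 : PolishMetric S) where
  open import Data.Nat.Base using (_+_)
  open import Defs using (_≤_)
  open Rationals
  open PolishMetric 𝓜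
  private module M = IsGeneralMetric isMetric
  private module S = Setoid S
  open S using (_≈_) renaming (Carrier to Pt)

  <ℚ-up : ∀ x {r s} → x <ℚ r → r ℚ.< s → x <ℚ s
  <ℚ-up x h r<s = Equivalence.from (ℝ∞.rounded x) (_ , r<s , h)

  -- The upper cut of a sum, being an `inf`, omits its endpoint; one of the bounds is lowered first
  -- to make room.
  triangle-< : ∀ x {y} z {r s} → dist x y <ℚ r → dist y z <ℚ s → dist x z <ℚ (r ℚ.+ s)
  triangle-< x {y} z {r} {s} h k with Equivalence.to (ℝ∞.rounded (dist x y)) h
  ... | r′ , r′<r , h′ = M.triangle x y z (r′ ℚ.+ s , ℚ.+-monoˡ-< s r′<r , r′ , s , h′ , k , refl)

  Near : ℕ → Pt → Pt → Set
  Near n x y = dist x y <ℚ ½^ n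

  near-≈ : ∀ n {x y} → x ≈ y → Near n x y
  near-≈ n e = proj₁ (M.≈⇒0 e) (0ℚ , ½^>0 n , refl)

  near-sym : ∀ n {x y} → Near n x y → Near n y x
  near-sym n {x} {y} = proj₁ (M.sym y x)

  near-trans : ∀ n {x y z} → Near (suc n) x y → Near (suc n) y z → Near n x z
  near-trans n {x} {z = z} h k = subst (dist x z <ℚ_) (½^-halves n) (triangle-< x z h k)

  near-weaken : ∀ n {x y} → Near (suc n) x y → Near n x y
  near-weaken n h = near-trans n h (near-≈ (suc n) S.refl)

  near-respʳ : ∀ n {x y z} → y ≈ z → Near n x y → Near n x z
  near-respʳ n e = proj₁ (M.cong S.refl (S.sym e))

  near⇒≈ : ∀ {x y} → (∀ n → Near n x y) → x ≈ y
  near⇒≈ {x} {y} h = M.0⇒≈ (small , M.nonNegative)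
    where
    small : dist x y ≤ 0ℝ
    small (_ , s<r , refl) = let (n , ½^n<r) = ½^-small s<r in <ℚ-up (dist x y) (h n) ½^n<r

  ball-open : ∀ n z → Open (Near n z)
  ball-open n z {y} h with Equivalence.to (ℝ∞.rounded (dist z y)) h
  ... | s , s<r , k = ½^ n ℚ.- s , ε>0 , λ {y′} e → subst (dist z y′ <ℚ_) eq (triangle-< z y′ k e)
    where
    open ℚ-Solver
    ε>0 : 0ℚ ℚ.< ½^ n ℚ.- s
    ε>0 = subst (ℚ._< ½^ n ℚ.- s) (ℚ.+-inverseʳ s) (ℚ.+-monoˡ-< (ℚ.- s) s<r)
    eq : s ℚ.+ (½^ n ℚ.- s) ≡ ½^ n
    eq = solve 2 (λ s r → s :+ (r :- s) := r) refl s (½^ n)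

  open⇒near : ∀ {U} → Open U → ∀ {x} → U x → ∃[ n ] (∀ {y} → Near n x y → U y)
  open⇒near U-open {x} u with U-open u
  ... | ε , ε>0 , sub with ½^-small ε>0
  ...   | n , ½^n<ε = n , λ {y} h → sub (<ℚ-up (dist x y) h ½^n<ε)

  Centre : ℕ → Pt → Set
  Centre m z = proj₁ separable m ≡ just z

  centre-unique : ∀ {m y z} → Centre m y → Centre m z → y ≡ z
  centre-unique p q = just-injective (trans (sym p) q)

  Ball : ℕ → ℕ → Pred Pt 0ℓ
  Ball i m x = ∃[ z ] Centre m z × Near i z x

  Linked : ℕ → ℕ → ℕ → Set
  Linked i m n = ∃₂ λ y z → Centre m y × Centre n z × Near i y z

  dense : ∀ i x → ∃[ m ] Ball i m x
  dense i x with proj₂ separable x (½^ i) (½^>0 i)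
  ... | m , z , c , h = m , z , c , near-sym i h

  ball-Open : ∀ i m → Open (Ball i m)
  ball-Open i m (z , c , h) = let (ε , ε>0 , sub) = ball-open i z h in ε , ε>0 , λ k → z , c , sub k

  ball-resp : ∀ i m {x y} → x ≈ y → Ball i m x → Ball i m y
  ball-resp i m e (z , c , h) = z , c , near-respʳ i e h

  balls-near : ∀ i {m x y} → Ball (suc i) m x → Ball (suc i) m y → Near i x y
  balls-near i {x = x} (z , c , h) (z′ , c′ , h′) =
    near-trans i (near-sym (suc i) h) (subst (λ w → Near (suc i) w _) (centre-unique c′ c) h′)

  -- Steps below 2^-(i+2), 2^-(i+3), ... add up to less than 2^-(i+1), so the centres form a Cauchy
  -- sequence; the other half of 2^-i is spent on the distance from a late centre to the limit.
  limit : (c : ℕ → ℕ) → (∀ i → Linked (2 + i) (c i) (c (suc i))) → ∃[ x ] (∀ i → Ball i (c i) x)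
  limit c link = x , λ i → z i , proj₁ (proj₂ (proj₂ (link i))) , close i
    where
    z : ℕ → Pt
    z i = proj₁ (link i)

    next : ∀ i → Near (2 + i) (z i) (z (suc i))
    next i with link i | link (suc i)
    ... | y , _ , _ , q , h | y′ , _ , p , _ , _ rewrite centre-unique p q = h

    tail : ∀ l i → Near (suc i) (z i) (z (l + i))
    tail zero    i = near-≈ (suc i) S.refl
    tail (suc l) i = near-trans (suc i) (next i)
      (subst (λ k → Near (2 + i) (z (suc i)) (z k)) (ℕ.+-suc l i) (tail l (suc i)))

    tail-≥ : ∀ N n → N ℕ.≤ n → Near (suc N) (z N) (z n)
    tail-≥ N n N≤n = subst (λ k → Near (suc N) (z N) (z k)) (ℕ.m∸n+n≡m N≤n) (tail (n ℕ.∸ N) N)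

    cauchy : Cauchy z
    cauchy ε ε>0 with ½^-small ε>0
    ... | N , small = N , λ m n N≤m N≤n → <ℚ-up (dist (z m) (z n))
      (near-trans N (near-sym (suc N) (tail-≥ N m N≤m)) (tail-≥ N n N≤n)) small

    x : Pt
    x = proj₁ (complete z cauchy)

    close : ∀ i → Near i (z i) x
    close i = let (N , near) = proj₂ (complete z cauchy) (½^ (suc i)) (½^>0 (suc i)) in
      near-trans i (tail-≥ i (N + i) (ℕ.m≤n+m i N)) (near (N + i) (ℕ.m≤m+n N i))

-- Codes for the points of a standard Borel space.

module StandardBorelSpaces (em : ∀ {ℓ} → ExcludedMiddle ℓ) (X : BorelSpace) (std : IsStandardBorel X) where
  open import Data.Nat.Base using (_+_)
  open Countability
  open Indicator em
  open Analyticity em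
  open BiAnalyticity em
  open BorelSpace X using (_≈_)
  private module S = Setoid (setoid X)
  open IsStandardBorel std
  open PolishMetric metric using (Open)
  open PolishSpaces metric public
  open Coded

  -- A point is coded by the indices of dense points converging to it at a
  -- prescribed speed.
  Xᶜ : Coded (Point X)
  Index Xᶜ = ℕ
  countable Xᶜ = ℕ-countable
  Codes Xᶜ α x = (∀ i → Linked (2 + i) (α i) (α (suc i))) × (∀ i → Ball i (α i) x)
  codes-closed Xᶜ = closed-resp (λ l → let (x , b) = limit _ l in x , l , b) (λ (x , l , b) → l)
    (closed-∩ λ i → closed-at i {λ m γ → Linked (2 + i) m (γ (suc i))} λ m →
      closed-at (suc i) {λ n _ → Linked (2 + i) m n} λ n → closed-const _)
  total Xᶜ x = (λ i → proj₁ (near i)) , linked , λ i →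
    let (z , c , h) = proj₂ (near i) in z , c , near-weaken i (near-weaken (suc i) (near-weaken (2 + i) h))
    where
    -- Centres within 2^-(3+i) of `x` have successive distances below 2^-(2+i), as the links
    -- require.
    near : ∀ i → ∃[ m ] Ball (3 + i) m x
    near i = dense (3 + i) x

    link : ∀ i {m n} → Ball (3 + i) m x → Ball (4 + i) n x → Linked (2 + i) m n
    link i (y , c , h) (z , d , k) = y , z , c , d , near-trans (2 + i) h (near-sym (3 + i) (near-weaken (3 + i) k))

    linked : ∀ i → Linked (2 + i) (proj₁ (near i)) (proj₁ (near (suc i)))
    linked i = link i (proj₂ (near i)) (proj₂ (near (suc i)))

  ball-⊆⇔ : ∀ {U α x} → Open U → Codes Xᶜ α x → U x → ∃[ i ] (∀ {y} → Ball i (α i) y → U y)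
  ball-⊆⇔ {α = α} U-open (_ , b) u with open⇒near U-open u
  ... | n , sub = suc n , λ c → sub (balls-near n (b (suc n)) c)

  -- A point lies in `U` exactly if some ball of its code is contained in `U`. Containment of a
  -- given ball is a fixed proposition, so the level of such a ball serves as a witness, and the
  -- absence of one at all levels is a closed condition.
  open-bi : ∀ {U} → Open U → Bi Xᶜ U
  open-bi {U} U-open = record
      { Witness   = ⊤
      ; witnesses = ⊤-countable
      ; Graph     = λ α β → ∀ {y} → Ball (β tt) (α (β tt)) y → U y
      ; closed    = closed-at (inj₂ tt) {λ i γ → ∀ {y} → Ball i (γ (inj₁ i)) y → U y} λ i →
                      closed-at (inj₁ i) {λ m _ → ∀ {y} → Ball i m y → U y} λ m → closed-const _
      ; sound     = λ (_ , b) g → g (b _)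
      ; complete  = λ c u → let (i , sub) = ball-⊆⇔ U-open c u in (λ _ → i) , sub
      } , record
      { Witness   = ⊥
      ; witnesses = ⊥-countable
      ; Graph     = λ α _ → ∀ i → ¬ (∀ {y} → Ball i (α i) y → U y)
      ; closed    = closed-∩ λ i → closed-at (inj₁ i) {λ m _ → ¬ (∀ {y} → Ball i m y → U y)} λ m → closed-const _
      ; sound     = λ c g u → let (i , sub) = ball-⊆⇔ U-open c u in g i sub
      ; complete  = λ (_ , b) ¬u → (λ ()) , λ i sub → ¬u (sub (b i))
      }

  suslin : Suslin X
  suslin = record
    { coded    = Xᶜ
    ; borel-bi = λ b → σ-bi (λ { (lift U-open) → open-bi U-open }) (Equivalence.to borel b)
    }

  linked-≈ : ∀ {α β x y} → Codes Xᶜ α x → Codes Xᶜ β y → x ≈ y → ∀ i → Linked i (α (suc i)) (β (suc i))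
  linked-≈ (_ , b) (_ , b′) e i with b (suc i) | b′ (suc i)
  ... | y , c , h | z , d , k = y , z , c , d ,
    near-trans i h (near-sym (suc i) (near-respʳ (suc i) (S.sym e) k))

  ≈-linked : ∀ {α β x y} → Codes Xᶜ α x → Codes Xᶜ β y → (∀ i → Linked i (α (suc i)) (β (suc i))) → x ≈ y
  ≈-linked {x = x} {y} (_ , b) (_ , b′) l = near⇒≈ close
    where
    close : ∀ n → Near n x y
    close n with l (2 + n) | b (3 + n) | b′ (3 + n)
    ... | y , z , c , d , h | _ , c′ , h′ | _ , d′ , k′
      rewrite centre-unique c′ c | centre-unique d′ d = near-trans n
        (near-trans (suc n) (near-sym (2 + n) (near-weaken (2 + n) h′)) h)
        (near-weaken (suc n) (near-weaken (2 + n) k′))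

  opaque
    -- Equality says that the two codes are close at every level, a closed condition on them;
    -- inequality is witnessed by one level at which they are not.
    ≈-bi : Bi (Xᶜ ×ᶜ Xᶜ) (λ (x , y) → x ≈ y)
    ≈-bi = record
        { Witness   = ⊥
        ; witnesses = ⊥-countable
        ; Graph     = λ α _ → ∀ i → Linked i (α (inj₁ (suc i))) (α (inj₂ (suc i)))
        ; closed    = closed-∩ λ i →
            closed-at (inj₁ (inj₁ (suc i))) {λ m γ → Linked i m (γ (inj₁ (inj₂ (suc i))))} λ m →
            closed-at (inj₁ (inj₂ (suc i))) {λ n _ → Linked i m n} λ n → closed-const _
        ; sound     = λ (c , d) g → ≈-linked c d g
        ; complete  = λ (c , d) e → (λ ()) , linked-≈ c d e
        } , record
        { Witness   = ⊤
        ; witnesses = ⊤-countable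
        ; Graph     = λ α β → ¬ Linked (β tt) (α (inj₁ (suc (β tt)))) (α (inj₂ (suc (β tt))))
        ; closed    = closed-at (inj₂ tt) {λ i γ → ¬ Linked i (γ (inj₁ (inj₁ (suc i)))) (γ (inj₁ (inj₂ (suc i))))} λ i →
            closed-at (inj₁ (inj₁ (suc i))) {λ m γ → ¬ Linked i m (γ (inj₁ (inj₂ (suc i))))} λ m →
            closed-at (inj₁ (inj₂ (suc i))) {λ n _ → ¬ Linked i m n} λ n → closed-const _
        ; sound     = λ (c , d) g e → g (linked-≈ c d e _)
        ; complete  = λ (c , d) ¬e → let (i , ¬l) = ¬∀⇒∃¬ (¬e ∘ ≈-linked c d) in (λ _ → i) , ¬l
        }

  ball-Borel : ∀ i m → Borel X (Ball i m)
  ball-Borel i m = Equivalence.from borel (gen (lift (ball-Open i m)))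

  codes-resp : ∀ {α x y} → x ≈ y → Codes Xᶜ α x → Codes Xᶜ α y
  codes-resp e (l , b) = l , λ i → ball-resp i _ e (b i)

  -- Equal points have the same codes, and the codes determine membership.
  analytic-resp : ∀ {A} → Analytic Xᶜ A → ∀ {x y} → x ≈ y → A x → A y
  analytic-resp a {x} e u =
    let (α , c) = total Xᶜ x in Analytic.sound a (codes-resp e c) (proj₂ (Analytic.complete a c u))

  separating-balls : ∀ {x y} → ¬ x ≈ y → ∃[ k ] (∀ {m n} → Ball k m x → Ball k n y →
                     ∀ {z} → Ball k m z → ¬ Ball k n z)
  separating-balls x≉y with ¬∀⇒∃¬ (x≉y ∘ near⇒≈)
  ... | p , ¬near = 2 + p , λ a b c d → ¬near (near-trans p (balls-near (suc p) a c) (balls-near (suc p) d b))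

  ball-avoiding : ∀ x (ys : List (Point X)) → ∃₂ λ i m → Ball i m x × (∀ {y} → y ∈ₗ ys → Ball i m y → x ≈ y)
  ball-avoiding x ys with radius ys
    where
    radius : ∀ ys → ∃[ i ] (∀ {y} → y ∈ₗ ys → Near i x y → x ≈ y)
    radius []       = 0 , λ ()
    radius (y ∷ ys) with radius ys | em {P = x ≈ y}
    ... | i , h | yes e = i , λ { (here refl) _ → e ; (there y∈) → h y∈ }
    ... | i , h | no ¬e with ¬∀⇒∃¬ (¬e ∘ near⇒≈)
    ...   | j , ¬near = i + j , λ { (here refl) near → contradiction (drop i j near) ¬near
                                    ; {y} (there y∈) near → h y∈ (drop j i (subst (λ k → Near k x y) (ℕ.+-comm i j) near)) }
      where
      drop : ∀ k j {y} → Near (k + j) x y → Near j x y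
      drop zero    j = id
      drop (suc k) j = drop k j ∘ near-weaken (k + j)
  ... | i , h with dense (suc i) x
  ...   | m , b = suc i , m , b , λ y∈ c → h y∈ (balls-near i b c)

-- Closure properties of Borel sets.

module BorelAlgebra (em : ∀ {ℓ} → ExcludedMiddle ℓ) (X : BorelSpace) where
  open Countability
  open Indicator em
  open BorelSpace X using (resp-≐; ∅-Borel; ∁-Borel; ⋃-Borel)

  borel-const : ∀ (Q : Set) → Borel X (λ _ → Q)
  borel-const Q with em {P = Q}
  ... | yes q = resp-≐ ((λ _ → q) , λ _ ()) (∁-Borel ∅-Borel)
  ... | no ¬q = resp-≐ ((λ ()) , ¬q) ∅-Borel

  borel-⋂ : ∀ {A : ℕ → Subset X} → (∀ n → Borel X (A n)) → Borel X (λ x → ∀ n → A n x)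
  borel-⋂ b = resp-≐ ((λ h n → dne λ ¬a → h (n , ¬a)) , λ h (n , ¬a) → ¬a (h n)) (∁-Borel (⋃-Borel (∁-Borel ∘ b)))

  borel-⋃ : ∀ {K : Set} → Countable K → {A : K → Subset X} → (∀ k → Borel X (A k)) →
            Borel X (λ x → ∃[ k ] A k x)
  borel-⋃ {K} (e , onto) {A} b = resp-≐
    ((λ (n , a) → from (e n) a) , λ (k , a) → let (n , eq) = onto k in n , subst (λ m → At m _) (sym eq) a)
    (⋃-Borel (at-Borel ∘ e))
    where
    At : Maybe K → Subset X
    At (just k) = A k
    At nothing  = ∅

    at-Borel : ∀ m → Borel X (At m)
    at-Borel (just k) = b k
    at-Borel nothing  = ∅-Borel

    from : ∀ m {x} → At m x → ∃[ k ] A k x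
    from (just k) a = k , a

  borel-∩ : ∀ {A B} → Borel X A → Borel X B → Borel X (λ x → A x × B x)
  borel-∩ {A} {B} a b = resp-≐ ((λ f → f 0 , f 1) , λ { (x , y) zero → x ; (x , y) (suc _) → y }) 
    (borel-⋂ {A then B} λ { zero → a ; (suc _) → b })

  borel-∪ : ∀ {A B} → Borel X A → Borel X B → Borel X (λ x → A x ⊎ B x)
  borel-∪ {A} {B} a b = resp-≐ (to , from) (∁-Borel (borel-∩ (∁-Borel a) (∁-Borel b)))
    where
    to : ∀ {x} → ¬ (¬ A x × ¬ B x) → A x ⊎ B x
    to h = dne λ n → h (n ∘ inj₁ , n ∘ inj₂)

    from : ∀ {x} → A x ⊎ B x → ¬ (¬ A x × ¬ B x)
    from s (na , nb) = [ na , nb ] s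

  borel-⇒ : ∀ (Q : Set) {A} → Borel X A → Borel X (λ x → Q → A x)
  borel-⇒ Q a = resp-≐
    ( [ (λ ¬q q → contradiction q ¬q) , const ]
    , λ f → case em {P = Q} of λ { (yes q) → inj₂ (f q) ; (no ¬q) → inj₁ ¬q } )
    (borel-∪ (borel-const (¬ Q)) a)

-- The separation theorems of Novikov and Lusin.

module SeparationTheorems (em : ∀ {ℓ} → ExcludedMiddle ℓ) (X : BorelSpace) (std : IsStandardBorel X) where
  open import Data.Nat.Base using (_+_)
  open Countability
  open Indicator em
  open Analyticity em
  open BorelAlgebra em X
  open StandardBorelSpaces em X std
  open BorelSpace X using (_≈_)
  open Coded

  module _ {A : ℕ → Subset X} (a : ∀ k → Analytic Xᶜ (A k)) where
    private
      module A k = Analytic (a k)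

      Coordinate : Set
      Coordinate = Σ[ k ∈ ℕ ] (ℕ ⊎ A.Witness k)

      e : Countable Coordinate
      e = Σ-countable ℕ-countable λ k → ⊎-countable ℕ-countable (A.witnesses k)

      State : Set
      State = List (Coordinate × ℕ)

      Branch : ∀ k → (ℕ ⊎ A.Witness k → ℕ) → Set
      Branch k γ = (∃[ x ] Codes Xᶜ (γ ∘ inj₁) x) × A.Graph k (γ ∘ inj₁) (γ ∘ inj₂)

      -- The part of `A k` visible through codes and witnesses that extend the finite information
      -- `σ`; entries of `σ` for other indices do not restrict it.
      Cell : State → ℕ → Subset X
      Cell σ k x = ∃[ γ ] Codes Xᶜ (γ ∘ inj₁) x × A.Graph k (γ ∘ inj₁) (γ ∘ inj₂) ×
                   (∀ {c v} → ((k , c) , v) ∈ₗ σ → γ c ≡ v)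

      Separated : (ℕ → Subset X) → Set₁
      Separated C = Σ[ B ∈ (ℕ → Subset X) ]
        (∀ k → Borel X (B k)) × (∀ k {x} → C k x → B k x) × (∀ x → ¬ (∀ k → B k x))

      -- The cell with index k₀ is the union over the values of the new coordinate, while the others
      -- are unchanged. So the enclosures are united over `v` at k₀ and intersected elsewhere: a
      -- common point would lie in the k₀-th enclosure for one `v` and in all the others for that
      -- same `v`.
      split : ∀ {σ} c → (∀ v → Separated (Cell ((c , v) ∷ σ))) → Separated (Cell σ)
      split {σ} c@(k₀ , i) s = B , B-Borel , cell⊆B , disjoint
        where
        B : ℕ → Subset X
        B k x = (k ≡ k₀ → ∃[ v ] proj₁ (s v) k x) × (k ≢ k₀ → ∀ v → proj₁ (s v) k x)
          where open ≡ using (_≢_)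

        B-Borel : ∀ k → Borel X (B k)
        B-Borel k = borel-∩ (borel-⇒ _ (BorelSpace.⋃-Borel X λ v → proj₁ (proj₂ (s v)) k))
                            (borel-⇒ _ (borel-⋂ λ v → proj₁ (proj₂ (s v)) k))

        cell⊆B : ∀ k {x} → Cell σ k x → B k x
        cell⊆B k (γ , cd , g , agree) =
          (λ { refl → γ i , proj₁ (proj₂ (proj₂ (s (γ i)))) k
                 (γ , cd , g , λ { (here refl) → refl ; (there m) → agree m }) }) ,
          (λ k≢k₀ v → proj₁ (proj₂ (proj₂ (s v))) k
                 (γ , cd , g , λ { (here refl) → contradiction refl k≢k₀ ; (there m) → agree m }))

        disjoint : ∀ x → ¬ (∀ k → B k x)
        disjoint x b = let (v , y) = proj₁ (b k₀) refl in
          proj₂ (proj₂ (proj₂ (s v))) x λ k → case k ℕ.≟ k₀ of λ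
            { (yes refl) → y ; (no k≢k₀) → proj₂ (b k) k≢k₀ v }

      empty-cell : ∀ {σ} k → (∀ {x} → ¬ Cell σ k x) → Separated (Cell σ)
      empty-cell k empty = (λ k′ _ → ¬ k′ ≡ k) , (λ k′ → borel-const _) ,
        (λ { k′ c refl → empty c }) , λ x b → b k refl

      module Branches (¬sep : ¬ Separated (Cell [])) where

        Bad : Set₁
        Bad = Σ[ σ ∈ State ] ¬ Separated (Cell σ)

        extend : Maybe Coordinate → Bad → Bad
        extend nothing  b       = b
        extend (just c) (σ , n) = let (v , n′) = ¬∀⇒∃¬ (n ∘ split c) in (c , v) ∷ σ , n′

        bad : ℕ → Bad
        bad zero    = [] , ¬sep
        bad (suc n) = extend (proj₁ e n) (bad n)

        σ^ : ℕ → State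
        σ^ = proj₁ ∘ bad

        extend-⊇ : ∀ m b {x} → x ∈ₗ proj₁ b → x ∈ₗ proj₁ (extend m b)
        extend-⊇ nothing  b x∈ = x∈
        extend-⊇ (just c) b x∈ = there x∈

        grow : ∀ d n {x} → x ∈ₗ σ^ n → x ∈ₗ σ^ (d + n)
        grow zero    n x∈ = x∈
        grow (suc d) n x∈ = extend-⊇ (proj₁ e (d + n)) (bad (d + n)) (grow d n x∈)

        growʳ : ∀ d n {x} → x ∈ₗ σ^ n → x ∈ₗ σ^ (n + d)
        growʳ d n {x} x∈ = subst (λ k → x ∈ₗ σ^ k) (ℕ.+-comm d n) (grow d n x∈)

        decided : ∀ c → ∃₂ λ n v → (c , v) ∈ₗ σ^ n
        decided c = let (n , eq) = proj₂ e c in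
          suc n , subst (λ m → ∃[ v ] (c , v) ∈ₗ proj₁ (extend m (bad n))) (sym eq) (_ , here refl)

        γ : Coordinate → ℕ
        γ c = proj₁ (proj₂ (decided c))

        nonempty : ∀ n k → ∃[ x ] Cell (σ^ n) k x
        nonempty n k = dne λ h → proj₂ (bad n) (empty-cell k λ {x} c → h (x , c))

        decided-list : ∀ k (L : List (ℕ ⊎ A.Witness k)) → ∃[ n ] (∀ {i} → i ∈ₗ L → ((k , i) , γ (k , i)) ∈ₗ σ^ n)
        decided-list k []      = 0 , λ ()
        decided-list k (i ∷ L) = let (n , h) = decided-list k L ; (m , v , d) = decided (k , i) in
          n + m , λ { (here refl) → grow n m d ; (there i∈) → growʳ m n (h i∈) }

        -- Any finite set of coordinates is decided at a single stage, where the cell is nonempty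
        -- because an empty one could be separated; an element of it is the approximation that
        -- closedness asks for.
        branch : ∀ k → Branch k (λ i → γ (k , i))
        branch k = closed-× (closed-∘ inj₁ (codes-closed Xᶜ)) (A.closed k) _ λ L →
          let (n , h) = decided-list k L ; (x , γ′ , c , g , agree) = nonempty n k in
          γ′ , ((x , c) , g) , λ i∈ → agree (h i∈)

        pt : ℕ → Point X
        pt k = proj₁ (proj₁ (branch k))

        pt∈A : ∀ k → A k (pt k)
        pt∈A k = A.sound k (proj₂ (proj₁ (branch k))) (proj₂ (branch k))

        -- If the limit points differed, their codes would name disjoint balls at some level `p`. At
        -- a stage where both of these coordinates are decided, the two balls would separate the
        -- cells.
        equal : ∀ i j → pt i ≈ pt j
        equal i j = dne λ i≉j →
          let (p , apart) = separating-balls i≉j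
              (n , _ , di) = decided (i , inj₁ p)
              (m , _ , dj) = decided (j , inj₁ p)
          in proj₂ (bad (n + m))
            ( (λ k x → (k ≡ i → Ball p (γ (i , inj₁ p)) x) × (k ≡ j → Ball p (γ (j , inj₁ p)) x))
            , (λ k → borel-∩ (borel-⇒ _ (ball-Borel p _)) (borel-⇒ _ (ball-Borel p _)))
            , (λ k (γ′ , c , _ , agree) →
                 (λ { refl → subst (λ l → Ball p l _) (agree (growʳ m n di)) (proj₂ c p) }) ,
                 (λ { refl → subst (λ l → Ball p l _) (agree (grow n m dj)) (proj₂ c p) }))
            , λ x b → apart (proj₂ (proj₂ (proj₁ (branch i))) p) (proj₂ (proj₂ (proj₁ (branch j))) p)
                        (proj₁ (b i) refl) (proj₂ (b j) refl) )

    -- Novikov's theorem: if the sequence of cells cannot be separated, then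
    -- neither can the cells after fixing one more coordinate suitably;
    -- fixing all of them leads to a common point of the sets.
    novikov : (∀ x → ¬ (∀ k → A k x)) → Separated A
    novikov disjoint = let (B , b , sub , dis) = dne {P = Separated (Cell [])} λ ¬sep →
                             let open Branches ¬sep in
                             disjoint (pt 0) λ k → analytic-resp (a k) (equal k 0) (pt∈A k)
      in B , b , (λ k {x} u → sub k
           (let (α , c) = total Xᶜ x ; (β , g) = A.complete k c u in [ α , β ] , c , g , λ ())) , dis

  -- Novikov's theorem for the sequence A, B, B, ...: every point of `B` lies in all enclosures but
  -- the first, hence outside the first.
  lusin : ∀ {A B} → Analytic Xᶜ A → Analytic Xᶜ B → (∀ {x} → A x → ¬ B x) →
          ∃[ C ] Borel X C × (∀ {x} → A x → C x) × (∀ {x} → C x → ¬ B x)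
  lusin {A} {B} a b disjoint =
    let (C , c , sub , dis) = novikov {A then B} (λ { zero → a ; (suc _) → b }) (λ x h → disjoint (h 0) (h 1)) in
    C 0 , c 0 , sub 0 , λ y z → dis _ λ { zero → y ; (suc k) → sub (suc k) z }

-- Codes for spaces of finite subsets.

module FiniteSubsets (em : ∀ {ℓ} → ExcludedMiddle ℓ) where
  open import Defs using (_^_)
  open Countability
  open Analyticity em
  open BiAnalyticity em
  open Suslin

  -- Distinctness of the entries of a tuple and equality of finite sets are expressed through
  -- equality of points; since finite subsets are formed twice to reach constraints, this property
  -- must be carried along.
  Eq-bi : ∀ {Y} → Suslin Y → Set₁
  Eq-bi {Y} sY = Bi (coded sY ×ᶜ coded sY) (λ (x , y) → BorelSpace._≈_ Y x y)

  opaque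
    eq-⊗ : ∀ {Y Z} (sY : Suslin Y) (sZ : Suslin Z) → Eq-bi sY → Eq-bi sZ → Eq-bi (suslin-⊗ sY sZ)
    eq-⊗ sY sZ eqY eqZ = bi-×
      (bi-∘ (tr-pair (tr-∘ tr-proj₁ tr-proj₁) (tr-∘ tr-proj₁ tr-proj₂)) eqY)
      (bi-∘ (tr-pair (tr-∘ tr-proj₂ tr-proj₁) (tr-∘ tr-proj₂ tr-proj₂)) eqZ)

  opaque
    eq-Fin : ∀ q → Eq-bi (suslin-Fin q)
    eq-Fin q = bi-resp ((λ { (a , refl , refl) → refl }) , λ { refl → _ , refl , refl })
      (bi-∃ (Fin-countable q) λ a → bi-× (bi-∘ tr-proj₁ (bi-Fin (_≡ a))) (bi-∘ tr-proj₂ (bi-Fin (_≡ a))))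

  opaque
    eq-Subspace : ∀ {Y} (sY : Suslin Y) {P} (p : Analytic (coded sY) P) → Eq-bi sY → Eq-bi (suslin-Subspace sY p)
    eq-Subspace sY p eqY = bi-∘ (tr-pair (tr-∘ tr-sub tr-proj₁) (tr-∘ tr-sub tr-proj₂)) eqY

  module _ {Y : BorelSpace} (sY : Suslin Y) (eqY : Eq-bi sY) where

    at-at : ∀ {k l} (i : Fin k) (j : Fin l) →
      Bi (coded sY ^ᶜ k ×ᶜ coded sY ^ᶜ l) (λ (s , t) → BorelSpace._≈_ Y (s i) (t j))
    at-at i j = bi-∘ (tr-pair (tr-∘ (tr-at i) tr-proj₁) (tr-∘ (tr-at j) tr-proj₂)) eqY

    opaque
      distinct-bi : ∀ k → Bi (coded sY ^ᶜ k) (Distinct Y)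
      distinct-bi k = bi-∀ (Fin-countable k) λ i → bi-∀ (Fin-countable k) λ j →
        bi-→ (bi-∘ (tr-pair (tr-at i) (tr-at j)) eqY) (bi-const (i ≡ j))

    suslin-[]^ : ∀ k → Suslin ([ Y ]^ k)
    suslin-[]^ k = suslin-Quotient (suslin-Subspace (suslin-^ sY k) (proj₁ (distinct-bi k))) (SameImage-isEquivalence Y)

    suslin-[]^<∞ : Suslin [ Y ]^<∞
    suslin-[]^<∞ = suslin-⨆ suslin-[]^

    opaque
      eq-[]^<∞ : Eq-bi suslin-[]^<∞
      eq-[]^<∞ = bi-slice₂ λ k l → slice k l (k ℕ.≟ l)
        where
        slice : ∀ k l → Dec (k ≡ l) → Bi (coded (suslin-[]^ k) ×ᶜ coded (suslin-[]^ l)) (λ (s , t) → ⨆-≈ ([ Y ]^_) (k , s) (l , t))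
        slice k l (no k≢l)   = bi-resp ((λ ()) , λ { (same _) → k≢l refl }) (bi-const ⊥)
        slice k .k (yes refl) = bi-resp (same , λ { (same e) → e })
          (bi-∘ (tr-pair (tr-∘ tr-sub tr-proj₁) (tr-∘ tr-sub tr-proj₂))
            (bi-× (bi-∀ (Fin-countable k) λ i → bi-∃ (Fin-countable k) λ j → at-at i j)
                  (bi-∀ (Fin-countable k) λ j → bi-∃ (Fin-countable k) λ i → at-at i j)))

-- Constraints, their domains and their conditional probabilities.

module Constraints (X : BorelSpace) (q : ℕ) where
  open BorelSpace X using (_≈_)
  open CSP X q
  private
    module S = Setoid (setoid X)
    module F = Setoid (setoid PartialFunction)

  arity : Point PartialFunction → ℕ
  arity ((k , _) , _) = k

  pt : (g : Point PartialFunction) → Fin (arity g) → Point X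
  pt ((_ , s , _) , _) i = proj₁ (s i)

  lab : (g : Point PartialFunction) → Fin (arity g) → Fin q
  lab ((_ , s , _) , _) i = proj₂ (s i)

  pt-injective : ∀ g {i j} → pt g i ≈ pt g j → i ≡ j
  pt-injective ((k , s , distinct) , partial) {i} {j} e =
    distinct i j (e , partial (i , S.refl , refl) (j , S.refl , refl) e)

  dom-pt : ∀ {g x} → domᵖ g x → ∃[ i ] x ≈ pt g i
  dom-pt (_ , i , e , _) = i , e

  pt-dom : ∀ {g x} → (∃[ i ] x ≈ pt g i) → domᵖ g x
  pt-dom (i , e) = _ , i , e , refl

  dom-resp : ∀ {g h} → g F.≈ h → domᵖ g ⊆ domᵖ h
  dom-resp (same (f , _)) (a , i , e , l) = let (j , e′ , l′) = f i in a , j , S.trans e e′ , trans l l′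

  ∣_∣ᵉ : Point Const → ℕ
  ∣ ((m , _) , _) ∣ᵉ = m

  element : (B : Point Const) → Fin ∣ B ∣ᵉ → Point PartialFunction
  element ((_ , t , _) , _) = t

  dom⇒element : ∀ {B x} → dom B x → ∃[ i ] domᵖ (element B i) x
  dom⇒element {B} (g , (i , e) , d) = i , dom-resp {g} {element B i} e d

  element⇒dom : ∀ {B x i} → domᵖ (element B i) x → dom B x
  element⇒dom {B} {i = i} d = element B i , (i , F.refl {element B i}) , d

  dom⇒all : ∀ {B x} → dom B x → ∀ i → domᵖ (element B i) x
  dom⇒all {B@((m , t , _) , common)} d i = let (j , e) = dom⇒element {B} d in
    common {element B j} {element B i} (j , F.refl {element B j}) (i , F.refl {element B i}) e

  dom-≈ : ∀ {B x y} → x ≈ y → dom B x → dom B y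
  dom-≈ e (g , g∈ , a , i , e′ , l) = g , g∈ , a , i , S.trans (S.sym e) e′ , l

  Agrees : Subset X → (Point X → Fin q) → Pred (Point PartialFunction) 0ℓ
  Agrees W h g = ∀ j → W (pt g j) → h (pt g j) ≡ lab g j

module Counts (em : ∀ {ℓ} → ExcludedMiddle ℓ) (X : BorelSpace) (q : ℕ) where
  open Indicator em
  open Constraints X q
  open CSP X q

  size : Subset X → Point PartialFunction → ℕ
  size W g = sum (λ j → ⟦ W (pt g j) ⟧)

  headSize : Subset X → ∀ m → (Fin m → Point PartialFunction) → ℕ
  headSize W zero    t = 0
  headSize W (suc _) t = size W (t zero)

  -- As in ∣dom_∣, the points of the domain are read off the first element.
  width : Subset X → Point Const → ℕ
  width W ((m , t , _) , _) = headSize W m t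

  -- Divided by `q ^ width (∁ W) B`, this is the conditional probability of violating `B` given the
  -- values of `h` on `W`.
  count : Subset X → (Point X → Fin q) → Point Const → ℕ
  count W h B = sum (λ i → ⟦ Agrees W h (element B i) ⟧)

-- Codes for constraints and analyticity of neighbourhoods.

module ConstraintCodes (em : ∀ {ℓ} → ExcludedMiddle ℓ) (X : BorelSpace) (std : IsStandardBorel X) (q : ℕ) where
  open Countability
  open Indicator em
  open Analyticity em
  open BiAnalyticity em
  open StandardBorelSpaces em X std
  open FiniteSubsets em
  open Constraints X q
  open Counts em X q
  open CSP X q
  open Suslin
  open BorelSpace X using (_≈_)
  private
    module S = Setoid (setoid X)
    module F = Setoid (setoid PartialFunction)
    suslin-V : Suslin (X ⊗ discrete (Fin q))
    suslin-V = suslin-⊗ suslin (suslin-Fin q)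

    eq-V : Eq-bi suslin-V
    eq-V = eq-⊗ suslin (suslin-Fin q) ≈-bi (eq-Fin q)

    suslin-G : Suslin [ X ⊗ discrete (Fin q) ]^<∞
    suslin-G = suslin-[]^<∞ suslin-V eq-V

    Gᶜ : Coded (Point [ X ⊗ discrete (Fin q) ]^<∞)
    Gᶜ = coded suslin-G

    eq-G : Eq-bi suslin-G
    eq-G = eq-[]^<∞ suslin-V eq-V

    opaque
      partial-bi : Bi (coded suslin-G) IsPartialFunction
      partial-bi = bi-resp {A = P} ((λ {g} → to {g}) , λ {g} → from {g}) (bi-Σ λ k → bi-∘ tr-sub
        {λ s → ∀ i j → proj₁ (s i) ≈ proj₁ (s j) → proj₂ (s i) ≡ proj₂ (s j)}
        (bi-∀ (Fin-countable k) λ i → bi-∀ (Fin-countable k) λ j →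
          bi-→ (bi-∘ (tr-pair (tr-∘ tr-proj₁ (tr-at i)) (tr-∘ tr-proj₁ (tr-at j))) ≈-bi)
               (bi-∘ (tr-pair (tr-∘ tr-proj₂ (tr-at i)) (tr-∘ tr-proj₂ (tr-at j))) (eq-Fin q))))
        where
        P : Pred (Point [ X ⊗ discrete (Fin q) ]^<∞) 0ℓ
        P (_ , s , _) = ∀ i j → proj₁ (s i) ≈ proj₁ (s j) → proj₂ (s i) ≡ proj₂ (s j)

        to : ∀ {g} → P g → IsPartialFunction g
        to {k , s , d} h {x} {y} {a} {b} (i , e , l) (j , e′ , l′) f = trans l (trans (h i j (S.trans (S.sym e) (S.trans f e′))) (sym l′))

        from : ∀ {g} → IsPartialFunction g → P g
        from {k , s , d} h i j = h (i , S.refl , refl) (j , S.refl , refl)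

    suslin-PF : Suslin PartialFunction
    suslin-PF = suslin-Subspace {[ X ⊗ discrete (Fin q) ]^<∞} suslin-G {IsPartialFunction} (proj₁ partial-bi)

    eq-PF : Eq-bi suslin-PF
    eq-PF = eq-Subspace {[ X ⊗ discrete (Fin q) ]^<∞} suslin-G {IsPartialFunction} (proj₁ partial-bi) eq-G

  PFᶜ : Coded (Point PartialFunction)
  PFᶜ = coded suslin-PF

  module _ {W : Subset X} (W-bi : Bi Xᶜ W) where

    size-simple : Simple {𝒴 = PFᶜ} (size W)
    size-simple r = bi-∘ tr-sub {λ (k , s , _) → sum (λ j → ⟦ W (proj₁ (s j)) ⟧) ≡ r}
      (bi-Σ λ k → bi-∘ tr-sub {λ s → sum (λ j → ⟦ W (proj₁ (s j)) ⟧) ≡ r}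
        (simple-sum (λ j → simple-⟦⟧ (bi-∘ (tr-∘ tr-proj₁ (tr-at j)) W-bi)) r))

    agrees-bi : ∀ {h} → (∀ a → Bi Xᶜ (λ x → h x ≡ a)) → Bi PFᶜ (Agrees W h)
    agrees-bi {h} h-bi = bi-∘ tr-sub {λ (k , s , _) → ∀ j → W (proj₁ (s j)) → h (proj₁ (s j)) ≡ proj₂ (s j)}
      (bi-Σ λ k → bi-∘ tr-sub {λ s → ∀ j → W (proj₁ (s j)) → h (proj₁ (s j)) ≡ proj₂ (s j)}
        (bi-∀ (Fin-countable k) λ j → bi-∘ (tr-at j) {λ (x , a) → W x → h x ≡ a}
          (bi-→ (bi-∘ tr-proj₁ W-bi) graph-bi)))
      where
      graph-bi : Bi (coded suslin-V) (λ (x , a) → h x ≡ a)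
      graph-bi = bi-resp ((λ { (a , e , refl) → e }) , λ e → _ , e , refl)
        (bi-∃ (Fin-countable q) λ a → bi-× (bi-∘ tr-proj₁ (h-bi a)) (bi-∘ tr-proj₂ (bi-Fin (_≡ a))))

  private
    dom-⊆-bi : Bi (PFᶜ ×ᶜ PFᶜ) (λ (g , h) → domᵖ g ⊆ domᵖ h)
    dom-⊆-bi = bi-resp {A = λ (g , h) → ∀ i → ∃[ j ] pt g i ≈ pt h j}
      ((λ {(g , h)} f {x} d → let (i , e) = dom-pt {g} d ; (j , e′) = f i in pt-dom {h} (j , S.trans e e′)) ,
       (λ {(g , h)} f i → dom-pt {h} (f {pt g i} (pt-dom {g} (i , S.refl)))))
      (bi-∘ {𝒵 = Gᶜ ×ᶜ Gᶜ} (tr-pair (tr-∘ tr-sub tr-proj₁) (tr-∘ tr-sub tr-proj₂))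
        {λ ((k , s , _) , (l , t , _)) → ∀ i → ∃[ j ] proj₁ (s i) ≈ proj₁ (t j)}
        (bi-slice₂ λ k l → bi-∀ (Fin-countable k) λ i → bi-∃ (Fin-countable l) λ j →
          bi-∘ (tr-pair (tr-∘ tr-proj₁ (tr-∘ (tr-at i) (tr-∘ tr-sub tr-proj₁)))
                        (tr-∘ tr-proj₁ (tr-∘ (tr-at j) (tr-∘ tr-sub tr-proj₂)))) ≈-bi))

    Fᶜ : Coded (Point [ PartialFunction ]^<∞)
    Fᶜ = coded (suslin-[]^<∞ suslin-PF eq-PF)

    opaque
      common-bi : Bi Fᶜ HasCommonDomain
      common-bi = bi-Σ λ m → bi-∘ tr-sub
        {λ t → ∀ {g h} → (∃[ i ] g F.≈ t i) → (∃[ i ] h F.≈ t i) → domᵖ g ⊆ domᵖ h} (bi-resp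
        {A = λ t → ∀ i j → domᵖ (t i) ⊆ domᵖ (t j)}
        ((λ {t} f {g} {h} (i , e) (j , e′) d → dom-resp {t j} {h} (F.sym {h} {t j} e′) (f i j (dom-resp {g} {t i} e d))) ,
         (λ {t} f i j → f {t i} {t j} (i , F.refl {t i}) (j , F.refl {t j})))
        (bi-∀ (Fin-countable m) λ i → bi-∀ (Fin-countable m) λ i′ →
          bi-∘ (tr-pair (tr-at i) (tr-at i′)) dom-⊆-bi))

  suslin-Const : Suslin Const
  suslin-Const = suslin-Subspace (suslin-[]^<∞ suslin-PF eq-PF) (proj₁ common-bi)

  Constᶜ : Coded (Point Const)
  Constᶜ = coded suslin-Const

  module _ {W : Subset X} (W-bi : Bi Xᶜ W) where

    width-simple : Simple {𝒴 = Constᶜ} (width W)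
    width-simple r = bi-∘ tr-sub {λ (m , t , _) → headSize W m t ≡ r}
      (bi-Σ λ m → bi-∘ tr-sub {λ t → headSize W m t ≡ r} (slice m))
      where
      slice : ∀ m → Bi (PFᶜ ^ᶜ m) (λ t → headSize W m t ≡ r)
      slice zero    = simple-const 0 r
      slice (suc m) = bi-∘ (tr-at zero) (size-simple W-bi r)

    count-simple : ∀ {h} → (∀ a → Bi Xᶜ (λ x → h x ≡ a)) → Simple {𝒴 = Constᶜ} (count W h)
    count-simple {h} h-bi r = bi-∘ tr-sub {λ (m , t , _) → sum (λ i → ⟦ Agrees W h (t i) ⟧) ≡ r}
      (bi-Σ λ m → bi-∘ tr-sub {λ t → sum (λ i → ⟦ Agrees W h (t i) ⟧) ≡ r}
        (simple-sum (λ i → simple-⟦⟧ (bi-∘ (tr-at i) (agrees-bi W-bi h-bi))) r))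

  dom-bi : Bi (Xᶜ ×ᶜ Constᶜ) (λ (x , B) → dom B x)
  dom-bi = bi-resp ((λ {(x , B)} (i , d) → element⇒dom {B} {x} {i} d) , λ {(x , B)} → dom⇒element {B} {x})
    (bi-∘ {𝒵 = Xᶜ ×ᶜ Fᶜ} (tr-pair tr-proj₁ (tr-∘ tr-sub tr-proj₂)) {λ (x , m , t , _) → ∃[ i ] domᵖ (t i) x}
      (bi-slice λ m → bi-∃ (Fin-countable m) λ i →
        bi-∘ (tr-pair tr-proj₁ (tr-∘ (tr-at i) (tr-∘ tr-sub tr-proj₂))) domᵖ-bi))
    where
    domᵖ-bi : Bi (Xᶜ ×ᶜ PFᶜ) (λ (x , g) → domᵖ g x)
    domᵖ-bi = bi-resp ((λ {(x , g)} → pt-dom {g}) , λ {(x , g)} → dom-pt {g})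
      (bi-∘ {𝒵 = Xᶜ ×ᶜ Gᶜ} (tr-pair tr-proj₁ (tr-∘ tr-sub tr-proj₂)) {λ (x , k , s , _) → ∃[ j ] x ≈ proj₁ (s j)}
        (bi-slice λ k → bi-∃ (Fin-countable k) λ j →
          bi-∘ (tr-pair tr-proj₁ (tr-∘ tr-proj₁ (tr-∘ (tr-at j) (tr-∘ tr-sub tr-proj₂)))) ≈-bi))

  -- The constraint and the point range over uncountable spaces: these are the projections after
  -- which only analyticity is retained.
  neighbourhood-an : ∀ {𝓒 A} → Analytic Constᶜ 𝓒 → Analytic Xᶜ A →
                     Analytic Xᶜ (λ y → ∃[ B ] 𝓒 B × dom B y × ∃[ x ] A x × dom B x)
  neighbourhood-an c a = an-∃ (an-× (an-∘ tr-proj₂ c) (an-× (proj₁ dom-bi)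
    (an-∃ (an-× (an-∘ tr-proj₂ a) (an-∘ (tr-pair tr-proj₂ (tr-∘ tr-proj₂ tr-proj₁)) (proj₁ dom-bi))))))

-- Borel selection of values on finite components.

module Least (em : ∀ {ℓ} → ExcludedMiddle ℓ) where

  IsLeast : ∀ {ℓ} → Pred ℕ ℓ → Pred ℕ ℓ
  IsLeast P n = P n × (∀ m → m ℕ.< n → ¬ P m)

  opaque
    least : ∀ {ℓ} (P : Pred ℕ ℓ) → ∃ P → ∃ (IsLeast P)
    least P (n , p) = go n (<-wellFounded n) p
      where
      go : ∀ n → Acc ℕ._<_ n → P n → ∃ (IsLeast P)
      go n (acc rs) p with em {P = ∃[ m ] m ℕ.< n × P m}
      ... | yes (m , m<n , p′) = go m (rs m<n) p′
      ... | no ¬smaller        = n , p , λ m m<n p′ → ¬smaller (m , m<n , p′)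

  least-unique : ∀ {ℓ} {P : Pred ℕ ℓ} {m n} → IsLeast P m → IsLeast P n → m ≡ n
  least-unique {m = m} {n} (p , h) (p′ , h′) with ℕ.<-cmp m n
  ... | tri< m<n _ _ = contradiction p (h′ m m<n)
  ... | tri≈ _ e _   = e
  ... | tri> _ _ n<m = contradiction p′ (h n n<m)

module Adjacency (X : BorelSpace) (q : ℕ) where
  open import Relation.Binary.Construct.Closure.ReflexiveTransitive using (Star)
  open CSP X q

  module _ (𝓑 : Subset Const) (U : Subset X) where

    -- Unlike `G[ 𝓑 ]`, this does not exclude `x ≈ y`; the two notions of component are compared in
    -- `connected⇒star`.
    Adjacent : Point X → Point X → Set
    Adjacent x y = U x × U y × ∃[ B ] 𝓑 B × dom B x × dom B y

    Connected : Point X → Point X → Set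
    Connected = Star Adjacent

    adjacent-sym : ∀ {x y} → Adjacent x y → Adjacent y x
    adjacent-sym (u , v , B , b , d , d′) = v , u , B , b , d′ , d

module Selection (em : ∀ {ℓ} → ExcludedMiddle ℓ) (X : BorelSpace) (std : IsStandardBorel X) (q : ℕ) where
  open import Relation.Binary.Construct.Closure.ReflexiveTransitive using (ε; _◅_; _◅◅_)
  open Countability
  open Indicator em
  open Least em
  open Analyticity em
  open BiAnalyticity em
  open BorelAlgebra em X
  open StandardBorelSpaces em X std
  open SeparationTheorems em X std
  open Adjacency X q
  open ConstraintCodes em X std q
  open CSP X q
  open Suslin
  open BorelSpace X using (_≈_; _∈ˡ_)

  BorelFun : (Point X → Fin q) → Set₁
  BorelFun h = ∀ a → Borel X (λ x → h x ≡ a)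

  borelFun-resp : ∀ {h} → BorelFun h → ∀ {x y} → x ≈ y → h x ≡ h y
  borelFun-resp {h} b {x} e = sym (BorelSpace.respects X (b (h x)) e refl)

  module _ {U : Subset X} (U-borel : Borel X U) {f₀ : Point X → Fin q} (f₀-borel : BorelFun f₀) where

    -- An entry `(i , m , b)` assigns the value `b` on the part of a ball lying in `U`. The first
    -- entry that applies counts, and `f₀` is the default, in particular outside `U`.
    decode : List (ℕ × ℕ × ℕ) → Point X → Fin q
    decode []                x = f₀ x
    decode ((i , m , b) ∷ L) x with em {P = U x × Ball i m x × b ℕ.< q}
    ... | yes (_ , _ , b<q) = fromℕ< b<q
    ... | no _              = decode L x

    decode-off : ∀ L {x} → ¬ U x → decode L x ≡ f₀ x
    decode-off []                ¬u = refl
    decode-off ((i , m , b) ∷ L) {x} ¬u with em {P = U x × Ball i m x × b ℕ.< q}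
    ... | yes (u , _) = contradiction u ¬u
    ... | no _        = decode-off L ¬u

    decode-borel : ∀ L → BorelFun (decode L)
    decode-borel []                a = f₀-borel a
    decode-borel ((i , m , b) ∷ L) a = BorelSpace.resp-≐ X (to , from)
      (borel-∪ (borel-∩ P-borel (borel-const (b ≡ toℕ a)))
               (borel-∩ (BorelSpace.∁-Borel X P-borel) (decode-borel L a)))
      where
      P : Subset X
      P x = U x × Ball i m x × b ℕ.< q

      P-borel : Borel X P
      P-borel = borel-∩ U-borel (borel-∩ (ball-Borel i m) (borel-const (b ℕ.< q)))

      to : ∀ {x} → P x × b ≡ toℕ a ⊎ ¬ P x × decode L x ≡ a → decode ((i , m , b) ∷ L) x ≡ a
      to {x} h with em {P = P x}
      to (inj₁ (_ , refl)) | yes (_ , _ , b<q) = Fin.fromℕ<-toℕ a b<q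
      to (inj₂ (¬p , _))   | yes p             = contradiction p ¬p
      to (inj₁ (p , _))    | no ¬p             = contradiction p ¬p
      to (inj₂ (_ , e))    | no ¬p             = e

      from : ∀ {x} → decode ((i , m , b) ∷ L) x ≡ a → P x × b ≡ toℕ a ⊎ ¬ P x × decode L x ≡ a
      from {x} e with em {P = P x}
      ... | yes p@(_ , _ , b<q) = inj₁ (p , trans (sym (Fin.toℕ-fromℕ< b<q)) (cong toℕ e))
      ... | no ¬p               = inj₂ (¬p , e)

    -- The ball chosen for a point contains no other point of the whole list `xs`, so entries placed
    -- in front of each other do not interfere on `xs`.
    decode-onto : ∀ {h : Point X → Fin q} → (∀ {x y} → x ≈ y → h x ≡ h y) → ∀ xs →
                  ∃[ L ] (∀ {y} → y ∈ₗ xs → U y → decode L y ≡ h y)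
    decode-onto {h} h-resp xs = let (L , ok) = go xs in L , λ y∈ → ok y∈ y∈
      where
      go : ∀ ys → ∃[ L ] (∀ {z} → z ∈ₗ xs → z ∈ₗ ys → U z → decode L z ≡ h z)
      go []       = [] , λ _ ()
      go (y ∷ ys) with go ys | ball-avoiding y xs
      ... | L , ok | i , m , y∈ball , avoid = (i , m , toℕ (h y)) ∷ L , label
        where
        label : ∀ {z} → z ∈ₗ xs → z ∈ₗ y ∷ ys → U z → decode ((i , m , toℕ (h y)) ∷ L) z ≡ h z
        label {z} z∈ z∈ys u with em {P = U z × Ball i m z × toℕ (h y) ℕ.< q}
        label z∈ _          u | yes (_ , z∈ball , lt) = trans (Fin.fromℕ<-toℕ (h y) lt) (h-resp (avoid z∈ z∈ball))
        label z∈ (here refl) u | no ¬p = contradiction (u , y∈ball , Fin.toℕ<n (h y)) ¬p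
        label z∈ (there z∈ys) u | no _ = ok z∈ z∈ys u

    entryAt : ℕ → ℕ × ℕ × ℕ
    entryAt n = let (a , k) = unpair n ; (i , m) = unpair a in i , m , k

    entryAt-surjective : ∀ t → ∃[ n ] entryAt n ≡ t
    entryAt-surjective (i , m , k) with a , p ← unpair-surjective i m with n , r ← unpair-surjective a k =
      n , trans (cong (λ z → proj₁ (unpair (proj₁ z)) , proj₂ (unpair (proj₁ z)) , proj₂ z) r)
                (cong (λ z → proj₁ z , proj₂ z , k) p)

    candidate : ℕ → Point X → Fin q
    candidate n = decode (listAt entryAt n)

    candidate-borel : ∀ n → BorelFun (candidate n)
    candidate-borel n = decode-borel (listAt entryAt n)

    candidate-onto : ∀ {h : Point X → Fin q} → (∀ {x y} → x ≈ y → h x ≡ h y) → ∀ xs →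
                     ∃[ n ] (∀ {y} → y ∈ₗ xs → U y → candidate n y ≡ h y)
    candidate-onto h-resp xs =
      let (L , ok) = decode-onto h-resp xs ; (n , e) = listAt-surjective entryAt entryAt-surjective L in
      n , λ y∈ u → trans (cong (λ L → decode L _) e) (ok y∈ u)

    -- Both rounds pass through here; they differ in `U`, in the values `f₀` given in advance and in
    -- the notion of a bad constraint.
    module _ {𝓑 : Subset Const} (𝓑-an : Analytic Constᶜ 𝓑)
      {bad : (Point X → Fin q) → Subset Const}
      (bad-an : ∀ {h} → BorelFun h → Analytic Constᶜ (bad h))
      (bad-local : ∀ {h h′ B} → (∀ {x} → dom B x → h x ≡ h′ x) → bad h B → bad h′ B)
      (component-finite : ∀ {x} → U x → BorelSpace.IsFinite X (Connected 𝓑 U x))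
      (component-good : ∀ {x} → U x → ∃[ h ] (∀ {y z} → y ≈ z → h y ≡ h z) × (∀ {y} → ¬ U y → h y ≡ f₀ y) ×
                        (∀ {B y} → 𝓑 B → dom B y → U y → Connected 𝓑 U x y → ¬ bad h B))
      where

      private
        U-an : Analytic Xᶜ U
        U-an = proj₁ (Suslin.borel-bi suslin U-borel)

        Bad₀ : ℕ → Subset X
        Bad₀ n y = U y × ∃[ B ] (𝓑 B × bad (candidate n) B) × dom B y × ∃[ x ] ⊤ × dom B x

        Next : Subset X → Subset X
        Next A y = U y × ∃[ B ] 𝓑 B × dom B y × ∃[ x ] (U x × A x) × dom B x

        next-an : ∀ {A} → Analytic Xᶜ A → Analytic Xᶜ (Next A)
        next-an a = an-× U-an (neighbourhood-an 𝓑-an (an-× U-an a))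

        Bads : ℕ → ℕ → Subset X
        Bads n zero    = Bad₀ n
        Bads n (suc j) = Next (Bads n j)

        bads-an : ∀ n j → Analytic Xᶜ (Bads n j)
        bads-an n zero    = an-× U-an (neighbourhood-an (an-× 𝓑-an (bad-an (candidate-borel n))) (an-const ⊤))
        bads-an n (suc j) = next-an (bads-an n j)

        -- The points of `U` from which a chain of adjacent points leads to the domain of a
        -- constraint that is bad for the candidate; `j` counts its steps.
        Bad : ℕ → Subset X
        Bad n x = ∃[ j ] Bads n j x

        bad-an′ : ∀ n → Analytic Xᶜ (Bad n)
        bad-an′ n = an-⋃ ℕ-countable (bads-an n)

        bads-U : ∀ n j {x} → Bads n j x → U x
        bads-U n zero    = proj₁
        bads-U n (suc j) = proj₁

        bads-witness : ∀ n j {x} → Bads n j x →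
                       ∃₂ λ B y → 𝓑 B × bad (candidate n) B × dom B y × U y × Connected 𝓑 U x y
        bads-witness n zero    (u , B , (b , bad) , d , _) = B , _ , b , bad , d , u , ε
        bads-witness n (suc j) (u , B , b , d , x , (v , p) , d′) =
          let (B′ , y , b′ , bad , e , w , c) = bads-witness n j p in
          B′ , y , b′ , bad , e , w , (u , v , B , b , d , d′) ◅ c

        -- Some candidate imitates the good values `h` on the finite component. The domain of a
        -- constraint touching the component lies in it except for points outside `U`, and there
        -- both functions equal `f₀`.
        good-candidate : ∀ {x} → U x → ∃[ n ] ¬ Bad n x
        good-candidate {x} u =
          let (xs , covers) = component-finite u
              (h , h-resp , h-off , good) = component-good u
              (n , ok) = candidate-onto h-resp xs
          in n , λ (j , p) → let (B , y , b , bad-B , d , v , c) = bads-witness n j p in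
            good {B} {y} b d v c (bad-local {candidate n} {h} {B} (λ {z} e → case em {P = U z} of λ
              { (no ¬w) → trans (decode-off (listAt entryAt n) ¬w) (sym (h-off ¬w))
              ; (yes w) → on-component {h} {n} h-resp ok (covers (c ◅◅ (v , w , B , b , d , e) ◅ ε)) w }) bad-B)
          where
          on-component : ∀ {h : Point X → Fin q} {n xs z} → (∀ {y z} → y ≈ z → h y ≡ h z) →
                         (∀ {y} → y ∈ₗ xs → U y → candidate n y ≡ h y) → z ∈ˡ xs → U z → candidate n z ≡ h z
          on-component {n = n} h-resp ok z∈ w = let (z′ , z′∈ , z≈z′) = findₗ z∈ in
            trans (borelFun-resp (candidate-borel n) z≈z′)
              (trans (ok z′∈ (BorelSpace.respects X U-borel z≈z′ w)) (sym (h-resp z≈z′)))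

        separated : Σ[ V ∈ (ℕ → Subset X) ]
          (∀ n → Borel X (V n)) × (∀ n {x} → Bad n x → V n x) × (∀ x → ¬ (∀ n → V n x))
        separated = novikov bad-an′ λ x p →
          let (n , ¬bad) = good-candidate (bads-U 0 (proj₁ (p 0)) (proj₂ (p 0))) in ¬bad (p n)

        record Part (n : ℕ) : Set₁ where
          field
            Member : Subset X
            borel  : Borel X Member
            avoids : ∀ {x} → Member x → ¬ Bad n x

        open Part

        initial : ∀ n → Part n
        initial n = let (V , V-borel , bad⊆V , _) = separated in record
          { Member = λ x → ¬ V n x
          ; borel  = BorelSpace.∁-Borel X (V-borel n)
          ; avoids = λ ¬v bad → ¬v (bad⊆V n bad)
          }

        -- Analyticity of Next is all that is known; separation replaces it by
        -- a larger Borel set that still avoids the invariant set Bad n.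
        saturate : ∀ {n} (D : Part n) → Σ[ D′ ∈ Part n ] (∀ {y} → Next (Member D) y → Member D′ y)
        saturate {n} D =
          let (C , c , sub , dis) = lusin (next-an (proj₁ (Suslin.borel-bi suslin (borel D)))) (bad-an′ n)
                (λ { (u , B , b , d , x , (v , p) , d′) (j , bad) → avoids D p (suc j , v , B , b , d′ , _ , (u , bad) , d) })
          in record { Member = C ; borel = c ; avoids = dis } , sub

        parts : ∀ n → ℕ → Part n
        parts n zero    = initial n
        parts n (suc i) = proj₁ (saturate (parts n i))

        D : ℕ → Subset X
        D n x = ∃[ i ] Member (parts n i) x

        D-borel : ∀ n → Borel X (D n)
        D-borel n = BorelSpace.⋃-Borel X (λ i → borel (parts n i))

        D-avoids : ∀ {n x} → D n x → ¬ Bad n x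
        D-avoids {n} (i , p) = avoids (parts n i) p

        D-invariant : ∀ {n x y} → Adjacent 𝓑 U x y → D n x → D n y
        D-invariant {n} (u , v , B , b , d , d′) (i , p) =
          suc i , proj₂ (saturate (parts n i)) (v , B , b , d′ , _ , (u , p) , d)

        D-covers : ∀ x → ∃[ n ] D n x
        D-covers x = let (V , _ , _ , dis) = separated ; (n , ¬v) = ¬∀⇒∃¬ (dis x) in n , 0 , ¬v

        choice : Point X → ℕ
        choice x = proj₁ (least (λ n → D n x) (D-covers x))

        choice-least : ∀ x → IsLeast (λ n → D n x) (choice x)
        choice-least x = proj₂ (least (λ n → D n x) (D-covers x))

        least-borel : ∀ n → Borel X (λ x → IsLeast (λ n → D n x) n)
        least-borel n = borel-∩ (D-borel n) (borel-⋂ λ m → borel-⇒ (m ℕ.< n) (BorelSpace.∁-Borel X (D-borel m)))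

        choice-invariant : ∀ {x y} → Adjacent 𝓑 U x y → choice x ≡ choice y
        choice-invariant {x} {y} xy = least-unique {P = λ n → D n x} (choice-least x)
          (let (p , h) = choice-least y in
            D-invariant {choice y} (adjacent-sym 𝓑 U xy) p , λ m m< p′ → h m m< (D-invariant {m} xy p′))

        solution : Point X → Fin q
        solution x = candidate (choice x) x

        solution-borel : BorelFun solution
        solution-borel a = BorelSpace.resp-≐ X {A = λ x → ∃[ n ] Chosen n x} {B = λ x → solution x ≡ a}
          ((λ {x} → to {x}) , λ {x} e → choice x , choice-least x , e)
          (BorelSpace.⋃-Borel X {A = Chosen} λ n → borel-∩ (least-borel n) (candidate-borel n a))
          where
          Chosen : ℕ → Subset X
          Chosen n x = IsLeast (λ k → D k x) n × candidate n x ≡ a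

          to : ∀ {x} → ∃[ n ] Chosen n x → solution x ≡ a
          to {x} (n , l , e) = trans (cong (λ k → candidate k x) (least-unique {P = λ k → D k x} (choice-least x) l)) e

        candidate-off : ∀ n {y} → ¬ U y → candidate n y ≡ f₀ y
        candidate-off n = decode-off (listAt entryAt n)

        solution-off : ∀ {y} → ¬ U y → solution y ≡ f₀ y
        solution-off {y} = candidate-off (choice y)

        -- On the domain of one constraint the solution follows a single candidate: its points in
        -- `U` belong to one component and share the index, and outside `U` all candidates coincide.
        solution-agrees : ∀ {B x z} → 𝓑 B → dom B x → U x → dom B z → solution z ≡ candidate (choice x) z
        solution-agrees {B} {x} {z} b d u e = case em {P = U z} of λ
          { (yes w) → cong (λ n → candidate n z) (sym (choice-invariant {x} {z} (u , w , B , b , d , e)))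
          ; (no ¬w) → trans (solution-off ¬w) (sym (candidate-off (choice x) ¬w)) }

        solution-good : ∀ {B x} → 𝓑 B → dom B x → U x → ¬ bad solution B
        solution-good {B} {x} b d u bad-B = D-avoids {choice x} {x} (proj₁ (choice-least x))
          (0 , u , B , (b , bad-candidate) , d , x , tt , d)
          where
          bad-candidate : bad (candidate (choice x)) B
          bad-candidate = bad-local {solution} {candidate (choice x)} {B} (λ {z} → solution-agrees {B} {x} {z} b d u) bad-B

      selection : ∃[ h ] BorelFun h × (∀ {y} → ¬ U y → h y ≡ f₀ y) ×
                  (∀ {B x} → 𝓑 B → dom B x → U x → ¬ bad h B)
      selection = solution , solution-borel , solution-off , λ {B} {x} → solution-good {B} {x}

-- Counting arguments and the points of a domain.

module Counting (em : ∀ {ℓ} → ExcludedMiddle ℓ) where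
  open import Data.Nat.Base using (_+_; _≤_; z≤n; s≤s)
  open import Data.Nat.Properties
  open Indicator em
  open FiniteSums

  sum-injection : ∀ {m n} (a : Fin m → ℕ) (b : Fin n → ℕ) (σ : Fin m → Fin n) →
                  (∀ {i j} → σ i ≡ σ j → i ≡ j) → (∀ i → a i ≤ b (σ i)) → sum a ≤ sum b
  sum-injection {zero}          a b σ inj h = z≤n
  sum-injection {suc m} {zero}  a b σ inj h with σ zero
  ... | ()
  sum-injection {suc m} {suc n} a b σ inj h = begin
    a zero + sum (a ∘ suc) ≤⟨ +-mono-≤ (h zero) (sum-injection (a ∘ suc) (removeAt b (σ zero)) σ′ inj′ h′) ⟩
    b (σ zero) + sum (removeAt b (σ zero)) ≡⟨ sum-remove b ⟨
    sum b ∎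
    where
    open ≤-Reasoning
    σ0≢ : ∀ i → ¬ σ zero ≡ σ (suc i)
    σ0≢ i e = Fin.0≢1+n (inj e)

    σ′ : Fin m → Fin n
    σ′ i = punchOut (σ0≢ i)

    inj′ : ∀ {i j} → σ′ i ≡ σ′ j → i ≡ j
    inj′ {i} {j} e = Fin.suc-injective (inj (Fin.punchOut-injective (σ0≢ i) (σ0≢ j) e))

    h′ : ∀ i → a (suc i) ≤ removeAt b (σ zero) (σ′ i)
    h′ i = subst (λ k → a (suc i) ≤ b k) (sym (Fin.punchIn-punchOut (σ0≢ i))) (h (suc i))

  sum-⟦⟧≤⟦⟧ : ∀ {n} {P : Fin n → Set} {Q : Set} → (∀ {a b} → P a → P b → a ≡ b) → (∀ {a} → P a → Q) →
              sum (λ a → ⟦ P a ⟧) ≤ ⟦ Q ⟧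
  sum-⟦⟧≤⟦⟧ {zero}          unique imp = z≤n
  sum-⟦⟧≤⟦⟧ {suc n} {P} {Q} unique imp = case em {P = P zero} of λ
    { (yes p) → ≤-reflexive (trans (cong₂ _+_ (⟦⟧-yes p)
        (trans (sum-cong-≗ {n} (λ a → ⟦⟧-no λ p′ → Fin.0≢1+n (unique p p′)))
          (trans (sum-const n 0) (*-zeroʳ n)))) (sym (⟦⟧-yes (imp p))))
    ; (no ¬p) → subst (λ k → k + sum (λ a → ⟦ P (suc a) ⟧) ≤ ⟦ Q ⟧) (sym (⟦⟧-no ¬p))
        (sum-⟦⟧≤⟦⟧ (λ p p′ → Fin.suc-injective (unique p p′)) imp) }

  ⟦⟧≤1 : {P : Set} → ⟦ P ⟧ ≤ 1
  ⟦⟧≤1 {P} = ≤-trans (⟦⟧-mono {P = P} (λ _ → tt)) (≤-reflexive (⟦⟧-yes tt))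

  module _ (S : Setoid 0ℓ 0ℓ) where
    open Setoid S using (_≈_) renaming (Carrier to A)
    private module S = Setoid S

    delete : ∀ {x : A} {ys} → Any (x ≈_) ys →
             ∃[ zs ] length ys ≡ suc (length zs) × (∀ {y} → ¬ x ≈ y → Any (y ≈_) ys → Any (y ≈_) zs)
    delete {ys = _ ∷ zs} (here e) = zs , refl , λ { x≉y (here e′) → contradiction (S.trans e (S.sym e′)) x≉y ; _ (there p) → p }
    delete {ys = y ∷ _} (there p) = let (zs , e , h) = delete p in
      y ∷ zs , cong suc e , λ { x≉y (here e′) → here e′ ; x≉y (there p′) → there (h x≉y p′) }

    pigeonhole : ∀ {xs ys : List A} → AllPairs (λ x y → ¬ x ≈ y) xs → All (λ x → Any (x ≈_) ys) xs →
      length xs ≤ length ys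
    pigeonhole []               []       = z≤n
    pigeonhole (x≉ ∷ pairs) (p ∷ ps) = let (zs , e , h) = delete p in
      subst (_ ≤_) (sym e) (s≤s (pigeonhole pairs (All.zipWith (λ (x≉y , q) → h x≉y q) (x≉ , ps))))

    enumerate : ∀ {P : A → Set} → (∀ {x y} → x ≈ y → P x → P y) → (ys : List A) → (∀ {x} → P x → Any (x ≈_) ys) →
                ∃[ zs ] AllPairs (λ (x y : ∃ P) → ¬ proj₁ x ≈ proj₁ y) zs ×
                        (∀ (x : ∃ P) → Any (λ z → proj₁ x ≈ proj₁ z) zs)
    enumerate {P} P-resp ys covers = let (zs , unique , h) = go ys in zs , unique , λ x → h x (covers (proj₂ x))
      where
      go : ∀ ys → ∃[ zs ] AllPairs (λ (x y : ∃ P) → ¬ proj₁ x ≈ proj₁ y) zs ×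
                          (∀ (x : ∃ P) → Any (proj₁ x ≈_) ys → Any (λ z → proj₁ x ≈ proj₁ z) zs)
      go [] = [] , [] , λ _ ()
      go (y ∷ ys) with go ys | em {P = P y}
      ... | zs , unique , h | no ¬p = zs , unique , λ { (x , p) (here e) → contradiction (P-resp e p) ¬p ; x (there m) → h x m }
      ... | zs , unique , h | yes p with em {P = Any (λ z → y ≈ proj₁ z) zs}
      ...   | yes m = zs , unique , λ { x (here e) → Any.map (S.trans e) m ; x (there m′) → h x m′ }
      ...   | no ¬m = (y , p) ∷ zs , All.¬Any⇒All¬ zs ¬m ∷ unique , λ { x (here e) → here e ; x (there m′) → there (h x m′) }

module Points (em : ∀ {ℓ} → ExcludedMiddle ℓ) (X : BorelSpace) (q : ℕ) where
  open import Data.Nat.Base using (_+_; _≤_; z≤n)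
  open import Data.Nat.Properties
  open Indicator em
  open FiniteSums
  open Counting em
  open Constraints X q
  open Counts em X q
  open CSP X q
  open Integration em (setoid X) q
  open BorelSpace X using (_≈_)
  private
    module S = Setoid (setoid X)
    module F = Setoid (setoid PartialFunction)

  module _ (W : Subset X) where

    select : ∀ {k} → (Fin k → Point X) → List (Point X)
    select {zero}  p = []
    select {suc k} p with em {P = W (p zero)}
    ... | yes _ = p zero ∷ select (p ∘ suc)
    ... | no _  = select (p ∘ suc)

    length-select : ∀ {k} (p : Fin k → Point X) → length (select p) ≡ sum (λ j → ⟦ W (p j) ⟧)
    length-select {zero}  p = refl
    length-select {suc k} p with em {P = W (p zero)}
    ... | yes _ = cong suc (length-select (p ∘ suc))
    ... | no _  = length-select (p ∘ suc)

    select-sound : ∀ {k} (p : Fin k → Point X) → All (λ x → W x × ∃[ j ] x ≡ p j) (select p)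
    select-sound {zero}  p = []
    select-sound {suc k} p with em {P = W (p zero)}
    ... | yes w = (w , zero , refl) ∷ All.map (λ (v , j , e) → v , suc j , e) (select-sound (p ∘ suc))
    ... | no _  = All.map (λ (v , j , e) → v , suc j , e) (select-sound (p ∘ suc))

    select-complete : ∀ {k} (p : Fin k → Point X) j → W (p j) → Any (p j ≈_) (select p)
    select-complete {suc k} p j w with em {P = W (p zero)}
    select-complete {suc k} p zero    w | yes _ = here S.refl
    select-complete {suc k} p (suc j) w | yes _ = there (select-complete (p ∘ suc) j w)
    select-complete {suc k} p zero    w | no ¬w = contradiction w ¬w
    select-complete {suc k} p (suc j) w | no _  = select-complete (p ∘ suc) j w

    select-unique : ∀ {k} (p : Fin k → Point X) → (∀ {i j} → p i ≈ p j → i ≡ j) →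
      AllPairs (λ x y → ¬ x ≈ y) (select p)
    select-unique {zero}  p inj = []
    select-unique {suc k} p inj with em {P = W (p zero)}
    ... | yes _ = All.map (λ { (_ , j , refl) e → Fin.0≢1+n (inj e) }) (select-sound (p ∘ suc))
                  ∷ select-unique (p ∘ suc) (Fin.suc-injective ∘ inj)
    ... | no _  = select-unique (p ∘ suc) (Fin.suc-injective ∘ inj)

  headPoints : Subset X → ∀ m → (Fin m → Point PartialFunction) → List (Point X)
  headPoints W zero    t = []
  headPoints W (suc _) t = select W (pt (t zero))

  domPoints : Subset X → Point Const → List (Point X)
  domPoints W ((m , t , _) , _) = headPoints W m t

  length-domPoints : ∀ W B → length (domPoints W B) ≡ width W B
  length-domPoints W ((zero  , t , _) , _) = refl
  length-domPoints W ((suc _ , t , _) , _) = length-select W (pt (t zero))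

  domPoints-sound : ∀ W B → All (λ x → W x × dom B x) (domPoints W B)
  domPoints-sound W ((zero  , t , _) , _) = []
  domPoints-sound W B@((suc _ , t , _) , _) = All.map
    (λ { (w , j , refl) → w , element⇒dom {B} {pt (t zero) j} {zero} (pt-dom {t zero} (j , S.refl)) })
    (select-sound W (pt (t zero)))

  domPoints-complete : ∀ W B → (∀ {x y} → x ≈ y → W x → W y) → ∀ {x} → W x → dom B x → Any (x ≈_) (domPoints W B)
  domPoints-complete W B@((zero  , t , _) , _) W-resp {x} w d = case proj₁ (dom⇒element {B} {x} d) of λ ()
  domPoints-complete W B@((suc _ , t , _) , _) W-resp {x} w d =
    let (j , e) = dom-pt {t zero} {x} (dom⇒all {B} {x} d zero) in
    Any.map (S.trans e) (select-complete W (pt (t zero)) j (W-resp e w))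

  domPoints-unique : ∀ W B → AllPairs (λ x y → ¬ x ≈ y) (domPoints W B)
  domPoints-unique W ((zero  , t , _) , _) = []
  domPoints-unique W ((suc _ , t , _) , _) = select-unique W (pt (t zero)) (pt-injective (t zero))

  width-split : ∀ W B → width W B + width (∁ W) B ≡ ∣dom B ∣
  width-split W ((zero  , t , _) , _) = refl
  width-split W ((suc _ , t , _) , _) = trans (sym (∑-distrib-+ (λ j → ⟦ W (pt (t zero) j) ⟧) (λ j → ⟦ ¬ W (pt (t zero) j) ⟧)))
    (trans (sum-cong-≗ one) (trans (sum-const (arity (t zero)) 1) (*-identityʳ _)))
    where
    one : ∀ j → ⟦ W (pt (t zero) j) ⟧ + ⟦ ¬ W (pt (t zero) j) ⟧ ≡ 1
    one j = case em {P = W (pt (t zero) j)} of λ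
      { (yes w) → cong₂ _+_ (⟦⟧-yes w) (⟦⟧-no λ ¬w → ¬w w)
      ; (no ¬w) → cong₂ _+_ (⟦⟧-no ¬w) (⟦⟧-yes ¬w) }

  -- A partial function prescribes the values on xs, so at most one of the
  -- assignments of values to xs agrees with it.
  I-agrees : ∀ g xs {W : Subset X} → (∀ {x y} → x ≈ y → W x → W y) →
             AllPairs (λ x y → ¬ x ≈ y) xs → All (λ x → ¬ W x × domᵖ g x) xs →
             ∀ f → I xs (λ h → ⟦ Agrees (λ y → W y ⊎ Any (_≈ y) xs) h g ⟧) f ≤ ⟦ Agrees W f g ⟧
  I-agrees g [] {W} W-resp [] [] f = ⟦⟧-mono λ ag j w → ag j (inj₁ w)
  I-agrees g (x ∷ xs) {W} W-resp (x≉ ∷ pairs) ((¬w , d) ∷ ok) f = begin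
    sum (λ a → I xs (λ h → ⟦ Agrees (λ y → W y ⊎ Any (_≈ y) (x ∷ xs)) h g ⟧) (f [ x ≔ a ]))
      ≤⟨ sum-mono (λ a → I-mono xs (λ h → ⟦⟧-mono (regroup h)) (f [ x ≔ a ])) ⟩
    sum (λ a → I xs (λ h → ⟦ Agrees (λ y → W′ y ⊎ Any (_≈ y) xs) h g ⟧) (f [ x ≔ a ]))
      ≤⟨ sum-mono (λ a → I-agrees g xs W′-resp pairs (All.zipWith disjoint (x≉ , ok)) (f [ x ≔ a ])) ⟩
    sum (λ a → ⟦ Agrees W′ (f [ x ≔ a ]) g ⟧)
      ≤⟨ sum-⟦⟧≤⟦⟧ (λ p p′ → trans (value p) (sym (value p′))) agrees ⟩
    ⟦ Agrees W f g ⟧ ∎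
    where
    open ≤-Reasoning
    W′ : Subset X
    W′ y = W y ⊎ x ≈ y

    W′-resp : ∀ {y z} → y ≈ z → W′ y → W′ z
    W′-resp e = Sum.map (W-resp e) (λ h → S.trans h e)

    disjoint : ∀ {y} → (¬ x ≈ y) × (¬ W y × domᵖ g y) → ¬ W′ y × domᵖ g y
    disjoint (x≉y , ¬w , d) = [ ¬w , x≉y ] , d

    regroup : ∀ h → Agrees (λ y → W y ⊎ Any (_≈ y) (x ∷ xs)) h g → Agrees (λ y → W′ y ⊎ Any (_≈ y) xs) h g
    regroup h ag j = ag j ∘ λ { (inj₁ (inj₁ w)) → inj₁ w ; (inj₁ (inj₂ e)) → inj₂ (here e) ; (inj₂ m) → inj₂ (there m) }

    j₀ : Fin (arity g)
    j₀ = proj₁ (dom-pt {g} {x} d)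

    x≈j₀ : x ≈ pt g j₀
    x≈j₀ = proj₂ (dom-pt {g} {x} d)

    value : ∀ {a} → Agrees W′ (f [ x ≔ a ]) g → a ≡ lab g j₀
    value ag = trans (sym (≔-hit x≈j₀)) (ag j₀ (inj₂ x≈j₀))

    agrees : ∀ {a} → Agrees W′ (f [ x ≔ a ]) g → Agrees W f g
    agrees ag j w = trans (sym (≔-miss λ e → ¬w (W-resp (S.sym e) w))) (ag j (inj₁ w))

  module _ {W : Subset X} (W-resp : ∀ {x y} → x ≈ y → W x → W y) where

    agrees-≈ : ∀ {h g g′} → (∀ {x y} → x ≈ y → h x ≡ h y) → g F.≈ g′ → Agrees W h g → Agrees W h g′
    agrees-≈ h-resp (same (_ , from)) ag j w = let (i , e , l) = from j in
      trans (h-resp (S.sym e)) (trans (ag i (W-resp (S.sym e) w)) l)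

    -- `width` inspects the first element only, and equal constraints may list their elements in
    -- different orders; the common domain carries each point from one first element to the other.
    width-≈ : ∀ {B B′} → BorelSpace._≈_ Const B B′ → width W B ≤ width W B′
    width-≈ {(zero  , _) , _} {(zero , _) , _} (same _) = z≤n
    width-≈ {B@((suc _ , t , _) , _)} {B′@((suc _ , t′ , _) , _)} (same (f , _)) =
      sum-injection _ _ τ
        (λ {i} {j} e → pt-injective (t zero)
          (S.trans (τ-≈ i) (S.trans (S.reflexive (cong (pt (t′ zero)) e)) (S.sym (τ-≈ j)))))
        λ i → ⟦⟧-mono (W-resp (τ-≈ i))
      where
      found : ∀ i → ∃[ j ] pt (t zero) i ≈ pt (t′ zero) j
      found i = let (k , e) = f zero in
        dom-pt {t′ zero} {pt (t zero) i} (dom⇒all {B′} {pt (t zero) i}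
          (element⇒dom {B′} {pt (t zero) i} {k} (dom-resp {t zero} {t′ k} e (pt-dom {t zero} (i , S.refl)))) zero)
      τ : Fin (arity (t zero)) → Fin (arity (t′ zero))
      τ = proj₁ ∘ found
      τ-≈ : ∀ i → pt (t zero) i ≈ pt (t′ zero) (τ i)
      τ-≈ = proj₂ ∘ found

    -- The elements of a constraint are pairwise distinct, so matching each with an equal element of
    -- `B′` is injective.
    count-≈ : ∀ {h B B′} → (∀ {x y} → x ≈ y → h x ≡ h y) → BorelSpace._≈_ Const B B′ → count W h B ≤ count W h B′
    count-≈ {h} {B@((_ , t , distinct) , _)} {B′@((_ , t′ , _) , _)} h-resp (same (f , _)) =
      sum-injection _ _ (proj₁ ∘ f)
        (λ {i} {j} e → distinct i j (F.trans {t i} {t′ (proj₁ (f i))} {t j} (proj₂ (f i))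
           (F.sym {t j} {t′ (proj₁ (f i))} (subst (λ k → t j F.≈ t′ k) (sym e) (proj₂ (f j))))))
        λ i → ⟦⟧-mono (agrees-≈ {h} {t i} {t′ (proj₁ (f i))} h-resp (proj₂ (f i)))

  const-dom-≈ : ∀ {B B′} → BorelSpace._≈_ Const B B′ → dom B ⊆ dom B′
  const-dom-≈ {B@((_ , t , _) , _)} {B′@((_ , t′ , _) , _)} (same (f , _)) {x} d =
    let (i , e) = dom⇒element {B} {x} d in
    element⇒dom {B′} {x} {proj₁ (f i)} (dom-resp {t i} {t′ (proj₁ (f i))} (proj₂ (f i)) e)

  count-local : ∀ {W h h′ B} → (∀ {x} → W x → dom B x → h x ≡ h′ x) → count W h B ≤ count W h′ B
  count-local {W} {h} {h′} {B} e = sum-mono λ i → ⟦⟧-mono λ ag j w →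
    trans (sym (e w (element⇒dom {B} {pt (element B i) j} {i} (pt-dom {element B i} (j , S.refl))))) (ag j w)

-- The local lemma on a single component.

module Components (em : ∀ {ℓ} → ExcludedMiddle ℓ) (X : BorelSpace) (q : ℕ) .{{_ : ℕ.NonZero q}} where
  open import Relation.Binary.Construct.Closure.ReflexiveTransitive using (ε; _◅_; _◅◅_)
  open import Data.Nat.Base using (_*_; _^_; _≤_; NonZero)
  open import Data.Nat.Properties
  open Indicator em
  open Counting em
  open Constraints X q
  open Points em X q
  open Adjacency X q
  open CSP X q
  open Integration em (setoid X) q
  open LocalLemma em (setoid X) q
  open BorelSpace X using (_≈_)
  private
    module S = Setoid (setoid X)
    module C = Setoid (setoid Const)

  module _ {𝓑 : Subset Const} (𝓑-resp : ∀ {B B′} → B C.≈ B′ → 𝓑 B → 𝓑 B′) {d} (deg : DegreeBound 𝓑 d) where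

    -- Any two different constraints through `x` are neighbours, so one of them and its boundedly
    -- many neighbours are all there are.
    through : ∀ x → ∃[ Bs ] (∀ {B} → 𝓑 B → dom B x → Any (B C.≈_) Bs)
    through x = case em {P = ∃[ B ] 𝓑 B × dom B x} of λ
      { (no ¬B)            → [] , λ {B} b e → contradiction (B , b , e) ¬B
      ; (yes (B , b , e)) → let (Bs , _ , covers) = deg {B} b in
          B ∷ Bs , λ {B′} b′ e′ → case em {P = B′ C.≈ B} of λ
            { (yes e) → here e ; (no B′≉B) → there (covers {B′} (b′ , B′≉B , x , e′ , e)) } }

    through-list : ∀ xs → ∃[ Bs ] (∀ {B} → 𝓑 B → Any (dom B) xs → Any (B C.≈_) Bs)
    through-list []       = [] , λ _ ()
    through-list (x ∷ xs) = let (Bs , h) = through x ; (Bs′ , h′) = through-list xs in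
      Bs ++ Bs′ , λ { {B} b (here e) → Any.++⁺ˡ (h {B} b e) ; {B} b (there m) → Any.++⁺ʳ Bs (h′ {B} b m) }

    module _ {V : Subset X} (V-resp : ∀ {x y} → x ≈ y → V x → V y)
      (bad : (Point X → Fin q) → Subset Const)
      (bad-local : ∀ {h h′ B} → (∀ {x} → dom B x → h x ≡ h′ x) → bad h B → bad h′ B)
      (bad-≈ : ∀ {h B B′} → (∀ {x y} → x ≈ y → h x ≡ h y) → B C.≈ B′ → bad h B → bad h B′)
      (δ : ℕ) .{{_ : NonZero δ}}
      {f : Point X → Fin q} (f-resp : ∀ {x y} → x ≈ y → f x ≡ f y)
      (rare : ∀ {B} → 𝓑 B → suc δ ^ suc d * I (domPoints V B) (λ h → ⟦ bad h B ⟧) f ≤ δ ^ d * q ^ length (domPoints V B))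
      where

      component-solution : ∀ {x} → BorelSpace.IsFinite X (Connected 𝓑 V x) →
        ∃[ h ] (∀ {y z} → y ≈ z → h y ≡ h z) × (∀ {y} → ¬ V y → h y ≡ f y) ×
               (∀ {B y} → 𝓑 B → dom B y → V y → Connected 𝓑 V x y → ¬ bad h B)
      component-solution {x} (xs , covers) =
        let (events , unique , complete) = enumerate (setoid Const) {Meets} (λ {B} {B′} → meets-resp {B} {B′})
                                             (proj₁ (through-list vars)) (λ {B} → meets-covered {B})
            (h , avoids , h-resp , h-off) = lovász-local-lemma _≉_ (λ {i} {j} n e → n (C.sym {proj₁ j} {proj₁ i} e))
                Occurs Dom (λ i → dom-≈ {proj₁ i}) (λ i {g} {h} → bad-local {g} {h} {proj₁ i})
                d δ degree vars f rare-event f-resp events unique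
        in h , h-resp ,
           (λ ¬v → h-off λ m → ¬v (let (z , z∈ , z≈y) = findₗ m in
             V-resp z≈y (proj₂ (∈-filter⁻ V? {xs = xs} z∈)))) ,
           λ {B} {y} b e v c bad-B → let (i , i∈ , B≈) = findₗ (complete (B , b , y , e , v , c)) in
             All.lookup avoids i∈ (bad-≈ {h} {B} {proj₁ i} h-resp B≈ bad-B)
        where
        V? : ∀ y → Dec (V y)
        V? y = em

        -- The covering list may repeat points and contain points off the component. The former only
        -- rescale the integral, and the latter may change freely as long as they lie in `V`.
        vars : List (Point X)
        vars = filter V? xs

        vars-cover : ∀ {y} → V y → Connected 𝓑 V x y → Any (y ≈_) vars
        vars-cover {y} v c = let (z , z∈ , y≈z) = findₗ (covers c) in loseₗ (∈-filter⁺ V? z∈ (V-resp y≈z v)) y≈z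

        Meets : Subset Const
        Meets B = 𝓑 B × ∃[ y ] dom B y × V y × Connected 𝓑 V x y

        meets-resp : ∀ {B B′} → B C.≈ B′ → Meets B → Meets B′
        meets-resp {B} {B′} e (b , y , e′ , v , c) = 𝓑-resp {B} {B′} e b , y , const-dom-≈ {B} {B′} e e′ , v , c

        meets-covered : ∀ {B} → Meets B → Any (B C.≈_) (proj₁ (through-list vars))
        meets-covered {B} (b , y , e , v , c) =
          proj₂ (through-list vars) {B} b (Any.map (λ {z} y≈z → dom-≈ {B} {y} {z} y≈z e) (vars-cover v c))

        Event : Set
        Event = ∃ Meets

        _≉_ : Event → Event → Set
        i ≉ j = ¬ proj₁ i C.≈ proj₁ j

        Occurs : Event → Assignment → Set
        Occurs i h = bad h (proj₁ i)

        Dom : Event → Point X → Set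
        Dom i = dom (proj₁ i)

        degree : ∀ i Γ → AllPairs _≉_ (i ∷ Γ) → All (λ j → ∃[ y ] Dom i y × Dom j y) Γ → length Γ ≤ d
        degree i@(B , b , _) Γ (i≉ ∷ pairs) near = let (Bs , len , covers) = deg {B} b in
          ≤-trans (subst (_≤ length Bs) (length-map proj₁ Γ)
            (pigeonhole (setoid Const) (AllPairs.map⁺ pairs)
              (All.map⁺ (All.zipWith (λ { {B′ , b′ , _} (i≉j , y , e , e′) →
                covers {B′} (b′ , (λ eq → i≉j (C.sym {B′} {B} eq)) , y , e′ , e) }) (i≉ , near))))) len

        -- The hypothesis resamples the points of `V` in the domain of `B`, the local lemma all of
        -- `vars`. As `B` meets the component, its points in `V` all occur in `vars`, and the
        -- remaining variables do not influence it; `I-transfer` compares the two.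
        rare-event : ∀ i → suc δ ^ suc d * I vars (λ h → ⟦ Occurs i h ⟧) f ≤ δ ^ d * q ^ length vars
        rare-event (B , b , y , e , v , c) = *-cancelˡ-≤ (q ^ length D) {{m^n≢0 q (length D)}} (begin
          q ^ length D * (M * I vars φ f)
            ≡⟨ solve 3 (λ a b c → a :* (b :* c) := b :* (a :* c)) refl (q ^ length D) M (I vars φ f) ⟩
          M * (q ^ length D * I vars φ f) ≡⟨ cong (M *_) (I-transfer vars D φ-ext vars-ok D-ok f) ⟩
          M * (q ^ length vars * I D φ f)
            ≡⟨ solve 3 (λ a b c → b :* (a :* c) := a :* (b :* c)) refl (q ^ length vars) M (I D φ f) ⟩
          q ^ length vars * (M * I D φ f) ≤⟨ *-monoʳ-≤ (q ^ length vars) (rare {B} b) ⟩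
          q ^ length vars * (K * q ^ length D)
            ≡⟨ solve 3 (λ a b c → a :* (b :* c) := c :* (b :* a)) refl (q ^ length vars) K (q ^ length D) ⟩
          q ^ length D * (K * q ^ length vars) ∎)
          where
          open ≤-Reasoning
          open +-*-Solver using (solve; _:*_; _:=_)
          M = suc δ ^ suc d
          K = δ ^ d
          D = domPoints V B

          φ : Functional
          φ h = ⟦ bad h B ⟧

          φ-ext : Extensional φ
          φ-ext {g} {h} eq = ⟦⟧-cong (bad-local {g} {h} {B} λ {z} _ → eq z) (bad-local {h} {g} {B} λ {z} _ → sym (eq z))

          φ-independent : ∀ {z} → ¬ dom B z → Independent z φ
          φ-independent {z} ¬d g a = ⟦⟧-cong (bad-local {g [ z ≔ a ]} {g} {B} miss)
            (bad-local {g} {g [ z ≔ a ]} {B} (λ {w} → sym ∘ miss {w}))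
            where
            miss : ∀ {w} → dom B w → (g [ z ≔ a ]) w ≡ g w
            miss {w} d′ = ≔-miss λ eq → ¬d (dom-≈ {B} {w} {z} (S.sym eq) d′)

          vars-ok : All (λ z → Any (z ≈_) D ⊎ Independent z φ) vars
          vars-ok = All.map (λ {z} w → case em {P = dom B z} of λ
            { (yes d′) → inj₁ (domPoints-complete V B V-resp w d′) ; (no ¬d) → inj₂ (φ-independent ¬d) }) (All.all-filter V? xs)

          D-ok : All (λ z → Any (z ≈_) vars ⊎ Independent z φ) D
          D-ok = All.map (λ {z} (w , d′) → inj₁ (vars-cover w (c ◅◅ (v , w , B , b , e , d′) ◅ ε))) (domPoints-sound V B)

-- Partial sums of the exponential series.

module PowerSeries where
  open import Data.Nat.Properties using (_!≢0)
  open import Data.Rational.Base using (_+_; _*_; _≤_; _<_)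
  open Rationals
  open ℚ-Solver

  *-monoʳ : ∀ {x a b} → 0ℚ ≤ x → a ≤ b → x * a ≤ x * b
  *-monoʳ {x} h = ℚ.*-monoˡ-≤-nonNeg x {{ℚ.nonNegative h}}

  *-monoˡ : ∀ {x a b} → 0ℚ ≤ x → a ≤ b → a * x ≤ b * x
  *-monoˡ {x} h = ℚ.*-monoʳ-≤-nonNeg x {{ℚ.nonNegative h}}

  *-nonNeg : ∀ {a b} → 0ℚ ≤ a → 0ℚ ≤ b → 0ℚ ≤ a * b
  *-nonNeg {a} {b} ha hb = subst (_≤ a * b) (ℚ.*-zeroʳ a) (*-monoʳ ha hb)

  +-nonNeg : ∀ {a b} → 0ℚ ≤ a → 0ℚ ≤ b → 0ℚ ≤ a + b
  +-nonNeg ha hb = ℚ.+-mono-≤ ha hb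

  ι-suc : ∀ n → ι (suc n) ≡ 1ℚ + ι n
  ι-suc n = trans (ι-+ 1 n) (cong (_+ ι n) ι-1)

  ι-cancel-* : ∀ n {a b} → ι (suc n) * a ≡ ι (suc n) * b → a ≡ b
  ι-cancel-* n e = ℚ.≤-antisym (ℚ.*-cancelˡ-≤-pos (ι (suc n)) {{ι-pos (suc n)}} (ℚ.≤-reflexive e))
                               (ℚ.*-cancelˡ-≤-pos (ι (suc n)) {{ι-pos (suc n)}} (ℚ.≤-reflexive (sym e)))

  opaque
    inv : ℕ → ℚ
    inv n = ℤ.+ 1 ℚ./ suc n

    inv-nonNeg : ∀ n → 0ℚ ≤ inv n
    inv-nonNeg n = ℚ.toℚᵘ-cancel-≤ (ℚᵘ.≤-trans (ℚᵘ.*≤* (ℤ.+≤+ ℕ.z≤n))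
      (ℚᵘ.≤-reflexive (ℚᵘ.≃-sym (ℚ.toℚᵘ-fromℚᵘ (mkℚᵘ (ℤ.+ 1) n)))))

    ι-inv : ∀ n → ι (suc n) * inv n ≡ 1ℚ
    ι-inv n = ℚ.toℚᵘ-injective (begin
      toℚᵘ (ι (suc n) * inv n) ≈⟨ ℚ.toℚᵘ-homo-* (ι (suc n)) (inv n) ⟩
      toℚᵘ (ι (suc n)) ℚᵘ.* toℚᵘ (inv n) ≈⟨ ℚᵘ.*-cong (toℚᵘ-ι (suc n)) (ℚ.toℚᵘ-fromℚᵘ (mkℚᵘ (ℤ.+ 1) n)) ⟩
      mkℚᵘ (ℤ.+ suc n) 0 ℚᵘ.* mkℚᵘ (ℤ.+ 1) n
        ≈⟨ ℚᵘ.*≡* (trans (ℤ.*-identityʳ _) (trans (ℤ.*-identityʳ (ℤ.+ suc n)) (sym (trans (ℤ.*-identityˡ _) (cong ℤ.+_ (ℕ.*-identityˡ (suc n))))))) ⟩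
      ℚᵘ.1ℚᵘ ∎)
      where open ℚᵘ.≃-Reasoning

  -- The coefficients of the Cauchy product of two power series.
  conv : (ℕ → ℚ) → (ℕ → ℚ) → ℕ → ℚ
  conv x y zero    = x 0 * y 0
  conv x y (suc k) = x 0 * y (suc k) + conv (x ∘ suc) y k

  cum : (ℕ → ℚ) → ℕ → ℚ
  cum x zero    = x 0
  cum x (suc n) = x 0 + cum (x ∘ suc) n

  cum-last : ∀ x n → cum x (suc n) ≡ cum x n + x (suc n)
  cum-last x zero    = refl
  cum-last x (suc n) = trans (cong (x 0 +_) (cum-last (x ∘ suc) n)) (sym (ℚ.+-assoc (x 0) _ _))

  deriv : (ℕ → ℚ) → ℕ → ℚ
  deriv x i = ι (suc i) * x (suc i)

  conv-cong : ∀ {x x′ y y′} → (∀ i → x i ≡ x′ i) → (∀ i → y i ≡ y′ i) → ∀ k → conv x y k ≡ conv x′ y′ k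
  conv-cong e f zero    = cong₂ _*_ (e 0) (f 0)
  conv-cong e f (suc k) = cong₂ _+_ (cong₂ _*_ (e 0) (f (suc k))) (conv-cong (e ∘ suc) f k)

  conv-+ˡ : ∀ x x′ y k → conv (λ i → x i + x′ i) y k ≡ conv x y k + conv x′ y k
  conv-+ˡ x x′ y zero    = ℚ.*-distribʳ-+ (y 0) (x 0) (x′ 0)
  conv-+ˡ x x′ y (suc k) = trans (cong ((x 0 + x′ 0) * y (suc k) +_) (conv-+ˡ (x ∘ suc) (x′ ∘ suc) y k))
    (solve 5 (λ a b c d e → (a :+ b) :* c :+ (d :+ e) := (a :* c :+ d) :+ (b :* c :+ e)) refl (x 0) (x′ 0) (y (suc k)) _ _)

  conv-*ˡ : ∀ c x y k → conv (λ i → c * x i) y k ≡ c * conv x y k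
  conv-*ˡ c x y zero    = ℚ.*-assoc c (x 0) (y 0)
  conv-*ˡ c x y (suc k) = trans (cong (c * x 0 * y (suc k) +_) (conv-*ˡ c (x ∘ suc) y k))
    (solve 4 (λ c a b d → c :* a :* b :+ c :* d := c :* (a :* b :+ d)) refl c (x 0) (y (suc k)) _)

  conv-*ʳ : ∀ c x y k → conv x (λ i → c * y i) k ≡ c * conv x y k
  conv-*ʳ c x y zero    = solve 3 (λ c a b → a :* (c :* b) := c :* (a :* b)) refl c (x 0) (y 0)
  conv-*ʳ c x y (suc k) = trans (cong (x 0 * (c * y (suc k)) +_) (conv-*ʳ c (x ∘ suc) y k))
    (solve 4 (λ c a b d → a :* (c :* b) :+ c :* d := c :* (a :* b :+ d)) refl c (x 0) (y (suc k)) _)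

  -- The product rule for formal derivatives, read off at the coefficient of degree `k`.
  leibniz : ∀ x y k → ι (suc k) * conv x y (suc k) ≡ conv (deriv x) y k + conv x (deriv y) k
  leibniz x y zero = begin
    ι 1 * (x 0 * y 1 + x 1 * y 0)
      ≡⟨ solve 5 (λ i a b c d → i :* (a :* b :+ c :* d) := i :* c :* d :+ a :* (i :* b)) refl (ι 1) (x 0) (y 1) (x 1) (y 0) ⟩
    ι 1 * x 1 * y 0 + x 0 * (ι 1 * y 1) ∎
    where open ≡-Reasoning
  leibniz x y (suc k) = begin
    ι (2 ℕ.+ k) * (x 0 * y (2 ℕ.+ k) + c)
      ≡⟨ cong (_* (x 0 * y (2 ℕ.+ k) + c)) (ι-suc (suc k)) ⟩
    (1ℚ + ι (suc k)) * (x 0 * y (2 ℕ.+ k) + c)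
      ≡⟨ solve 4 (λ i a b c → (con 1ℚ :+ i) :* (a :* b :+ c) := a :* ((con 1ℚ :+ i) :* b) :+ (c :+ i :* c)) refl (ι (suc k)) (x 0) (y (2 ℕ.+ k)) c ⟩
    x 0 * ((1ℚ + ι (suc k)) * y (2 ℕ.+ k)) + (c + ι (suc k) * c)
      ≡⟨ cong₂ (λ i s → x 0 * (i * y (2 ℕ.+ k)) + (c + s)) (sym (ι-suc (suc k))) (leibniz (x ∘ suc) y k) ⟩
    x 0 * deriv y (suc k) + (x 1 * y (suc k) + conv (x ∘ ℕ.suc ∘ ℕ.suc) y k + (conv (deriv (x ∘ suc)) y k + conv (x ∘ suc) (deriv y) k))
      ≡⟨ solve 6 (λ a b p s r t → a :+ (b :* p :+ s :+ (r :+ t)) := (con 1ℚ :* b :* p :+ (s :+ r)) :+ (a :+ t)) refl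
           (x 0 * deriv y (suc k)) (x 1) (y (suc k)) (conv (x ∘ ℕ.suc ∘ ℕ.suc) y k) (conv (deriv (x ∘ suc)) y k) (conv (x ∘ suc) (deriv y) k) ⟩
    (1ℚ * x 1 * y (suc k) + (conv (x ∘ ℕ.suc ∘ ℕ.suc) y k + conv (deriv (x ∘ suc)) y k)) + (x 0 * deriv y (suc k) + conv (x ∘ suc) (deriv y) k)
      ≡⟨ cong (_+ (x 0 * deriv y (suc k) + conv (x ∘ suc) (deriv y) k))
           (cong₂ (λ i s → i * x 1 * y (suc k) + s) (sym ι-1)
             (trans (sym (conv-+ˡ (x ∘ ℕ.suc ∘ ℕ.suc) (deriv (x ∘ suc)) y k)) (conv-cong shifted (λ _ → refl) k))) ⟩
    conv (deriv x) y (suc k) + conv x (deriv y) (suc k) ∎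
    where
    open ≡-Reasoning
    c = conv (x ∘ suc) y (suc k)
    shifted : ∀ i → x (2 ℕ.+ i) + deriv (x ∘ suc) i ≡ deriv x (suc i)
    shifted i = trans (solve 2 (λ a j → a :+ j :* a := (con 1ℚ :+ j) :* a) refl (x (2 ℕ.+ i)) (ι (suc i)))
                      (cong (_* x (2 ℕ.+ i)) (sym (ι-suc (suc i))))

  -- The coefficient zⁿ/n!.
  t : ℚ → ℕ → ℚ
  t z zero    = 1ℚ
  t z (suc n) = z * t z n * inv n

  t-deriv : ∀ z n → deriv (t z) n ≡ z * t z n
  t-deriv z n = begin
    ι (suc n) * (z * t z n * inv n)
      ≡⟨ solve 3 (λ i a v → i :* (a :* v) := a :* (i :* v)) refl (ι (suc n)) (z * t z n) (inv n) ⟩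
    z * t z n * (ι (suc n) * inv n) ≡⟨ cong (z * t z n *_) (ι-inv n) ⟩
    z * t z n * 1ℚ ≡⟨ ℚ.*-identityʳ _ ⟩
    z * t z n ∎
    where open ≡-Reasoning

  t-nonNeg : ∀ {z} → 0ℚ ≤ z → ∀ n → 0ℚ ≤ t z n
  t-nonNeg hz zero    = ℚ.*≤* (ℤ.+≤+ ℕ.z≤n)
  t-nonNeg hz (suc n) = *-nonNeg (*-nonNeg hz (t-nonNeg hz n)) (inv-nonNeg n)

  -- The binomial theorem without binomial coefficients: both sides start at 1 and satisfy the
  -- differential equation y′ = (z + w) y, which determines each coefficient from the previous one.
  t-conv : ∀ z w k → conv (t z) (t w) k ≡ t (z + w) k
  t-conv z w zero    = refl
  t-conv z w (suc k) = ι-cancel-* k (begin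
    ι (suc k) * conv (t z) (t w) (suc k) ≡⟨ leibniz (t z) (t w) k ⟩
    conv (deriv (t z)) (t w) k + conv (t z) (deriv (t w)) k ≡⟨ cong₂ _+_
      (trans (conv-cong (t-deriv z) (λ _ → refl) k) (conv-*ˡ z (t z) (t w) k))
      (trans (conv-cong (λ _ → refl) (t-deriv w) k) (conv-*ʳ w (t z) (t w) k)) ⟩
    z * conv (t z) (t w) k + w * conv (t z) (t w) k ≡⟨ ℚ.*-distribʳ-+ _ z w ⟨
    (z + w) * conv (t z) (t w) k ≡⟨ cong ((z + w) *_) (t-conv z w k) ⟩
    (z + w) * t (z + w) k ≡⟨ t-deriv (z + w) k ⟨
    ι (suc k) * t (z + w) (suc k) ∎)
    where open ≡-Reasoning

  conv-cum-suc : ∀ x y k → conv x (cum y) (suc k) ≡ conv x (cum y) k + conv x y (suc k)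
  conv-cum-suc x y zero    = solve 4 (λ a b c d → a :* (b :+ c) :+ d :* b := a :* b :+ (a :* c :+ d :* b)) refl (x 0) (y 0) (y 1) (x 1)
  conv-cum-suc x y (suc k) = begin
    x 0 * cum y (2 ℕ.+ k) + conv (x ∘ suc) (cum y) (suc k)
      ≡⟨ cong₂ (λ a b → x 0 * a + b) (cum-last y (suc k)) (conv-cum-suc (x ∘ suc) y k) ⟩
    x 0 * (cum y (suc k) + y (2 ℕ.+ k)) + (conv (x ∘ suc) (cum y) k + conv (x ∘ suc) y (suc k))
      ≡⟨ solve 5 (λ a b c d e → a :* (b :+ c) :+ (d :+ e) := (a :* b :+ d) :+ (a :* c :+ e)) refl (x 0) (cum y (suc k)) (y (2 ℕ.+ k)) _ _ ⟩
    conv x (cum y) (suc k) + conv x y (2 ℕ.+ k) ∎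
    where open ≡-Reasoning

  -- Taking partial sums is multiplication by the series 1/(1-X), which may be applied to one factor
  -- or to the product.
  conv-cum : ∀ x y n → conv x (cum y) n ≡ cum (conv x y) n
  conv-cum x y zero    = refl
  conv-cum x y (suc n) = trans (conv-cum-suc x y n) (trans (cong (_+ conv x y (suc n)) (conv-cum x y n)) (sym (cum-last (conv x y) n)))

  cum-cong : ∀ {x y} → (∀ i → x i ≡ y i) → ∀ n → cum x n ≡ cum y n
  cum-cong e zero    = e 0
  cum-cong e (suc n) = cong₂ _+_ (e 0) (cum-cong (e ∘ suc) n)

  cum-nonNeg : ∀ {x} → (∀ i → 0ℚ ≤ x i) → ∀ n → 0ℚ ≤ cum x n
  cum-nonNeg h zero    = h 0
  cum-nonNeg h (suc n) = +-nonNeg (h 0) (cum-nonNeg (h ∘ suc) n)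

  cum-mono : ∀ {x} → (∀ i → 0ℚ ≤ x i) → ∀ k n → cum x n ≤ cum x (k ℕ.+ n)
  cum-mono     h zero    n = ℚ.≤-refl
  cum-mono {x} h (suc k) n = ℚ.≤-trans (cum-mono h k n) (begin
    cum x (k ℕ.+ n) ≡⟨ ℚ.+-identityʳ _ ⟨
    cum x (k ℕ.+ n) + 0ℚ ≤⟨ ℚ.+-monoʳ-≤ (cum x (k ℕ.+ n)) (h (suc (k ℕ.+ n))) ⟩
    cum x (k ℕ.+ n) + x (suc (k ℕ.+ n)) ≡⟨ cum-last x (k ℕ.+ n) ⟨
    cum x (suc k ℕ.+ n) ∎)
    where open ℚ.≤-Reasoning

  conv-nonNeg : ∀ {x y} → (∀ i → 0ℚ ≤ x i) → (∀ i → 0ℚ ≤ y i) → ∀ n → 0ℚ ≤ conv x y n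
  conv-nonNeg hx hy zero    = *-nonNeg (hx 0) (hy 0)
  conv-nonNeg hx hy (suc n) = +-nonNeg (*-nonNeg (hx 0) (hy (suc n))) (conv-nonNeg (hx ∘ suc) hy n)

  -- The right side collects all terms x_i y_j of the triangle i + j ≤ n + m, which contains the
  -- rectangle i ≤ n, j ≤ m.
  cum*≤conv : ∀ {x y} → (∀ i → 0ℚ ≤ x i) → (∀ i → 0ℚ ≤ y i) → ∀ n m → cum x n * cum y m ≤ conv x (cum y) (n ℕ.+ m)
  cum*≤conv {x} {y} hx hy zero zero    = ℚ.≤-refl
  cum*≤conv {x} {y} hx hy zero (suc m) = begin
    x 0 * cum y (suc m) ≡⟨ ℚ.+-identityʳ _ ⟨
    x 0 * cum y (suc m) + 0ℚ ≤⟨ ℚ.+-monoʳ-≤ (x 0 * cum y (suc m)) (conv-nonNeg (hx ∘ suc) (cum-nonNeg hy) m) ⟩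
    x 0 * cum y (suc m) + conv (x ∘ suc) (cum y) m ∎
    where open ℚ.≤-Reasoning
  cum*≤conv {x} {y} hx hy (suc n) m = begin
    (x 0 + cum (x ∘ suc) n) * cum y m ≡⟨ ℚ.*-distribʳ-+ (cum y m) (x 0) _ ⟩
    x 0 * cum y m + cum (x ∘ suc) n * cum y m
      ≤⟨ ℚ.+-mono-≤ (*-monoʳ (hx 0) (cum-mono hy (suc n) m)) (cum*≤conv (hx ∘ suc) hy n m) ⟩
    x 0 * cum y (suc n ℕ.+ m) + conv (x ∘ suc) (cum y) (n ℕ.+ m) ∎
    where open ℚ.≤-Reasoning

  -- The estimate Σ (x′_i - x_i) Y_(n-i) ≤ M Σ (x′_i - x_i) with the negative terms moved across.
  conv-exchange : ∀ {x x′ Y M} → (∀ i → x i ≤ x′ i) → ∀ n → (∀ j → j ℕ.≤ n → Y j ≤ M) →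
                  conv x′ Y n + cum x n * M ≤ conv x Y n + cum x′ n * M
  conv-exchange {x} {x′} {Y} {M} h n hM = go h n hM
    where
    open ℚ.≤-Reasoning
    two : ∀ {a a′ b} → a ≤ a′ → b ≤ M → a′ * b + a * M ≤ a * b + a′ * M
    two {a} {a′} {b} a≤a′ b≤M = begin
      a′ * b + a * M
        ≡⟨ solve 4 (λ a a′ b M → a′ :* b :+ a :* M := (a :* b :+ a :* M) :+ (a′ :- a) :* b) refl a a′ b M ⟩
      (a * b + a * M) + (a′ ℚ.- a) * b
        ≤⟨ ℚ.+-monoʳ-≤ (a * b + a * M) (*-monoʳ (subst (_≤ a′ ℚ.- a) (ℚ.+-inverseʳ a) (ℚ.+-monoˡ-≤ (ℚ.- a) a≤a′)) b≤M) ⟩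
      (a * b + a * M) + (a′ ℚ.- a) * M
        ≡⟨ solve 4 (λ a a′ b M → (a :* b :+ a :* M) :+ (a′ :- a) :* M := a :* b :+ a′ :* M) refl a a′ b M ⟩
      a * b + a′ * M ∎

    go : ∀ {x x′} → (∀ i → x i ≤ x′ i) → ∀ n → (∀ j → j ℕ.≤ n → Y j ≤ M) →
         conv x′ Y n + cum x n * M ≤ conv x Y n + cum x′ n * M
    go h zero    hM = two (h 0) (hM 0 ℕ.z≤n)
    go {x} {x′} h (suc n) hM = begin
      (x′ 0 * Y (suc n) + conv (x′ ∘ suc) Y n) + (x 0 + cum (x ∘ suc) n) * M
        ≡⟨ regroup (x′ 0 * Y (suc n)) (conv (x′ ∘ suc) Y n) (x 0) (cum (x ∘ suc) n) ⟩
      (x′ 0 * Y (suc n) + x 0 * M) + (conv (x′ ∘ suc) Y n + cum (x ∘ suc) n * M)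
        ≤⟨ ℚ.+-mono-≤ (two (h 0) (hM (suc n) ℕ.≤-refl)) (go (h ∘ suc) n λ j j≤n → hM j (ℕ.m≤n⇒m≤1+n j≤n)) ⟩
      (x 0 * Y (suc n) + x′ 0 * M) + (conv (x ∘ suc) Y n + cum (x′ ∘ suc) n * M)
        ≡⟨ regroup (x 0 * Y (suc n)) (conv (x ∘ suc) Y n) (x′ 0) (cum (x′ ∘ suc) n) ⟨
      (x 0 * Y (suc n) + conv (x ∘ suc) Y n) + (x′ 0 + cum (x′ ∘ suc) n) * M ∎
      where
      regroup : ∀ a b c e → (a + b) + (c + e) * M ≡ (a + c * M) + (b + e * M)
      regroup a b c e = solve 5 (λ a b c e M → (a :+ b) :+ (c :+ e) :* M := (a :+ c :* M) :+ (b :+ e :* M)) refl a b c e M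

  E : ℚ → ℕ → ℚ
  E z = cum (t z)

  conv-E : ∀ z w n → conv (t z) (E w) n ≡ E (z + w) n
  conv-E z w n = trans (conv-cum (t z) (t w) n) (cum-cong (t-conv z w) n)

  E-* : ∀ {z w} → 0ℚ ≤ z → 0ℚ ≤ w → ∀ n m → E z n * E w m ≤ E (z + w) (n ℕ.+ m)
  E-* {z} {w} hz hw n m = ℚ.≤-trans (cum*≤conv (t-nonNeg hz) (t-nonNeg hw) n m) (ℚ.≤-reflexive (conv-E z w (n ℕ.+ m)))

  E-0 : ∀ n → E 0ℚ n ≡ 1ℚ
  E-0 zero    = refl
  E-0 (suc n) = trans (cum-last (t 0ℚ) n) (trans (cong₂ _+_ (E-0 n)
    (trans (cong (_* inv n) (ℚ.*-zeroˡ (t 0ℚ n))) (ℚ.*-zeroˡ (inv n)))) (ℚ.+-identityʳ 1ℚ))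

  t-neg≤ : ∀ {z} → 0ℚ ≤ z → ∀ n → t (ℚ.- z) n ≤ t z n × ℚ.- t (ℚ.- z) n ≤ t z n
  t-neg≤ hz zero = ℚ.≤-refl , ℚ.*≤* ℤ.-≤+
  t-neg≤ {z} hz (suc n) with t-neg≤ hz n
  ... | upper , lower =
      ℚ.≤-trans (ℚ.≤-reflexive (solve 3 (λ z a v → :- z :* a :* v := z :* (:- a) :* v) refl z (t (ℚ.- z) n) (inv n))) (step lower)
    , ℚ.≤-trans (ℚ.≤-reflexive (solve 3 (λ z a v → :- (:- z :* a :* v) := z :* a :* v) refl z (t (ℚ.- z) n) (inv n))) (step upper)
    where
    step : ∀ {a} → a ≤ t z n → z * a * inv n ≤ z * t z n * inv n
    step h = *-monoˡ (inv-nonNeg n) (*-monoʳ hz h)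

  -- e^{-z} e^z = 1 for the partial sums, up to a tail of e^{2z}.
  E-neg-* : ∀ {z} → 0ℚ ≤ z → ∀ n → E (z + z) n + E (ℚ.- z) n * E z n ≤ 1ℚ + E (z + z) (n ℕ.+ n)
  E-neg-* {z} hz n = begin
    E (z + z) n + E (ℚ.- z) n * E z n ≡⟨ cong (_+ E (ℚ.- z) n * E z n) (conv-E z z n) ⟨
    conv (t z) (E z) n + E (ℚ.- z) n * E z n ≤⟨ conv-exchange (λ i → proj₁ (t-neg≤ hz i)) n
        (λ j j≤n → subst (λ k → E z j ≤ E z k) (ℕ.m∸n+n≡m j≤n) (cum-mono (t-nonNeg hz) (n ℕ.∸ j) j)) ⟩
    conv (t (ℚ.- z)) (E z) n + E z n * E z n
      ≡⟨ cong (_+ E z n * E z n) (trans (conv-E (ℚ.- z) z n) (trans (cong (λ w → E w n) (ℚ.+-inverseˡ z)) (E-0 n))) ⟩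
    1ℚ + E z n * E z n ≤⟨ ℚ.+-monoʳ-≤ 1ℚ (E-* hz hz n n) ⟩
    1ℚ + E (z + z) (n ℕ.+ n) ∎
    where open ℚ.≤-Reasoning

  module Tail {w} (hw : 0ℚ ≤ w) (J : ℕ) (hJ : w + w ≤ ι (suc J)) where
    open ℚ.≤-Reasoning

    t-halves : ∀ k → t w (suc (k ℕ.+ J)) + t w (suc (k ℕ.+ J)) ≤ t w (k ℕ.+ J)
    t-halves k = begin
      w * t w j * inv j + w * t w j * inv j
        ≡⟨ solve 3 (λ w a v → w :* a :* v :+ w :* a :* v := a :* ((w :+ w) :* v)) refl w (t w j) (inv j) ⟩
      t w j * ((w + w) * inv j)
        ≤⟨ *-monoʳ (t-nonNeg hw j) (*-monoˡ (inv-nonNeg j) (ℚ.≤-trans hJ (ι-mono (ℕ.s≤s (ℕ.m≤n+m J k))))) ⟩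
      t w j * (ι (suc j) * inv j) ≡⟨ trans (cong (t w j *_) (ι-inv j)) (ℚ.*-identityʳ _) ⟩
      t w j ∎
      where j = k ℕ.+ J

    -- From `J` on each term is at most half its predecessor. Passing to the next index adds twice
    -- the new term to `E w n`, which is at most the term `t w n` given up; so the tail never
    -- exceeds the last term included.
    E-decreasing : ∀ l k → E w (l ℕ.+ (k ℕ.+ J)) + t w (l ℕ.+ (k ℕ.+ J)) ≤ E w (k ℕ.+ J) + t w (k ℕ.+ J)
    E-decreasing zero    k = ℚ.≤-refl
    E-decreasing (suc l) k = begin
      E w (suc n) + t w (suc n) ≡⟨ trans (cong (_+ t w (suc n)) (cum-last (t w) n)) (ℚ.+-assoc (E w n) _ _) ⟩
      E w n + (t w (suc n) + t w (suc n))
        ≤⟨ ℚ.+-monoʳ-≤ (E w n) (subst (λ m → t w (suc m) + t w (suc m) ≤ t w m) (ℕ.+-assoc l k J) (t-halves (l ℕ.+ k))) ⟩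
      E w n + t w n ≤⟨ E-decreasing l k ⟩
      E w (k ℕ.+ J) + t w (k ℕ.+ J) ∎
      where n = l ℕ.+ (k ℕ.+ J)

    E-double : ∀ k → let n = k ℕ.+ J in E w (n ℕ.+ n) ≤ E w n + t w n
    E-double k = begin
      E w (n ℕ.+ n) ≡⟨ ℚ.+-identityʳ _ ⟨
      E w (n ℕ.+ n) + 0ℚ ≤⟨ ℚ.+-monoʳ-≤ (E w (n ℕ.+ n)) (t-nonNeg hw (n ℕ.+ n)) ⟩
      E w (n ℕ.+ n) + t w (n ℕ.+ n) ≤⟨ E-decreasing n k ⟩
      E w n + t w n ∎
      where n = k ℕ.+ J

    t-geometric : ∀ k → t w (k ℕ.+ J) ≤ ½^ k * t w J
    t-geometric zero    = ℚ.≤-reflexive (sym (trans (cong (_* t w J) ½^-zero) (ℚ.*-identityˡ _)))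
    t-geometric (suc k) = begin
      t w (suc (k ℕ.+ J)) ≡⟨ ℚ.*-identityˡ (t w (suc (k ℕ.+ J))) ⟨
      (½ + ½) * t w (suc (k ℕ.+ J)) ≡⟨ solve 2 (λ h a → (h :+ h) :* a := h :* (a :+ a)) refl ½ (t w (suc (k ℕ.+ J))) ⟩
      ½ * (t w (suc (k ℕ.+ J)) + t w (suc (k ℕ.+ J)))
        ≤⟨ *-monoʳ {½} (ℚ.*≤* (ℤ.+≤+ ℕ.z≤n)) (ℚ.≤-trans (t-halves k) (t-geometric k)) ⟩
      ½ * (½^ k * t w J) ≡⟨ ℚ.*-assoc ½ (½^ k) (t w J) ⟨
      ½ * ½^ k * t w J ≡⟨ cong (_* t w J) (½^-suc k) ⟨
      ½^ (suc k) * t w J ∎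

    t-small : ∀ {ε} → 0ℚ < ε → ∃[ k ] (∀ l → t w (l ℕ.+ (k ℕ.+ J)) ≤ ε)
    t-small {ε} ε>0 with ℚ.<-cmp 0ℚ (t w J)
    ... | tri> _ _ h  = contradiction (ℚ.<-≤-trans h (t-nonNeg hw J)) (ℚ.<-irrefl refl)
    ... | tri≈ _ e _  = 0 , λ l → ℚ.≤-trans (t-geometric l)
      (ℚ.≤-trans (ℚ.≤-reflexive (trans (cong (½^ l *_) (sym e)) (ℚ.*-zeroʳ (½^ l)))) (ℚ.<⇒≤ ε>0))
    ... | tri< t>0 _ _ =
      let (k , h) = ½^-small {ε * (ℚ.1/ t w J) {{nz}}} (subst (_< ε * (ℚ.1/ t w J) {{nz}}) (ℚ.*-zeroʳ ε)
                      (ℚ.*-monoʳ-<-pos ε {{ℚ.positive ε>0}} (ℚ.positive⁻¹ ((ℚ.1/ t w J) {{nz}}) {{ℚ.1/pos⇒pos (t w J) {{pos}}}})))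
      in k , λ l → begin
        t w (l ℕ.+ (k ℕ.+ J)) ≡⟨ cong (t w) (ℕ.+-assoc l k J) ⟨
        t w (l ℕ.+ k ℕ.+ J) ≤⟨ t-geometric (l ℕ.+ k) ⟩
        ½^ (l ℕ.+ k) * t w J ≤⟨ *-monoˡ (t-nonNeg hw J) (ℚ.≤-trans (½^-mono l k) (ℚ.<⇒≤ h)) ⟩
        ε * (ℚ.1/ t w J) {{nz}} * t w J
          ≡⟨ trans (ℚ.*-assoc ε _ (t w J)) (trans (cong (ε *_) (ℚ.*-inverseˡ (t w J) {{nz}})) (ℚ.*-identityʳ ε)) ⟩
        ε ∎
      where
      pos : ℚ.Positive (t w J)
      pos = ℚ.positive t>0
      nz : ℚ.NonZero (t w J)
      nz = ℚ.pos⇒nonZero (t w J) {{pos}}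
      ½^-mono : ∀ l k → ½^ (l ℕ.+ k) ≤ ½^ k
      ½^-mono zero    k = ℚ.≤-refl
      ½^-mono (suc l) k = ℚ.≤-trans (ℚ.<⇒≤ (½^-dec (l ℕ.+ k))) (½^-mono l k)

  -- Here `y` bounds e^z from below and `c` is its inverse. Once the partial sums of e^z exceed `y`,
  -- a nonnegative partial sum of e^(-z) times `y` is at most 1 plus a tail of e^(2z), and this tail
  -- eventually drops below y s - 1 > 0.
  E-neg-limsup : ∀ {z} → 0ℚ ≤ z → ∀ J → z + z + (z + z) ≤ ι (suc J) → ∀ {c y m} → 0ℚ < c → 0ℚ < y →
    y * c ≡ 1ℚ → y ≤ E z m →
                 ∀ {s} → c < s → ∃[ N ] (∀ n → N ℕ.≤ n → E (ℚ.- z) n ≤ s)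
  E-neg-limsup {z} hz J hJ {c} {y} {m} c>0 y>0 yc≡1 y≤E {s} c<s = N , bound
    where
    open ℚ.≤-Reasoning
    instance
      y-pos : ℚ.Positive y
      y-pos = ℚ.positive y>0

    ε : ℚ
    ε = y * s ℚ.- 1ℚ

    ε>0 : 0ℚ < ε
    ε>0 = subst (_< ε) (ℚ.+-inverseʳ 1ℚ) (ℚ.+-monoˡ-< (ℚ.- 1ℚ) (subst (_< y * s) yc≡1 (ℚ.*-monoʳ-<-pos y c<s)))

    w = z + z
    hw = +-nonNeg hz hz

    open Tail hw J hJ

    k = proj₁ (t-small ε>0)
    N = (k ℕ.+ J) ℕ.+ m

    bound : ∀ n → N ℕ.≤ n → E (ℚ.- z) n ≤ s
    bound n N≤n with ℚ.≤-total (E (ℚ.- z) n) 0ℚ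
    ... | inj₁ neg = ℚ.≤-trans neg (ℚ.<⇒≤ (ℚ.<-trans c>0 c<s))
    ... | inj₂ E≥0 = ℚ.*-cancelˡ-≤-pos y (begin
      y * E (ℚ.- z) n ≡⟨ ℚ.*-comm y _ ⟩
      E (ℚ.- z) n * y
        ≤⟨ *-monoʳ E≥0 (ℚ.≤-trans y≤E (subst (λ k → E z m ≤ E z k) (ℕ.m∸n+n≡m m≤n) (cum-mono (t-nonNeg hz) (n ℕ.∸ m) m))) ⟩
      E (ℚ.- z) n * E z n ≡⟨ solve 2 (λ a b → b := :- a :+ (a :+ b)) refl (E w n) _ ⟩
      ℚ.- E w n + (E w n + E (ℚ.- z) n * E z n)
        ≤⟨ ℚ.+-monoʳ-≤ (ℚ.- E w n) (ℚ.≤-trans (E-neg-* hz n) (ℚ.+-monoʳ-≤ 1ℚ E-double′)) ⟩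
      ℚ.- E w n + (1ℚ + (E w n + t w n))
        ≡⟨ solve 2 (λ a b → :- a :+ (con 1ℚ :+ (a :+ b)) := con 1ℚ :+ b) refl (E w n) (t w n) ⟩
      1ℚ + t w n ≤⟨ ℚ.+-monoʳ-≤ 1ℚ t≤ε ⟩
      1ℚ + ε ≡⟨ solve 1 (λ a → con 1ℚ :+ (a :- con 1ℚ) := a) refl (y * s) ⟩
      y * s ∎)
      where
      m≤n = ℕ.≤-trans (ℕ.m≤n+m m (k ℕ.+ J)) N≤n
      kJ≤n = ℕ.≤-trans (ℕ.m≤m+n (k ℕ.+ J) m) N≤n
      J≤n = ℕ.≤-trans (ℕ.m≤n+m J k) kJ≤n

      E-double′ : E w (n ℕ.+ n) ≤ E w n + t w n
      E-double′ = subst (λ n → E w (n ℕ.+ n) ≤ E w n + t w n) (ℕ.m∸n+n≡m J≤n) (E-double (n ℕ.∸ J))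

      t≤ε : t w n ≤ ε
      t≤ε = subst (λ n → t w n ≤ ε) (ℕ.m∸n+n≡m kJ≤n) (proj₂ (t-small ε>0) (n ℕ.∸ (k ℕ.+ J)))

  infix 10 _**_
  _**_ : ℚ → ℕ → ℚ
  x ** zero  = 1ℚ
  x ** suc n = x * x ** n

  **-positive : ∀ {x} → 0ℚ < x → ∀ n → 0ℚ < x ** n
  **-positive     h zero    = ℚ.*<* (ℤ.+<+ (ℕ.s≤s ℕ.z≤n))
  **-positive {x} h (suc n) = subst (_< x * x ** n) (ℚ.*-zeroʳ x) (ℚ.*-monoʳ-<-pos x {{ℚ.positive h}} (**-positive h n))

  **-inverse : ∀ {x y} → x * y ≡ 1ℚ → ∀ n → x ** n * y ** n ≡ 1ℚ
  **-inverse         e zero    = refl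
  **-inverse {x} {y} e (suc n) = trans (solve 4 (λ x y a b → (x :* a) :* (y :* b) := (x :* y) :* (a :* b)) refl x y (x ** n) (y ** n))
    (trans (cong₂ _*_ e (**-inverse e n)) (ℚ.*-identityˡ 1ℚ))

  ι-** : ∀ m n → ι (m ℕ.^ n) ≡ ι m ** n
  ι-** m zero    = ι-1
  ι-** m (suc n) = trans (ι-* m (m ℕ.^ n)) (cong (ι m *_) (ι-** m n))

  **-distrib : ∀ x y n → (x * y) ** n ≡ x ** n * y ** n
  **-distrib x y zero    = refl
  **-distrib x y (suc n) = trans (cong (x * y *_) (**-distrib x y n))
    (solve 4 (λ x y a b → (x :* y) :* (a :* b) := (x :* a) :* (y :* b)) refl x y (x ** n) (y ** n))

  -- Bernoulli's 1 + h is the partial sum E h 1.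
  [1+h]^k≤E : ∀ {h} → 0ℚ ≤ h → ∀ k → (1ℚ + h) ** k ≤ E (ι k * h) k
  [1+h]^k≤E hh zero    = ℚ.≤-refl
  [1+h]^k≤E {h} hh (suc k) = begin
    (1ℚ + h) * (1ℚ + h) ** k ≤⟨ *-monoʳ (+-nonNeg {1ℚ} (ℚ.*≤* (ℤ.+≤+ ℕ.z≤n)) hh) ([1+h]^k≤E hh k) ⟩
    (1ℚ + h) * E (ι k * h) k ≡⟨ cong (λ x → (1ℚ + x) * E (ι k * h) k) t₁ ⟨
    E h 1 * E (ι k * h) k ≤⟨ E-* hh (*-nonNeg (ι≥0 k) hh) 1 k ⟩
    E (h + ι k * h) (suc k)
      ≡⟨ cong (λ z → E z (suc k)) (trans (cong (_* h) (ι-suc k)) (trans (ℚ.*-distribʳ-+ h 1ℚ (ι k)) (cong (_+ ι k * h) (ℚ.*-identityˡ h)))) ⟨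
    E (ι (suc k) * h) (suc k) ∎
    where
    open ℚ.≤-Reasoning
    t₁ : t h 1 ≡ h
    t₁ = trans (cong (h * 1ℚ *_) (trans (sym (ℚ.*-identityˡ (inv 0))) (trans (cong (_* inv 0) (sym ι-1)) (ι-inv 0))))
               (trans (ℚ.*-identityʳ _) (ℚ.*-identityʳ h))

  /-spec : ∀ i m .{{_ : ℕ.NonZero m}} → ι m * (i ℚ./ m) ≡ i ℚ./ 1
  /-spec i (suc m) = ℚ.toℚᵘ-injective (begin
    toℚᵘ (ι (suc m) * (i ℚ./ suc m)) ≈⟨ ℚ.toℚᵘ-homo-* (ι (suc m)) (i ℚ./ suc m) ⟩
    toℚᵘ (ι (suc m)) ℚᵘ.* toℚᵘ (i ℚ./ suc m) ≈⟨ ℚᵘ.*-cong (toℚᵘ-ι (suc m)) (ℚ.toℚᵘ-fromℚᵘ (mkℚᵘ i m)) ⟩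
    mkℚᵘ (ℤ.+ suc m) 0 ℚᵘ.* mkℚᵘ i m
      ≈⟨ ℚᵘ.*≡* (trans (ℤ.*-identityʳ _) (trans (ℤ.*-comm (ℤ.+ suc m) i) (cong (λ k → i ℤ.* ℤ.+ k) (sym (ℕ.*-identityˡ (suc m)))))) ⟩
    mkℚᵘ i 0 ≈⟨ ℚ.toℚᵘ-fromℚᵘ (mkℚᵘ i 0) ⟨
    toℚᵘ (i ℚ./ 1) ∎)
    where open ℚᵘ.≃-Reasoning

  /1-* : ∀ i j → (i ℤ.* j) ℚ./ 1 ≡ (i ℚ./ 1) * (j ℚ./ 1)
  /1-* i j = ℚ.toℚᵘ-injective (begin
    toℚᵘ ((i ℤ.* j) ℚ./ 1) ≈⟨ ℚ.toℚᵘ-fromℚᵘ (mkℚᵘ (i ℤ.* j) 0) ⟩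
    mkℚᵘ (i ℤ.* j) 0 ≈⟨ ℚᵘ.*≡* refl ⟩
    mkℚᵘ i 0 ℚᵘ.* mkℚᵘ j 0 ≈⟨ ℚᵘ.*-cong (ℚ.toℚᵘ-fromℚᵘ (mkℚᵘ i 0)) (ℚ.toℚᵘ-fromℚᵘ (mkℚᵘ j 0)) ⟨
    toℚᵘ (i ℚ./ 1) ℚᵘ.* toℚᵘ (j ℚ./ 1) ≈⟨ ℚ.toℚᵘ-homo-* (i ℚ./ 1) (j ℚ./ 1) ⟨
    toℚᵘ ((i ℚ./ 1) * (j ℚ./ 1)) ∎)
    where open ℚᵘ.≃-Reasoning

  module _ (z : ℤ) where
    open ≡-Reasoning

    !-t : ∀ n → ι (n ℕ.!) * t (z ℚ./ 1) n ≡ (z ℤ.^ n) ℚ./ 1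
    !-t zero    = trans (ℚ.*-identityʳ (ι 1)) ι-1
    !-t (suc n) = begin
      ι (suc n ℕ.* n ℕ.!) * (z′ * t z′ n * inv n) ≡⟨ cong (_* (z′ * t z′ n * inv n)) (ι-* (suc n) (n ℕ.!)) ⟩
      ι (suc n) * ι (n ℕ.!) * (z′ * t z′ n * inv n)
        ≡⟨ solve 5 (λ a b c d e → (a :* b) :* (c :* d :* e) := c :* (b :* d) :* (a :* e)) refl (ι (suc n)) (ι (n ℕ.!)) z′ (t z′ n) (inv n) ⟩
      z′ * (ι (n ℕ.!) * t z′ n) * (ι (suc n) * inv n) ≡⟨ cong₂ (λ a b → z′ * a * b) (!-t n) (ι-inv n) ⟩
      z′ * ((z ℤ.^ n) ℚ./ 1) * 1ℚ ≡⟨ ℚ.*-identityʳ _ ⟩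
      z′ * ((z ℤ.^ n) ℚ./ 1) ≡⟨ /1-* z (z ℤ.^ n) ⟨
      (z ℤ.^ suc n) ℚ./ 1 ∎
      where z′ = z ℚ./ 1

    term : ∀ n → ((z ℤ.^ n) ℚ./ (n ℕ.!)) {{n !≢0}} ≡ t (z ℚ./ 1) n
    term n = ℚ.≤-antisym (cancel (trans (/-spec (z ℤ.^ n) (n ℕ.!) {{n !≢0}}) (sym (!-t n))))
                         (cancel (trans (!-t n) (sym (/-spec (z ℤ.^ n) (n ℕ.!) {{n !≢0}}))))
      where
      cancel : ∀ {a b} → ι (n ℕ.!) * a ≡ ι (n ℕ.!) * b → a ≤ b
      cancel e = ℚ.*-cancelˡ-≤-pos (ι (n ℕ.!)) {{ι-pos (n ℕ.!) {{n !≢0}}}} (ℚ.≤-reflexive e)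

    expSum-E : ∀ n → expSum z n ≡ E (z ℚ./ 1) n
    expSum-E zero    = refl
    expSum-E (suc n) = trans (cong₂ _+_ (expSum-E n) (term (suc n))) (sym (cum-last (t (z ℚ./ 1)) n))

  -- e^{-2} ≤ (δ/(1+δ))^{2δ}, because (1 + 1/δ)^{2δ} ≤ e^2.
  exp[-2]≤ : ∀ δ {s} → (ι (suc δ) * inv (suc δ)) ** (2 ℕ.* suc δ) < s → exp -[1+ 1 ] <ℚ s
  exp[-2]≤ δ {s} c<s =
    let (v , c<v , v<s) = ℚ.<-dense c<s
        -- With z = 2 the terms of e^(2z) halve once the index reaches 4z = 8 = `suc 7`.
        (N , bound) = E-neg-limsup {ι 2} (ι≥0 2) 7 (ℚ.≤-reflexive (sym (trans (ι-+ 4 4) (cong₂ _+_ (ι-+ 2 2) (ι-+ 2 2)))))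
                        {c} {y} {m} (**-positive c₀>0 m) (**-positive y₀>0 m) (**-inverse {y₀} {c₀} y₀c₀ m)
                        (subst (λ z → y ≤ E z m) m*h≡2 ([1+h]^k≤E (inv-nonNeg δ) m)) c<v
    in v , v<s , N , λ n N≤n → subst (_≤ v) (sym (trans (expSum-E -[1+ 1 ] n) (cong (λ z → E z n) -2≡))) (bound n N≤n)
    where
    m = 2 ℕ.* suc δ
    c₀ = ι (suc δ) * inv (suc δ)
    y₀ = 1ℚ + inv δ
    c = c₀ ** m
    y = y₀ ** m

    -2≡ : -[1+ 1 ] ℚ./ 1 ≡ ℚ.- ι 2
    -2≡ = cong ℚ.-_ (sym (ι-def 2))

    inv>0 : ∀ n → 0ℚ < inv n
    inv>0 n with ℚ.<-cmp 0ℚ (inv n)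
    ... | tri< h _ _ = h
    ... | tri≈ _ e _ = contradiction (trans (sym (ℚ.*-zeroʳ (ι (suc n)))) (trans (cong (ι (suc n) *_) e) (ι-inv n))) λ ()
    ... | tri> _ _ h = contradiction (ℚ.<-≤-trans h (inv-nonNeg n)) (ℚ.<-irrefl refl)

    c₀>0 : 0ℚ < c₀
    c₀>0 = subst (_< c₀) (ℚ.*-zeroʳ (ι (suc δ))) (ℚ.*-monoʳ-<-pos (ι (suc δ)) {{ι-pos (suc δ)}} (inv>0 (suc δ)))

    y₀>0 : 0ℚ < y₀
    y₀>0 = ℚ.<-≤-trans (ℚ.*<* (ℤ.+<+ (ℕ.s≤s ℕ.z≤n))) (subst (_≤ y₀) (ℚ.+-identityʳ 1ℚ) (ℚ.+-monoʳ-≤ 1ℚ (inv-nonNeg δ)))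

    y₀c₀ : y₀ * c₀ ≡ 1ℚ
    y₀c₀ = begin
      (1ℚ + inv δ) * (ι (suc δ) * inv (suc δ))
        ≡⟨ solve 3 (λ a b c → (con 1ℚ :+ a) :* (b :* c) := (b :+ b :* a) :* c) refl (inv δ) (ι (suc δ)) (inv (suc δ)) ⟩
      (ι (suc δ) + ι (suc δ) * inv δ) * inv (suc δ) ≡⟨ cong (λ a → (ι (suc δ) + a) * inv (suc δ)) (ι-inv δ) ⟩
      (ι (suc δ) + 1ℚ) * inv (suc δ)
        ≡⟨ cong (_* inv (suc δ)) (trans (ℚ.+-comm (ι (suc δ)) 1ℚ) (sym (ι-suc (suc δ)))) ⟩
      ι (2 ℕ.+ δ) * inv (suc δ) ≡⟨ ι-inv (suc δ) ⟩
      1ℚ ∎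
      where open ≡-Reasoning

    m*h≡2 : ι m * inv δ ≡ ι 2
    m*h≡2 = trans (cong (_* inv δ) (ι-* 2 (suc δ))) (trans (ℚ.*-assoc (ι 2) (ι (suc δ)) (inv δ))
              (trans (cong (ι 2 *_) (ι-inv δ)) (ℚ.*-identityʳ (ι 2))))

  -- The argument `δ` is one less than the constant of the local lemma, which makes that constant
  -- visibly positive. A rational strictly between the bound c and the left side would exceed
  -- exp(-2) and contradict the hypothesis.
  ≤exp[-2]⇒≤ : ∀ D m Q .{{_ : ℕ.NonZero Q}} δ →
               (∀ {r} → exp -[1+ 1 ] <ℚ r → ι D * (ℤ.+ m ℚ./ Q) ≤ r) →
               D ℕ.* m ℕ.* (2 ℕ.+ δ) ℕ.^ (2 ℕ.* suc δ) ℕ.≤ Q ℕ.* suc δ ℕ.^ (2 ℕ.* suc δ)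
  ≤exp[-2]⇒≤ D m Q δ h = ι-cancel (begin
    ι (D ℕ.* m ℕ.* M) ≡⟨ trans (ι-* (D ℕ.* m) M) (cong (_* ι M) (ι-* D m)) ⟩
    ι D * ι m * ι M ≡⟨ cong (λ a → ι D * a * ι M) (trans (ι-def m) (sym (/-spec (ℤ.+ m) Q))) ⟩
    ι D * (ι Q * P) * ι M
      ≡⟨ solve 4 (λ a b c d → a :* (b :* c) :* d := (b :* d) :* (a :* c)) refl (ι D) (ι Q) P (ι M) ⟩
    (ι Q * ι M) * (ι D * P) ≤⟨ *-monoʳ (*-nonNeg (ι≥0 Q) (ι≥0 M)) DP≤c ⟩
    (ι Q * ι M) * c ≡⟨ ℚ.*-assoc (ι Q) (ι M) c ⟩
    ι Q * (ι M * c) ≡⟨ cong (ι Q *_) M*c ⟩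
    ι Q * ι (suc δ ℕ.^ e) ≡⟨ ι-* Q (suc δ ℕ.^ e) ⟨
    ι (Q ℕ.* suc δ ℕ.^ e) ∎)
    where
    open ℚ.≤-Reasoning
    e = 2 ℕ.* suc δ
    M = (2 ℕ.+ δ) ℕ.^ e
    P = ℤ.+ m ℚ./ Q
    c = (ι (suc δ) * inv (suc δ)) ** e

    DP≤c : ι D * P ≤ c
    DP≤c with ℚ.<-cmp c (ι D * P)
    ... | tri≈ _ eq _ = ℚ.≤-reflexive (sym eq)
    ... | tri> _ _ lt = ℚ.<⇒≤ lt
    ... | tri< lt _ _ = let (r , c<r , r<DP) = ℚ.<-dense lt in
      contradiction (ℚ.<-≤-trans r<DP (h (exp[-2]≤ δ c<r))) (ℚ.<-irrefl refl)

    M*c : ι M * c ≡ ι (suc δ ℕ.^ e)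
    M*c = begin-equality
      ι M * c ≡⟨ cong (_* c) (ι-** (2 ℕ.+ δ) e) ⟩
      ι (2 ℕ.+ δ) ** e * c ≡⟨ **-distrib (ι (2 ℕ.+ δ)) _ e ⟨
      (ι (2 ℕ.+ δ) * (ι (suc δ) * inv (suc δ))) ** e
        ≡⟨ cong (_** e) (trans (solve 3 (λ a b c → a :* (b :* c) := b :* (a :* c)) refl (ι (2 ℕ.+ δ)) (ι (suc δ)) (inv (suc δ)))
           (trans (cong (ι (suc δ) *_) (ι-inv (suc δ))) (ℚ.*-identityʳ (ι (suc δ))))) ⟩
      ι (suc δ) ** e ≡⟨ ι-** (suc δ) e ⟨
      ι (suc δ ℕ.^ e) ∎

-- Finite components from a separation of the graph.

module Separations (em : ∀ {ℓ} → ExcludedMiddle ℓ) (X : BorelSpace) (q : ℕ) where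
  open import Relation.Binary.Construct.Closure.ReflexiveTransitive using (Star; ε; _◅_)
  open Constraints X q
  open Adjacency X q
  open CSP X q
  open Graph X
  open BorelSpace X using (_≈_; _∈ˡ_; IsFinite)
  private module S = Setoid (setoid X)

  module _ (𝓑 : Subset Const) where

    power-≈ : ∀ {x y z} → x ≈ y → Power G[ 𝓑 ] 1 y z → x ≈ z ⊎ Power G[ 𝓑 ] 1 x z
    power-≈ e (y≉z , stop y≈z) = contradiction y≈z y≉z
    power-≈ {x} {y} {z} e (y≉z , step {y = v} (y≉v , B , b , d , d′) (stop v≈z)) = inj₂
      ( (λ x≈z → y≉z (S.trans (S.sym e) x≈z))
      , step ((λ x≈v → y≉v (S.trans (S.sym e) x≈v)) , B , b , dom-≈ {B} {y} {x} (S.sym e) d , d′) (stop v≈z))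

    star-≈ : ∀ {W : Subset X} {x y z} → W x → x ≈ y → Star (Induced (Power G[ 𝓑 ] 1) W) y z →
             ∃[ z′ ] z ≈ z′ × Star (Induced (Power G[ 𝓑 ] 1) W) x z′
    star-≈ w e ε = _ , S.sym e , ε
    star-≈ w e ((_ , u , p) ◅ c) = case power-≈ e p of λ
      { (inj₁ e′) → star-≈ w e′ c
      ; (inj₂ p′) → _ , S.refl , (w , u , p′) ◅ c }

    -- A step between equal points is not an edge of the power graph. It is dropped, and the
    -- following walk is moved to the other representative by `star-≈`, which may change the
    -- endpoint within its equality class.
    connected⇒star : ∀ {V W : Subset X} → V ⊆ W → ∀ {x y} → V x → Connected 𝓑 V x y →
                     ∃[ y′ ] y ≈ y′ × Star (Induced (Power G[ 𝓑 ] 1) W) x y′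
    connected⇒star V⊆W v ε = _ , S.refl , ε
    connected⇒star V⊆W {x} v (_◅_ {j = z} (_ , w , B , b , d , d′) c) =
      let (y′ , e , c′) = connected⇒star V⊆W w c in case em {P = x ≈ z} of λ
        { (no x≉z)  → y′ , e , (V⊆W v , V⊆W w , x≉z , step (x≉z , B , b , d , d′) (stop S.refl)) ◅ c′
        ; (yes x≈z) → let (y″ , e′ , c″) = star-≈ (V⊆W v) x≈z c′ in y″ , S.trans e e′ , c″ }

    connected-finite : ∀ {V W : Subset X} → V ⊆ W → ComponentFinite (Power G[ 𝓑 ] 1) W →
                       ∀ {x} → V x → IsFinite (Connected 𝓑 V x)
    connected-finite V⊆W finite v = let (xs , covers) = finite (V⊆W v) in
      xs , λ c → let (y′ , e , c′) = connected⇒star V⊆W v c in Any.map (S.trans e) (covers c′)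

    separation : asi G[ 𝓑 ] ≤ 1 → ∃[ U ] Borel X U × (∀ {x} → U x → IsFinite (Connected 𝓑 U x)) ×
                    (∀ {x} → ¬ U x → IsFinite (Connected 𝓑 (∁ U) x))
    separation asi with asi 1
    -- A single class is the whole space, so the complementary side is empty.
    ... | zero , _ , sep = U zero , borel zero , connected-finite id (componentFinite zero) ,
          λ {x} ¬u → case partition x of λ { (zero , u , _) → contradiction u ¬u }
      where open Separation sep
    ... | suc zero , _ , sep = U zero , borel zero , connected-finite id (componentFinite zero) ,
          connected-finite (λ {x} → rest x) (componentFinite (suc zero))
      where
      open Separation sep
      rest : ∀ x → ¬ U zero x → U (suc zero) x
      rest x ¬u = case partition x of λ { (zero , u , _) → contradiction u ¬u ; (suc zero , u , _) → u }
    ... | suc (suc _) , ℕ.s≤s () , _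

-- The hypothesis as an inequality between natural numbers.

module Smallness (q : ℕ) .{{_ : ℕ.NonZero q}} (X : BorelSpace) where
  open import Defs using (_≤_)
  open Constraints X q
  open Rationals
  open PowerSeries
  open CSP X q

  module _ {𝓑 : Subset Const} {d : ℕ} (small : (suc d ℕ.^ 2) · 𝗉 𝓑 ≤ exp -[1+ 1 ]) where

    ℙ-bound : ∀ {B} → 𝓑 B → ∀ {r} → exp -[1+ 1 ] <ℚ r → ι (suc d ℕ.^ 2) ℚ.* ℙ B ℚ.≤ r
    ℙ-bound {B} b {r} e = go (small e)
      where
      D = suc d ℕ.^ 2
      go : (D · 𝗉 𝓑) <ℚ r → ι D ℚ.* ℙ B ℚ.≤ r
      go (s₁ , s₁<r , s , (u , u<s , 0≤u , bound) , s₁≡) = ℚ.≤-trans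
        (*-monoʳ (ι≥0 D) (ℚ.≤-trans (bound {B} b) (ℚ.<⇒≤ u<s)))
        (ℚ.≤-trans (ℚ.≤-reflexive (trans (cong (ℚ._* s) (ι-def D)) (sym s₁≡))) (ℚ.<⇒≤ s₁<r))

    -- The constant δ below is max d 1: with no neighbours at all, the local
    -- lemma is applied with the weight 1/2 instead of 1.
    unlikely : ∀ {B} → 𝓑 B → let δ = suc (ℕ.pred d) in
      (suc δ ℕ.^ suc d) ℕ.* (suc δ ℕ.^ suc d) ℕ.* ∣ B ∣ᵉ ℕ.≤ (δ ℕ.^ d) ℕ.* (δ ℕ.^ d) ℕ.* q ℕ.^ ∣dom B ∣
    unlikely {B} b = rearrange d
      (≤exp[-2]⇒≤ (suc d ℕ.^ 2) ∣ B ∣ᵉ (q ℕ.^ ∣dom B ∣) {{ℕ.m^n≢0 q ∣dom B ∣}} (ℕ.pred d) (ℙ-bound {B} b))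
      where
      open +-*-Solver using (solve; _:*_; _:=_; con)
      open ℕ.≤-Reasoning

      rearrange : ∀ d {m Q} → let δ = suc (ℕ.pred d) in
        suc d ℕ.^ 2 ℕ.* m ℕ.* suc δ ℕ.^ (2 ℕ.* δ) ℕ.≤ Q ℕ.* δ ℕ.^ (2 ℕ.* δ) →
        (suc δ ℕ.^ suc d) ℕ.* (suc δ ℕ.^ suc d) ℕ.* m ℕ.≤ (δ ℕ.^ d) ℕ.* (δ ℕ.^ d) ℕ.* Q
      -- Here δ = 1, and both inequalities say that m/Q is at most (1/2)².
      rearrange zero {m} {Q} h = begin
        4 ℕ.* m ≡⟨ solve 1 (λ m → con 4 :* m := con 1 :* m :* con 4) refl m ⟩
        1 ℕ.* m ℕ.* 4 ≤⟨ h ⟩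
        Q ℕ.* 1 ≡⟨ ℕ.*-comm Q 1 ⟩
        1 ℕ.* Q ∎
      rearrange (suc n) {m} {Q} h = begin
        (D ℕ.* D ℕ.^ suc n) ℕ.* (D ℕ.* D ℕ.^ suc n) ℕ.* m
          ≡⟨ solve 3 (λ a b m → (a :* b) :* (a :* b) :* m := (a :* (a :* con 1)) :* m :* (b :* b)) refl D (D ℕ.^ suc n) m ⟩
        D ℕ.^ 2 ℕ.* m ℕ.* (D ℕ.^ suc n ℕ.* D ℕ.^ suc n) ≡⟨ cong (D ℕ.^ 2 ℕ.* m ℕ.*_) (double D) ⟩
        D ℕ.^ 2 ℕ.* m ℕ.* D ℕ.^ (2 ℕ.* suc n) ≤⟨ h ⟩
        Q ℕ.* suc n ℕ.^ (2 ℕ.* suc n) ≡⟨ trans (ℕ.*-comm Q _) (cong (ℕ._* Q) (sym (double (suc n)))) ⟩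
        (suc n ℕ.^ suc n) ℕ.* (suc n ℕ.^ suc n) ℕ.* Q ∎
        where
        D = suc (suc n)
        double : ∀ a → a ℕ.^ suc n ℕ.* a ℕ.^ suc n ≡ a ℕ.^ (2 ℕ.* suc n)
        double a = trans (sym (ℕ.^-distribˡ-+-* a (suc n) (suc n))) (cong (λ k → a ℕ.^ (suc n ℕ.+ k)) (sym (ℕ.+-identityʳ (suc n))))

-- The two rounds and the solution.

module Solution (em : ∀ {ℓ} → ExcludedMiddle ℓ) (q : ℕ) .{{_ : ℕ.NonZero q}} (X : BorelSpace) (std : IsStandardBorel X) where
  open import Data.Nat.Base using (_+_; _*_; _^_; _≤_; _<_; z≤n; s≤s; NonZero; >-nonZero⁻¹)
  open import Data.Nat.Properties
  open Countability
  open Indicator em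
  open Analyticity em
  open BiAnalyticity em
  open BorelAlgebra em X
  open StandardBorelSpaces em X std
  open FiniteSums
  open Counting em
  open Constraints X q
  open Counts em X q
  open Points em X q
  open Adjacency X q
  open ConstraintCodes em X std q
  open Selection em X std q
  open Components em X q
  open Integration em (setoid X) q
  open CSP X q
  open BorelSpace X using (_≈_; IsFinite)
  private
    module S = Setoid (setoid X)
    module C = Setoid (setoid Const)

  violates⇒count : ∀ {h B} → Violates h B → 0 < count (λ _ → ⊤) h B
  violates⇒count {h} {B} (g , (i , e) , graph-g) = <-≤-trans
    (≤-reflexive (sym (⟦⟧-yes agrees)))
    (term≤sum (λ i → ⟦ Agrees (λ _ → ⊤) h (element B i) ⟧) i)
    where
    term≤sum : ∀ {n} (φ : Fin n → ℕ) i → φ i ≤ sum φ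
    term≤sum φ zero    = m≤m+n (φ zero) _
    term≤sum φ (suc i) = ≤-trans (term≤sum (φ ∘ suc) i) (m≤n+m _ (φ zero))

    agrees : Agrees (λ _ → ⊤) h (element B i)
    agrees j _ = proj₂ (Equivalence.to graph-g (member {g} {element B i} e))
      where
      member : ∀ {g g′ : Point PartialFunction} {j} → Setoid._≈_ (setoid PartialFunction) g g′ →
               FiniteSubset._∈ᶠ_ (X ⊗ discrete (Fin q)) (pt g′ j , lab g′ j) (graph g)
      member {j = j} (same (_ , from)) = let (k , e , l) = from j in k , S.sym e , sym l

  module _ {W V W′ : Subset X} (W-resp : ∀ {x y} → x ≈ y → W x → W y)
    (disjoint : ∀ {x} → V x → ¬ W x) (V-resp : ∀ {x y} → x ≈ y → V x → V y)
    (W′-contains : ∀ {x} → W x ⊎ V x → W′ x) where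

    -- Each element of `B` prescribes the values on `V`, so among all choices of these values it
    -- survives at most once, and only if it agreed on `W` before.
    I-count : ∀ B f → I (domPoints V B) (λ h → count W′ h B) f ≤ count W f B
    I-count B f = ≤-trans (≤-reflexive (I-sum D (λ i h → ⟦ Agrees W′ h (element B i) ⟧) f))
      (sum-mono λ i → ≤-trans
        (I-mono D (λ h → ⟦⟧-mono λ ag j → ag j ∘ W′-contains ∘ Sum.map₂ in-V) f)
        (I-agrees (element B i) D {W} W-resp (domPoints-unique V B)
          (All.map (λ {x} (v , d) → disjoint v , dom⇒all {B} {x} d i) (domPoints-sound V B)) f))
      where
      D = domPoints V B
      in-V : ∀ {y} → Any (_≈ y) D → V y
      in-V m = let ((v , _) , e) = All.lookupAny (domPoints-sound V B) m in V-resp e v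

  count≤ : ∀ W h B → count W h B ≤ ∣ B ∣ᵉ
  count≤ W h B = ≤-trans
    (sum-mono {∣ B ∣ᵉ} {λ i → ⟦ Agrees W h (element B i) ⟧} {λ _ → 1} λ i → ⟦⟧≤1 {Agrees W h (element B i)})
    (≤-reflexive (trans (sum-const ∣ B ∣ᵉ 1) (*-identityʳ ∣ B ∣ᵉ)))

  width≡0 : ∀ W B → (∀ {x} → dom B x → ¬ W x) → width W B ≡ 0
  width≡0 W B none = trans (sym (length-domPoints W B)) (no-points (domPoints-sound W B))
    where
    no-points : ∀ {xs} → All (λ x → W x × dom B x) xs → length xs ≡ 0
    no-points []            = refl
    no-points ((w , d) ∷ _) = contradiction w (none d)

  module Stages {𝓑 : Subset Const} (𝓑-borel : Borel Const 𝓑) {d : ℕ} (deg : DegreeBound 𝓑 d)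
    (δ : ℕ) .{{_ : NonZero δ}}
    (unlikely : ∀ {B} → 𝓑 B → (suc δ ^ suc d) * (suc δ ^ suc d) * ∣ B ∣ᵉ ≤ (δ ^ d) * (δ ^ d) * q ^ ∣dom B ∣)
    {U : Subset X} (U-borel : Borel X U)
    (U-finite : ∀ {x} → U x → IsFinite (Connected 𝓑 U x))
    (∁U-finite : ∀ {x} → ¬ U x → IsFinite (Connected 𝓑 (∁ U) x))
    where
    open ≤-Reasoning
    open +-*-Solver using (solve; _:*_; _:=_)

    private
      -- K / M is the constant c, both the threshold for conditional probabilities and the bound of
      -- the local lemma.
      M K : ℕ
      M = suc δ ^ suc d
      K = δ ^ d

      instance
        K≢0 : NonZero K
        K≢0 = m^n≢0 δ d

      K<M : K < M
      K<M = begin-strict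
        δ ^ d ≤⟨ ^-monoˡ-≤ d (n≤1+n δ) ⟩
        suc δ ^ d ≡⟨ *-identityˡ _ ⟨
        1 * suc δ ^ d <⟨ *-monoˡ-< (suc δ ^ d) {{m^n≢0 (suc δ) d}} (s≤s (>-nonZero⁻¹ δ)) ⟩
        suc δ * suc δ ^ d ∎

      U-resp : ∀ {x y} → x ≈ y → U x → U y
      U-resp = BorelSpace.respects X U-borel

      ∁U-borel : Borel X (∁ U)
      ∁U-borel = BorelSpace.∁-Borel X U-borel

      ∁U-resp : ∀ {x y} → x ≈ y → ¬ U x → ¬ U y
      ∁U-resp = BorelSpace.respects X ∁U-borel

      𝓑-resp : ∀ {B B′} → B C.≈ B′ → 𝓑 B → 𝓑 B′
      𝓑-resp {B} {B′} = BorelSpace.respects Const 𝓑-borel {B} {B′}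

      𝓑-an : Analytic Constᶜ 𝓑
      𝓑-an = proj₁ (Suslin.borel-bi suslin-Const 𝓑-borel)

      bi : ∀ {A} → Borel X A → Bi Xᶜ A
      bi = Suslin.borel-bi suslin

      -- Bad₁ h B says that, given the values of h on U, the constraint B is
      -- violated with conditional probability more than K/M; Bad₂ h B says
      -- that h violates B.
      Bad₁ Bad₂ : (Point X → Fin q) → Subset Const
      Bad₁ h B = K * q ^ width (∁ U) B < M * count U h B
      Bad₂ h B = 0 < count (λ _ → ⊤) h B

      bad₁-an : ∀ {h} → BorelFun h → Analytic Constᶜ (Bad₁ h)
      bad₁-an h-borel = proj₁ (simple-rel (width-simple (bi ∁U-borel)) (count-simple (bi U-borel) (bi ∘ h-borel))
        (λ w c → K * q ^ w < M * c))

      bad₂-an : ∀ {h} → BorelFun h → Analytic Constᶜ (Bad₂ h)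
      bad₂-an h-borel = proj₁ (simple-rel (simple-const 0) (count-simple (bi-const ⊤) (bi ∘ h-borel)) _<_)

      bad₁-local : ∀ {h h′ B} → (∀ {x} → dom B x → h x ≡ h′ x) → Bad₁ h B → Bad₁ h′ B
      bad₁-local {h} {h′} {B} e lt = <-≤-trans lt (*-monoʳ-≤ M (count-local {U} {h} {h′} {B} λ _ → e))

      bad₂-local : ∀ {h h′ B} → (∀ {x} → dom B x → h x ≡ h′ x) → Bad₂ h B → Bad₂ h′ B
      bad₂-local {h} {h′} {B} e lt = <-≤-trans lt (count-local {λ _ → ⊤} {h} {h′} {B} λ _ → e)

      bad₁-≈ : ∀ {h B B′} → (∀ {x y} → x ≈ y → h x ≡ h y) → B C.≈ B′ → Bad₁ h B → Bad₁ h B′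
      bad₁-≈ {h} {B} {B′} h-resp e lt = begin-strict
        K * q ^ width (∁ U) B′ ≤⟨ *-monoʳ-≤ K (^-monoʳ-≤ q (width-≈ ∁U-resp {B′} {B} (C.sym {B} {B′} e))) ⟩
        K * q ^ width (∁ U) B <⟨ lt ⟩
        M * count U h B ≤⟨ *-monoʳ-≤ M (count-≈ U-resp {h} {B} {B′} h-resp e) ⟩
        M * count U h B′ ∎

      bad₂-≈ : ∀ {h B B′} → (∀ {x y} → x ≈ y → h x ≡ h y) → B C.≈ B′ → Bad₂ h B → Bad₂ h B′
      bad₂-≈ {h} {B} {B′} h-resp e lt = <-≤-trans lt (count-≈ {λ _ → ⊤} (λ _ _ → tt) {h} {B} {B′} h-resp e)

      rare₁ : ∀ f {B} → 𝓑 B → M * I (domPoints U B) (λ h → ⟦ Bad₁ h B ⟧) f ≤ K * q ^ length (domPoints U B)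
      rare₁ f {B} b = *-cancelˡ-≤ (K * Q) {{m*n≢0 K Q {{K≢0}} {{m^n≢0 q (width (∁ U) B)}}}} (begin
        K * Q * (M * I D (λ h → ⟦ Bad₁ h B ⟧) f)
          ≡⟨ solve 3 (λ a b c → a :* (b :* c) := b :* (a :* c)) refl (K * Q) M (I D (λ h → ⟦ Bad₁ h B ⟧) f) ⟩
        M * (K * Q * I D (λ h → ⟦ Bad₁ h B ⟧) f) ≡⟨ cong (M *_) (I-* D (K * Q) (λ h → ⟦ Bad₁ h B ⟧) f) ⟨
        M * I D (λ h → K * Q * ⟦ Bad₁ h B ⟧) f ≤⟨ *-monoʳ-≤ M (I-mono D markov f) ⟩
        M * I D (λ h → M * count U h B) f ≡⟨ cong (M *_) (I-* D M (λ h → count U h B) f) ⟩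
        M * (M * I D (λ h → count U h B) f) ≡⟨ *-assoc M M _ ⟨
        -- With no values fixed beforehand, every element of `B` is counted at most once.
        M * M * I D (λ h → count U h B) f ≤⟨ *-monoʳ-≤ (M * M) (≤-trans
            (I-count {λ _ → ⊥} (λ _ ()) (λ _ ()) U-resp (λ { (inj₂ u) → u }) B f) (count≤ (λ _ → ⊥) f B)) ⟩
        M * M * ∣ B ∣ᵉ ≤⟨ unlikely {B} b ⟩
        K * K * q ^ ∣dom B ∣ ≡⟨ cong (λ n → K * K * q ^ n) (sym (width-split U B)) ⟩
        K * K * q ^ (width U B + width (∁ U) B) ≡⟨ cong (K * K *_) (^-distribˡ-+-* q (width U B) (width (∁ U) B)) ⟩
        K * K * (q ^ width U B * Q) ≡⟨ cong (λ n → K * K * (q ^ n * Q)) (length-domPoints U B) ⟨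
        K * K * (q ^ length D * Q)
          ≡⟨ solve 3 (λ a b c → a :* a :* (b :* c) := a :* c :* (a :* b)) refl K (q ^ length D) Q ⟩
        K * Q * (K * q ^ length D) ∎)
        where
        D = domPoints U B
        Q = q ^ width (∁ U) B
        markov : ∀ h → K * Q * ⟦ Bad₁ h B ⟧ ≤ M * count U h B
        markov h = case em {P = Bad₁ h B} of λ
          { (yes bad) → ≤-trans (≤-reflexive (trans (cong (K * Q *_) (⟦⟧-yes bad)) (*-identityʳ _))) (<⇒≤ bad)
          ; (no ¬bad) → ≤-trans (≤-reflexive (trans (cong (K * Q *_) (⟦⟧-no ¬bad)) (*-zeroʳ (K * Q)))) z≤n }

      f₀ : Point X → Fin q
      f₀ _ = Fin.fromℕ< (>-nonZero⁻¹ q)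

      f₀-borel : BorelFun f₀
      f₀-borel a = borel-const _

      stage₁ : ∃[ h ] BorelFun h × (∀ {y} → ¬ U y → h y ≡ f₀ y) × (∀ {B x} → 𝓑 B → dom B x → U x → ¬ Bad₁ h B)
      stage₁ = selection U-borel {f₀} f₀-borel 𝓑-an {Bad₁} bad₁-an (λ {h} {h′} {B} → bad₁-local {h} {h′} {B}) U-finite
        λ u → component-solution (λ {B} {B′} → 𝓑-resp {B} {B′}) {d} (λ {B} → deg {B}) U-resp Bad₁
          (λ {h} {h′} {B} → bad₁-local {h} {h′} {B}) (λ {h} {B} {B′} → bad₁-≈ {h} {B} {B′})
          δ {f₀} (λ _ → refl) (λ {B} → rare₁ f₀ {B}) (U-finite u)

      h₁ : Point X → Fin q
      h₁ = proj₁ stage₁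

      -- The first round treats only constraints that meet `U`. For any other the conditional
      -- probability is the original one, at most c² ≤ c.
      good₁ : ∀ {B} → 𝓑 B → M * count U h₁ B ≤ K * q ^ width (∁ U) B
      good₁ {B} b = case em {P = ∃[ x ] dom B x × U x} of λ
        { (yes (x , e , u)) → ≮⇒≥ (proj₂ (proj₂ (proj₂ stage₁)) {B} {x} b e u)
        ; (no none) → *-cancelˡ-≤ K (begin
            K * (M * count U h₁ B) ≤⟨ *-mono-≤ (<⇒≤ K<M) (*-monoʳ-≤ M (count≤ U h₁ B)) ⟩
            M * (M * ∣ B ∣ᵉ) ≡⟨ *-assoc M M _ ⟨
            M * M * ∣ B ∣ᵉ ≤⟨ unlikely {B} b ⟩
            K * K * q ^ ∣dom B ∣ ≡⟨ cong (λ n → K * K * q ^ n) (trans (sym (width-split U B))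
                    (cong (_+ width (∁ U) B) (width≡0 U B λ {x} e u → none (x , e , u)))) ⟩
            K * K * q ^ width (∁ U) B ≡⟨ *-assoc K K _ ⟩
            K * (K * q ^ width (∁ U) B) ∎) }

      -- A violated constraint has at least one element that agrees everywhere, so the expected
      -- number of such elements bounds the probability of violation; by `good₁` it is at most c.
      rare₂ : ∀ {B} → 𝓑 B → M * I (domPoints (∁ U) B) (λ h → ⟦ Bad₂ h B ⟧) h₁ ≤ K * q ^ length (domPoints (∁ U) B)
      rare₂ {B} b = begin
        M * I D (λ h → ⟦ Bad₂ h B ⟧) h₁ ≤⟨ *-monoʳ-≤ M (I-mono D positive h₁) ⟩
        M * I D (λ h → count (λ _ → ⊤) h B) h₁ ≤⟨ *-monoʳ-≤ M (I-count U-resp id ∁U-resp (λ _ → tt) B h₁) ⟩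
        M * count U h₁ B ≤⟨ good₁ {B} b ⟩
        K * q ^ width (∁ U) B ≡⟨ cong (λ n → K * q ^ n) (length-domPoints (∁ U) B) ⟨
        K * q ^ length D ∎
        where
        D = domPoints (∁ U) B
        positive : ∀ h → ⟦ Bad₂ h B ⟧ ≤ count (λ _ → ⊤) h B
        positive h = case em {P = Bad₂ h B} of λ
          { (yes bad) → ≤-trans (≤-reflexive (⟦⟧-yes bad)) bad
          ; (no ¬bad) → ≤-trans (≤-reflexive (⟦⟧-no ¬bad)) z≤n }

      stage₂ : ∃[ h ] BorelFun h × (∀ {y} → ¬ ¬ U y → h y ≡ h₁ y) × (∀ {B x} → 𝓑 B → dom B x → ¬ U x → ¬ Bad₂ h B)
      stage₂ = selection ∁U-borel {h₁} h₁-borel 𝓑-an {Bad₂} bad₂-an (λ {h} {h′} {B} → bad₂-local {h} {h′} {B}) ∁U-finite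
        λ u → component-solution (λ {B} {B′} → 𝓑-resp {B} {B′}) {d} (λ {B} → deg {B}) ∁U-resp Bad₂
          (λ {h} {h′} {B} → bad₂-local {h} {h′} {B}) (λ {h} {B} {B′} → bad₂-≈ {h} {B} {B′})
          δ {h₁} (borelFun-resp h₁-borel) (λ {B} → rare₂ {B}) (∁U-finite u)
        where
        h₁-borel : BorelFun h₁
        h₁-borel = proj₁ (proj₂ stage₁)

    solve-CSP : ∃[ h ] BorelFun h × IsSolution 𝓑 h
    solve-CSP = h₂ , proj₁ (proj₂ stage₂) , λ {B} b violates → good₂ {B} b (violates⇒count {h₂} {B} violates)
      where
      h₂ : Point X → Fin q
      h₂ = proj₁ stage₂

      -- A constraint inside `U` was untouched by the second round. Were it violated, its
      -- conditional probability after the first round would be at least 1, whereas `good₁` bounds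
      -- it by K / M < 1.
      good₂ : ∀ {B} → 𝓑 B → ¬ Bad₂ h₂ B
      good₂ {B} b bad = case em {P = ∃[ x ] dom B x × ¬ U x} of λ
        { (yes (x , e , ¬u)) → proj₂ (proj₂ (proj₂ stage₂)) {B} {x} b e ¬u bad
        ; (no none) → <-irrefl refl (begin-strict
            M ≡⟨ *-identityʳ M ⟨
            M * 1 ≤⟨ *-monoʳ-≤ M bad ⟩
            M * count (λ _ → ⊤) h₂ B ≤⟨ *-monoʳ-≤ M (within {B} λ {x} e → dne λ ¬u → none (x , e , ¬u)) ⟩
            M * count U h₁ B ≤⟨ good₁ {B} b ⟩
            K * q ^ width (∁ U) B ≡⟨ cong (λ n → K * q ^ n) (width≡0 (∁ U) B λ {x} e ¬u → none (x , e , ¬u)) ⟩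
            K * 1 ≡⟨ *-identityʳ K ⟩
            K <⟨ K<M ⟩
            M ∎) }
        where
        within : ∀ {B} → (∀ {x} → dom B x → U x) → count (λ _ → ⊤) h₂ B ≤ count U h₁ B
        within {B} inside = ≤-trans
          (sum-mono {∣ B ∣ᵉ} {λ i → ⟦ Agrees (λ _ → ⊤) h₂ (element B i) ⟧} {λ i → ⟦ Agrees U h₂ (element B i) ⟧}
            λ i → ⟦⟧-mono λ ag j _ → ag j tt)
          (count-local {U} {h₂} {h₁} {B} λ u _ → proj₁ (proj₂ (proj₂ stage₂)) λ ¬u → ¬u u)

  toFunc : ∀ {h} → BorelFun h → Func (setoid X) (setoid (discrete (Fin q)))
  toFunc {h} h-borel = record { to = h ; cong = borelFun-resp h-borel }

  toFunc-borel : ∀ {h} (h-borel : BorelFun h) → IsBorelMap X (discrete (Fin q)) (toFunc h-borel)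
  toFunc-borel h-borel {A} _ = BorelSpace.resp-≐ X ((λ { (a , x , refl) → x }) , λ x → _ , x , refl)
    (borel-⋃ (Fin-countable q) λ a → borel-∩ (borel-const (A a)) (h-borel a))

open import Defs using (_≤_)

corollary1p30 :
    (∀ {ℓ} → ExcludedMiddle ℓ) →
    (q : ℕ) .{{_ : ℕ.NonZero q}} (X : BorelSpace) → IsStandardBorel X →
    let open CSP X q
        open Graph X in
    (𝓑 : Pred (Point Const) 0ℓ) → Borel Const 𝓑 →
    asi G[ 𝓑 ] ≤ 1 →
    (d : ℕ) → 𝖽 𝓑 ≡ d →
    (suc d ℕ.^ 2) · 𝗉 𝓑 ≤ exp -[1+ 1 ] →
    ∃[ f ] IsBorelMap X (discrete (Fin q)) f × IsSolution 𝓑 (Func.to f)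
corollary1p30 em q X std 𝓑 𝓑-borel asi d (deg , _) small =
  let (U , U-borel , U-finite , ∁U-finite) = separation 𝓑 asi
      (h , h-borel , solution) = Stages.solve-CSP {𝓑} 𝓑-borel {d} (λ {B} → deg {B}) (suc (ℕ.pred d))
        (λ {B} → unlikely {𝓑} {d} small {B}) {U} U-borel U-finite ∁U-finite
  in toFunc h-borel , (λ {A} → toFunc-borel h-borel {A}) , λ {B} → solution {B}
  where
  open Separations em X q
  open Smallness q X
  open Solution em q X std
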